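{- Let $p$ be a prime, $n\in\mathbb{N}$, and let $F=\mathbb{F}_{p^n}$ be the finite field with $p^n$ elements. Suppose that $A$ is a subset of $F^*=F\setminus\{0\}$ with the following property: for any subfield $G\subset F$ and any elements $c,d\in F$, $$|A\cap(cG+d)|\leq \max\{|G|^{14/25},|A|^{6/7}\},$$ where $cG+d=\{cg+d: g\in G\}$. Then $$\max\{|A+A|,|A\cdot A|\}\gg \frac{|A|^{15/14}}{\log|A|},$$ where $A+A=\{a+b:a,b\in A\}$ and $A\cdot A=\{ab:a,b\in A\}$.
   Context: The notation $X\gg Y$ means that there is an absolute constant $C>0$ (independent of $p$, $n$ and $A$) such that $X\geq Y/C$. -}

module Defs where

open import Data.Nat using (ℕ)
open import Data.Fin using (Fin)
open import Data.Fin.Properties as FinP using ()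
open import Data.Bool using (Bool; true; false; _∧_)
open import Data.List using (List; map; length; filterᵇ)
open import Data.Bool.ListAction using (any)
open import Data.List.Base using (allFin)
open import Data.Product using (∃; _,_)
open import Relation.Binary.PropositionalEquality using (_≡_; _≢_; cong; sym; trans)
open import Relation.Nullary using (Dec; yes; no; does)
open import Relation.Nullary.Decidable using (map′)
open import Function.Bundles using (_↔_; Inverse)
open import Algebra.Core using (Op₁; Op₂)
open import Algebra.Structures using (IsCommutativeRing)

record FiniteField (q : ℕ) : Set₁ where
  infixl 7 _*_
  infixl 6 _+_
  field
    Carrier : Set
    _+_ _*_ : Op₂ Carrier
    -_      : Op₁ Carrier
    0# 1#   : Carrier
    isCommutativeRing : IsCommutativeRing _≡_ _+_ _*_ -_ 0# 1#
    0≢1     : 0# ≢ 1#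
    inverse : ∀ x → x ≢ 0# → ∃ λ y → x * y ≡ 1#
    enum    : Fin q ↔ Carrier

  open Inverse enum using (to; from; strictlyInverseˡ)

  _≟_ : (x y : Carrier) → Dec (x ≡ y)
  x ≟ y = map′ (λ e → trans (sym (strictlyInverseˡ _ )) (trans (cong to e) (strictlyInverseˡ _)))
               (cong from) (from x FinP.≟ from y)

  elems : List Carrier
  elems = map to (allFin q)

  Subset : Set
  Subset = Carrier → Bool

  ∣_∣ : Subset → ℕ
  ∣ S ∣ = length (filterᵇ S elems)

  _∩_ : Subset → Subset → Subset
  (S ∩ T) x = S x ∧ T x

  sumset : Subset → Subset
  sumset A x = any (λ a → A a ∧ any (λ b → A b ∧ does ((a + b) ≟ x)) elems) elems

  prodset : Subset → Subset
  prodset A x = any (λ a → A a ∧ any (λ b → A b ∧ does ((a * b) ≟ x)) elems) elems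

  affine : Carrier → Subset → Carrier → Subset
  affine c G d x = any (λ g → G g ∧ does ((c * g + d) ≟ x)) elems

  record IsSubfield (G : Subset) : Set where
    field
      has-0   : G 0# ≡ true
      has-1   : G 1# ≡ true
      +-closed : ∀ x y → G x ≡ true → G y ≡ true → G (x + y) ≡ true
      neg-closed : ∀ x → G x ≡ true → G (- x) ≡ true
      *-closed : ∀ x y → G x ≡ true → G y ≡ true → G (x * y) ≡ true
      inv-closed : ∀ x y → G x ≡ true → x * y ≡ 1# → G y ≡ true

{-# OPTIONS --safe #-}
-- Put K = M / |A| with M = max(|A + A|, |A · A|) and L = log |A|. Multiplicative energy and a dyadic pigeonholing give,
-- after rescaling A, a set B ⊆ A with |A ∩ bA| ≥ N for b ∈ B, where |B| N ≫ |A|² / K L and N ≫ |A| / K. By Plünnecke and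
-- Ruzsa, |A ± bA| ≪ M² / N, so |A + xA| ≪ M⁸ / |A|³ N⁴ =: W for every x in the quotient set R = (B − B) / (B − B), whereas
-- |U + yV| = |U| |V| for U, V ⊆ B whenever y ∉ R. If x ∈ R but x + 1 ∉ R, then |B|³ ≪ M W. If x ∈ R and β ∈ B but β x ∉ R,
-- then |B|² N ≪ M W. If neither happens, R is a subfield containing B: averaging |B + xB| over x ∈ R gives
-- min(|B|², |R|) ≪ W, and point-line incidences over R give |R| |E| ≪ M² or |E|⁴ ≪ M² |R| for E = A ∩ R ⊇ B. By hypothesis
-- |E| ≤ |A|^(6/7), or |E| ≤ |R|^(14/25), which disposes of the first alternative. In all cases |A| ≪ K¹⁴ L¹⁴.

module Submission where

open import Defs
open import Algebra.Bundles using (CommutativeRing; RawRing)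
import Algebra.Properties.Ring
import Algebra.Properties.Semiring.Mult
import Algebra.Solver.Ring
open import Algebra.Solver.Ring.AlmostCommutativeRing using (fromCommutativeRing; AlmostCommutativeRing; _-Raw-AlmostCommutative⟶_)
import Algebra.Solver.Ring.NaturalCoefficients.Default
open import Data.Bool using (Bool; true; false; _∧_; _∨_; if_then_else_)
open import Data.Bool.ListAction using (any)
import Data.Bool.Properties as Bool
open import Data.Fin using (Fin; toℕ)
import Data.Fin.Properties as Fin
open import Data.List using (List; []; _∷_; map; length; filterᵇ)
open import Data.List.Membership.Propositional using () renaming (_∈_ to _∈ˡ_)
open import Data.List.Membership.Propositional.Properties using (∈-map⁺; ∈-allFin)
open import Data.List.Relation.Unary.All as All using (All; []; _∷_)
open import Data.List.Relation.Unary.AllPairs using ([]; _∷_)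
open import Data.List.Relation.Unary.Any using (here; there)
open import Data.List.Relation.Unary.Unique.Propositional using (Unique)
open import Data.List.Relation.Unary.Unique.Propositional.Properties using (map⁺; allFin⁺)
open import Data.Maybe using (Maybe; just; nothing)
open import Data.Nat
open import Data.Nat.DivMod using (_/_; _%_; m/n*n≤m; m≡m%n+[m/n]*n; m%n<n)
open import Data.Nat.ListAction using (sum)
open import Data.Nat.Logarithm using (⌊log₂_⌋; ⌊log₂⌋-mono-≤; ⌊log₂[2^n]⌋≡n)
open import Data.Nat.Primality using (Prime)
open import Data.Nat.Properties
open import Data.Nat.Solver using (module +-*-Solver)
open import Data.Nat.Tactic.RingSolver using (solve-∀)
open import Data.Product using (∃; ∃₂; _×_; _,_; proj₁; proj₂)
open import Data.Sum using (_⊎_; inj₁; inj₂; [_,_]′)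
open import Function using (_∘_; id)
open import Function.Bundles using (Inverse)
open import Relation.Binary.Definitions using (DecidableEquality)
open import Relation.Binary.PropositionalEquality hiding ([_])
open import Relation.Nullary using (Dec; yes; no; does; ¬_; contradiction)
open import Relation.Nullary.Decidable using (dec-true; dec-false; map′; decidable-stable; from-yes; _×-dec_; ¬?)

-- Sums over lists

-- The pivot is that `y` lies outside `quotients B` exactly when (u , v) ↦ u + y v is injective on B
-- × B. Outside, sumsets with dilates are as large as possible; inside, clearing the denominator
-- turns A + xA into a sum of four popular dilates, so it is small. A step from inside to outside,
-- by x ↦ x + 1 or by x ↦ β x, plays the two facts against each other. The obstacle is that no step
-- may lead outside: then A may genuinely concentrate on a dilate of a subfield, and this is where
-- the hypothesis enters. The exponent 14 is forced by the step x ↦ β x and by the subfield case in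
-- which |E|⁴ ≪ M² |R| and |R| ≤ |B|²; all other cases leave room. Everything is carried out in ℕ:
-- ratios are cross-multiplied, fractional exponents are cleared, and second-moment arguments are
-- arranged without subtraction. The minimiser behind Plünnecke's inequality ranges over all subsets
-- and is obtained only under double negation; this is harmless, because it only serves to prove
-- decidable inequalities between numbers.

⟦_⟧ : Bool → ℕ
⟦ b ⟧ = if b then 1 else 0

⟦⟧-mono : ∀ {a b} → (a ≡ true → b ≡ true) → ⟦ a ⟧ ≤ ⟦ b ⟧
⟦⟧-mono {false} _ = z≤n
⟦⟧-mono {true} h rewrite h refl = ≤-refl

1≤⟦⟧⇒ : ∀ {b} → 1 ≤ ⟦ b ⟧ → b ≡ true
1≤⟦⟧⇒ {true} _ = refl

⟦∧⟧ : ∀ a b → ⟦ a ∧ b ⟧ ≡ ⟦ a ⟧ * ⟦ b ⟧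
⟦∧⟧ false _ = refl
⟦∧⟧ true b = sym (+-identityʳ ⟦ b ⟧)

∧-elim : ∀ {a b} → a ∧ b ≡ true → a ≡ true × b ≡ true
∧-elim {true} e = refl , e

∧-intro : ∀ {a b} → a ≡ true → b ≡ true → a ∧ b ≡ true
∧-intro refl refl = refl

bool-ext : ∀ {a b} → (a ≡ true → b ≡ true) → (b ≡ true → a ≡ true) → a ≡ b
bool-ext {false} {false} _ _ = refl
bool-ext {true} f _ = sym (f refl)
bool-ext {false} {true} _ g = g refl

does⇒ : ∀ {p} {P : Set p} (d : Dec P) → does d ≡ true → P
does⇒ (yes x) _ = x

2ab≤a²+b² : ∀ a b → 2 * (a * b) ≤ a * a + b * b
2ab≤a²+b² a b with ≤-total a b
... | inj₁ a≤b = subst (λ b → 2 * (a * b) ≤ a * a + b * b) (m+[n∸m]≡n a≤b) (ordered a (b ∸ a))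
  where
  ordered : ∀ a d → 2 * (a * (a + d)) ≤ a * a + (a + d) * (a + d)
  ordered a d = subst (2 * (a * (a + d)) ≤_) (e a d) (m≤m+n _ (d * d))
    where
    e : ∀ a d → 2 * (a * (a + d)) + d * d ≡ a * a + (a + d) * (a + d)
    e = solve-∀
... | inj₂ b≤a = subst (λ a → 2 * (a * b) ≤ a * a + b * b) (m+[n∸m]≡n b≤a) (ordered b (a ∸ b))
  where
  ordered : ∀ b d → 2 * ((b + d) * b) ≤ (b + d) * (b + d) + b * b
  ordered b d = subst (2 * ((b + d) * b) ≤_) (e b d) (m≤m+n _ (d * d))
    where
    e : ∀ b d → 2 * ((b + d) * b) + d * d ≡ (b + d) * (b + d) + b * b
    e = solve-∀

private variable
  Ix Iy : Set

∑[_] : List Ix → (Ix → ℕ) → ℕ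
∑[ xs ] f = sum (map f xs)

∑-mono : (xs : List Ix) {f g : Ix → ℕ} → (∀ x → f x ≤ g x) → ∑[ xs ] f ≤ ∑[ xs ] g
∑-mono [] _ = z≤n
∑-mono (x ∷ xs) h = +-mono-≤ (h x) (∑-mono xs h)

∑-cong : (xs : List Ix) {f g : Ix → ℕ} → (∀ x → f x ≡ g x) → ∑[ xs ] f ≡ ∑[ xs ] g
∑-cong [] _ = refl
∑-cong (x ∷ xs) h = cong₂ _+_ (h x) (∑-cong xs h)

∑-+ : (xs : List Ix) (f g : Ix → ℕ) → ∑[ xs ] (λ x → f x + g x) ≡ ∑[ xs ] f + ∑[ xs ] g
∑-+ [] _ _ = refl
∑-+ (x ∷ xs) f g rewrite ∑-+ xs f g = e (f x) (g x) _ _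
  where
  e : ∀ a b c d → a + b + (c + d) ≡ a + c + (b + d)
  e = solve-∀

∑-*ˡ : (xs : List Ix) (c : ℕ) (f : Ix → ℕ) → ∑[ xs ] (λ x → c * f x) ≡ c * ∑[ xs ] f
∑-*ˡ [] c f = sym (*-zeroʳ c)
∑-*ˡ (x ∷ xs) c f rewrite ∑-*ˡ xs c f = sym (*-distribˡ-+ c (f x) _)

∑-*ʳ : (xs : List Ix) (f : Ix → ℕ) (c : ℕ) → ∑[ xs ] (λ x → f x * c) ≡ ∑[ xs ] f * c
∑-*ʳ xs f c = trans (∑-cong xs (λ x → *-comm (f x) c)) (trans (∑-*ˡ xs c f) (*-comm c _))

∑-zero : (xs : List Ix) → ∑[ xs ] (λ _ → 0) ≡ 0
∑-zero [] = refl
∑-zero (_ ∷ xs) = ∑-zero xs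

∑-swap : (xs : List Ix) (ys : List Iy) (f : Ix → Iy → ℕ) →
         ∑[ xs ] (λ x → ∑[ ys ] (f x)) ≡ ∑[ ys ] (λ y → ∑[ xs ] (λ x → f x y))
∑-swap [] ys f = sym (∑-zero ys)
∑-swap (x ∷ xs) ys f = trans (cong (∑[ ys ] (f x) +_) (∑-swap xs ys f)) (sym (∑-+ ys (f x) _))

∑-* : (xs : List Ix) (ys : List Iy) (f : Ix → ℕ) (g : Iy → ℕ) →
      ∑[ xs ] f * ∑[ ys ] g ≡ ∑[ xs ] (λ x → ∑[ ys ] (λ y → f x * g y))
∑-* xs ys f g = trans (sym (∑-*ʳ xs f _)) (∑-cong xs λ x → sym (∑-*ˡ ys (f x) g))

∈⇒≤∑ : {xs : List Ix} (f : Ix → ℕ) {x : Ix} → x ∈ˡ xs → f x ≤ ∑[ xs ] f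
∈⇒≤∑ f (here refl) = m≤m+n _ _
∈⇒≤∑ f (there p) = ≤-trans (∈⇒≤∑ f p) (m≤n+m _ _)

∑-filter : (S : Ix → Bool) (xs : List Ix) → length (filterᵇ S xs) ≡ ∑[ xs ] (λ x → ⟦ S x ⟧)
∑-filter S [] = refl
∑-filter S (x ∷ xs) with S x
... | true = cong suc (∑-filter S xs)
... | false = ∑-filter S xs

∑-δ : (_≟_ : DecidableEquality Ix) {xs : List Ix} → Unique xs → ∀ {y} → y ∈ˡ xs → (f : Ix → ℕ) →
      ∑[ xs ] (λ x → ⟦ does (y ≟ x) ⟧ * f x) ≡ f y
∑-δ {Ix} _≟_ {x ∷ xs} (x∉ ∷ _) (here refl) f
  rewrite dec-true (x ≟ x) refl = trans (cong₂ _+_ (+-identityʳ (f x)) (off xs x∉)) (+-identityʳ (f x))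
  where
  off : ∀ ys → All (x ≢_) ys → ∑[ ys ] (λ y → ⟦ does (x ≟ y) ⟧ * f y) ≡ 0
  off [] [] = refl
  off (y ∷ ys) (x≢y ∷ ps) rewrite dec-false (x ≟ y) x≢y = off ys ps
∑-δ _≟_ {x ∷ xs} (x∉ ∷ u) {y} (there p) f
  rewrite dec-false (y ≟ x) (λ e → All.lookup x∉ p (sym e)) = ∑-δ _≟_ u p f

-- Cauchy-Schwarz, with `S` any set containing the support of `r`. Both sides expand over pairs and
-- are compared through 2 r(x) r(y) ≤ S(x) r(y)² + r(x)² S(y), so no subtraction occurs.
∑²≤ : (xs : List Ix) (S : Ix → Bool) (r : Ix → ℕ) → (∀ x → S x ≢ true → r x ≡ 0) →
      ∑[ xs ] r * ∑[ xs ] r ≤ ∑[ xs ] (λ x → ⟦ S x ⟧) * ∑[ xs ] (λ x → r x * r x)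
∑²≤ xs S r supp = *-cancelˡ-≤ 2 (begin
  2 * (∑[ xs ] r * ∑[ xs ] r)
    ≡⟨ cong (2 *_) (∑-* xs xs r r) ⟩
  2 * ∑[ xs ] (λ x → ∑[ xs ] (λ y → r x * r y))
    ≡⟨ sym (∑-*ˡ xs 2 _) ⟩
  ∑[ xs ] (λ x → 2 * ∑[ xs ] (λ y → r x * r y))
    ≡⟨ ∑-cong xs (λ x → sym (∑-*ˡ xs 2 _)) ⟩
  ∑[ xs ] (λ x → ∑[ xs ] (λ y → 2 * (r x * r y)))
    ≤⟨ ∑-mono xs (λ x → ∑-mono xs (pointwise x)) ⟩
  ∑[ xs ] (λ x → ∑[ xs ] (λ y → ⟦ S x ⟧ * (r y * r y) + r x * r x * ⟦ S y ⟧))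
    ≡⟨ ∑-cong xs (λ x → ∑-+ xs _ _) ⟩
  ∑[ xs ] (λ x → ∑[ xs ] (λ y → ⟦ S x ⟧ * (r y * r y)) + ∑[ xs ] (λ y → r x * r x * ⟦ S y ⟧))
    ≡⟨ ∑-+ xs _ _ ⟩
  ∑[ xs ] (λ x → ∑[ xs ] (λ y → ⟦ S x ⟧ * (r y * r y))) +
  ∑[ xs ] (λ x → ∑[ xs ] (λ y → r x * r x * ⟦ S y ⟧))
    ≡⟨ cong₂ _+_ (sym (∑-* xs xs _ _)) (sym (∑-* xs xs _ _)) ⟩
  s * t + t * s
    ≡⟨ e s t ⟩
  2 * (s * t) ∎)
  where
  open ≤-Reasoning
  s = ∑[ xs ] (λ x → ⟦ S x ⟧)
  t = ∑[ xs ] (λ x → r x * r x)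
  e : ∀ s t → s * t + t * s ≡ 2 * (s * t)
  e = solve-∀
  pointwise : ∀ x y → 2 * (r x * r y) ≤ ⟦ S x ⟧ * (r y * r y) + r x * r x * ⟦ S y ⟧
  pointwise x y with S x in ex | S y in ey
  ... | false | _ rewrite supp x (λ e → contradiction (trans (sym ex) e) λ ()) = z≤n
  ... | true | false rewrite supp y (λ e → contradiction (trans (sym ey) e) λ ()) | *-zeroʳ (r x) = z≤n
  ... | true | true = subst (2 * (r x * r y) ≤_) (e′ (r x * r x) (r y * r y)) (2ab≤a²+b² (r x) (r y))
    where
    e′ : ∀ a b → a + b ≡ b + 0 + a * 1
    e′ = solve-∀

-- The averaging principle: if `f` exceeded `g` wherever the weight is positive, the weighted sum of
-- `f` would be strictly larger. With 0-1 weights it selects an element of a set.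
∃-below-average : (xs : List Ix) (w f g : Ix → ℕ) → 1 ≤ ∑[ xs ] w →
  ∑[ xs ] (λ x → w x * f x) ≤ ∑[ xs ] (λ x → w x * g x) → ∃ λ x → 1 ≤ w x × f x ≤ g x
∃-below-average (x ∷ xs) w f g pos h with w x in ew | f x ≤? g x
... | suc _ | yes fg = x , subst (1 ≤_) (sym ew) (s≤s z≤n) , fg
... | zero | _ = ∃-below-average xs w f g pos h
... | suc k | no fg = rest
  where
  -- The head has positive weight and violates the bound, so the tail must compensate strictly. A
  -- tail of total weight 0 cannot.
  smaller : ∑[ xs ] (λ x → w x * f x) < ∑[ xs ] (λ x → w x * g x)
  smaller = ≰⇒> λ le → <⇒≱ (+-mono-<-≤ (*-monoʳ-< (suc k) (≰⇒> fg)) le) h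
  vanish : ∀ ys h → ∑[ ys ] w ≡ 0 → ∑[ ys ] (λ x → w x * h x) ≡ 0
  vanish [] h _ = refl
  vanish (y ∷ ys) h e rewrite m+n≡0⇒m≡0 (w y) e = vanish ys h (m+n≡0⇒n≡0 (w y) e)
  rest : ∃ λ x → 1 ≤ w x × f x ≤ g x
  rest with 1 ≤? ∑[ xs ] w
  ... | yes p = ∃-below-average xs w f g p (<⇒≤ smaller)
  ... | no ¬p = contradiction smaller (<-irrefl (trans (vanish xs f e) (sym (vanish xs g e))))
    where
    e : ∑[ xs ] w ≡ 0
    e = n<1⇒n≡0 (≰⇒> ¬p)

-- Dyadic decomposition of natural numbers

∑< : ℕ → (ℕ → ℕ) → ℕ
∑< zero f = 0
∑< (suc k) f = f k + ∑< k f

∑-∑< : (xs : List Ix) (k : ℕ) (f : ℕ → Ix → ℕ) → ∑[ xs ] (λ x → ∑< k (λ j → f j x)) ≡ ∑< k (λ j → ∑[ xs ] (f j))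
∑-∑< xs zero f = ∑-zero xs
∑-∑< xs (suc k) f = trans (∑-+ xs (f k) _) (cong (∑[ xs ] (f k) +_) (∑-∑< xs k f))

∑<-mono : ∀ k {f g : ℕ → ℕ} → (∀ j → f j ≤ g j) → ∑< k f ≤ ∑< k g
∑<-mono zero _ = z≤n
∑<-mono (suc k) h = +-mono-≤ (h k) (∑<-mono k h)

∑<-cong : ∀ k {f g : ℕ → ℕ} → (∀ j → f j ≡ g j) → ∑< k f ≡ ∑< k g
∑<-cong zero _ = refl
∑<-cong (suc k) h = cong₂ _+_ (h k) (∑<-cong k h)

∃-max-term : ∀ k (f : ℕ → ℕ) → ∃ λ j → j ≤ k × ∑< (suc k) f ≤ suc k * f j
∃-max-term zero f = 0 , z≤n , ≤-refl
∃-max-term (suc k) f with ∃-max-term k f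
... | j , j≤k , h with f (suc k) ≤? f j
...   | yes p = j , m≤n⇒m≤1+n j≤k , +-mono-≤ p h
...   | no p = suc k , ≤-refl , +-monoʳ-≤ (f (suc k)) (≤-trans h (*-monoʳ-≤ (suc k) (≰⇒≥ p)))

-- The sum of all powers of two that are at most `v`, up to the cut-off `k`. It replaces `v` by a
-- sum over thresholds, so the level sets are the nested sets v ≥ 2^j and not disjoint bands.
dyadic : ℕ → ℕ → ℕ
dyadic v k = ∑< k (λ j → 2 ^ j * ⟦ does (2 ^ j ≤? v) ⟧)

-- When the largest of the `k` powers is at most `v`, all are present and sum to 2^k - 1. Doubling
-- `v` in the hypothesis avoids 2^(k - 1) at k = 0.
2^k≤1+dyadic : ∀ k {v} → 2 ^ k ≤ 2 * v → 2 ^ k ≤ suc (dyadic v k)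
2^k≤1+dyadic zero _ = ≤-refl
2^k≤1+dyadic (suc k) {v} h = begin
  2 ^ k + (2 ^ k + 0)              ≡⟨ cong (2 ^ k +_) (+-identityʳ _) ⟩
  2 ^ k + 2 ^ k                    ≤⟨ +-monoʳ-≤ (2 ^ k) (2^k≤1+dyadic k (≤-trans 2^k≤v (m≤m+n v _))) ⟩
  2 ^ k + suc (dyadic v k)         ≡⟨ +-suc (2 ^ k) _ ⟩
  suc (2 ^ k + dyadic v k)         ≡⟨ cong (λ z → suc (z + dyadic v k)) (sym (*-identityʳ (2 ^ k))) ⟩
  suc (2 ^ k * 1 + dyadic v k)
    ≡⟨ cong (λ z → suc (2 ^ k * ⟦ z ⟧ + dyadic v k)) (sym (dec-true (2 ^ k ≤? v) 2^k≤v)) ⟩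
  suc (dyadic v (suc k))           ∎
  where
  open ≤-Reasoning
  2^k≤v : 2 ^ k ≤ v
  2^k≤v = *-cancelˡ-≤ 2 h

v≤dyadic : ∀ k {v} → v < 2 ^ k → v ≤ dyadic v k
v≤dyadic zero h = ≤-trans (≤-pred h) z≤n
v≤dyadic (suc k) {v} h = by-size (2 ^ k ≤? v)
  where
  by-size : Dec (2 ^ k ≤ v) → v ≤ dyadic v (suc k)
  by-size (no p) = ≤-trans (v≤dyadic k (≰⇒> p)) (m≤n+m _ _)
  by-size (yes p) = ≤-pred (≤-trans h (2^k≤1+dyadic (suc k) (*-monoʳ-≤ 2 p)))

-- Exponent arithmetic

n<2^[1+⌊log₂n⌋] : ∀ n → n < 2 ^ suc ⌊log₂ n ⌋
n<2^[1+⌊log₂n⌋] n = ≰⇒> λ h → 1+n≰n (subst (_≤ ⌊log₂ n ⌋) (⌊log₂[2^n]⌋≡n (suc ⌊log₂ n ⌋)) (⌊log₂⌋-mono-≤ h))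

≤⊔⇒⊎ : ∀ {k m n} → k ≤ m ⊔ n → k ≤ m ⊎ k ≤ n
≤⊔⇒⊎ {k} {m} {n} h with ≤-total m n
... | inj₁ m≤n = inj₂ (subst (k ≤_) (m≤n⇒m⊔n≡n m≤n) h)
... | inj₂ n≤m = inj₁ (subst (k ≤_) (m≥n⇒m⊔n≡m n≤m) h)

^-cancelˡ-≤ : ∀ k .⦃ _ : NonZero k ⦄ {m n} → m ^ k ≤ n ^ k → m ≤ n
^-cancelˡ-≤ k h = ≮⇒≥ λ n<m → <⇒≱ (^-monoˡ-< k n<m) h

^-distribʳ-* : ∀ k m n → (m * n) ^ k ≡ m ^ k * n ^ k
^-distribʳ-* zero m n = refl
^-distribʳ-* (suc k) m n = trans (cong (m * n *_) (^-distribʳ-* k m n)) (e m n (m ^ k) (n ^ k))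
  where
  e : ∀ m n x y → m * n * (x * y) ≡ m * x * (n * y)
  e = solve-∀

fourth-power : ∀ c m → c ^ 4 * (c * (m * m) * (c * (m * m)) * (c * (m * m)) * (c * (m * m))) ≡ c ^ 8 * m ^ 8
fourth-power = solve 2 (λ c m → c :^ 4 :* (c :* (m :* m) :* (c :* (m :* m)) :* (c :* (m :* m)) :* (c :* (m :* m))) :=
                                c :^ 8 :* m :^ 8) refl
  where open +-*-Solver using (solve; _:=_; _:*_; _:^_)

-- t is the absolute constant; as a variable it keeps large numerals from being unfolded.
module Exponents {t a b N M L W : ℕ} (2≤t : 2 ≤ t) (1≤a : 1 ≤ a) (1≤L : 1 ≤ L) (a≤M : a ≤ M)
  (large : a * a ≤ t * (M * N)) (mass : a * a * a ≤ t * (L * M) * (N * b)) where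

  open ≤-Reasoning
  open +-*-Solver using (solve; _:=_; _:*_; _:^_)

  private
    -- `a`, `b` stand for |A|, |B|; `N` is the popularity of the dilates by `B`, `M` the larger of
    -- the sumset and product set sizes, `L` the logarithm and `W` the size of A + xA. Each case has
    -- to reach a^15 ≤ X^14, and `a ≤ X` supplies a missing degree.
    X = t * (M * L)

    instance
      a-nonZero : NonZero a
      a-nonZero = >-nonZero 1≤a
      L-nonZero : NonZero L
      L-nonZero = >-nonZero 1≤L
      t-nonZero : NonZero t
      t-nonZero = >-nonZero (≤-trans (s≤s z≤n) 2≤t)

    a≤X : a ≤ X
    a≤X = ≤-trans a≤M (≤-trans (m≤m*n M L) (m≤n*m (M * L) t))

    instance
      X-nonZero : NonZero X
      X-nonZero = >-nonZero (≤-trans 1≤a a≤X)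

    -- Fewer than `n` factors `L` are topped up to `n`, since L ≥ 1. The logarithmic power is
    -- thereby wasted, but all cases end in the same shape.
    collect : ∀ i n → i ≤ n → t ^ n * (L ^ i * M ^ n) ≤ X ^ n
    collect i n i≤n = begin
      t ^ n * (L ^ i * M ^ n)   ≤⟨ *-monoʳ-≤ (t ^ n) (*-monoˡ-≤ (M ^ n) (^-monoʳ-≤ L i≤n)) ⟩
      t ^ n * (L ^ n * M ^ n)   ≡⟨ cong (t ^ n *_) (*-comm (L ^ n) (M ^ n)) ⟩
      t ^ n * (M ^ n * L ^ n)   ≡⟨ cong (t ^ n *_) (sym (^-distribʳ-* n M L)) ⟩
      t ^ n * (M * L) ^ n       ≡⟨ sym (^-distribʳ-* n t (M * L)) ⟩
      X ^ n                     ∎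

  -- Bounding `N` by `a` in `mass` and cancelling `a` shows that `B` has size at least a² / X.
  a²≤ : N ≤ a → a * a ≤ X * b
  a²≤ N≤a = *-cancelʳ-≤ (a * a) (X * b) a (begin
    a * a * a                   ≤⟨ mass ⟩
    t * (L * M) * (N * b)       ≤⟨ *-monoʳ-≤ (t * (L * M)) (*-monoˡ-≤ b N≤a) ⟩
    t * (L * M) * (a * b)       ≡⟨ e t L M a b ⟩
    X * b * a                   ∎)
    where
    e : ∀ t l m a b → t * (l * m) * (a * b) ≡ t * (m * l) * b * a
    e = solve-∀

  module _ (W-bound : W * (a * a * a * (N * N * N * N)) ≤ t ^ 8 * M ^ 8) where

    private
      Q = a * a * a * (N * N * N * N)

      -- Every case is arranged so that `W` appears exactly once, next to a full factor Q = a³ N⁴;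
      -- `W-bound` trades the pair for eight more degrees in `t` and `M`.
      substitute-W : ∀ {y} i j k → y ≤ t ^ k * W * Q * (L ^ i * M ^ j) → y ≤ t ^ (k + 8) * (L ^ i * M ^ (j + 8))
      substitute-W {y} i j k h = begin
        y                                           ≤⟨ h ⟩
        t ^ k * W * Q * (L ^ i * M ^ j)             ≡⟨ e₁ (t ^ k) W Q (L ^ i) (M ^ j) ⟩
        t ^ k * (L ^ i * M ^ j) * (W * Q)           ≤⟨ *-monoʳ-≤ (t ^ k * (L ^ i * M ^ j)) W-bound ⟩
        t ^ k * (L ^ i * M ^ j) * (t ^ 8 * M ^ 8)   ≡⟨ e₂ (t ^ k) (L ^ i) (M ^ j) (t ^ 8) (M ^ 8) ⟩
        t ^ k * t ^ 8 * (L ^ i * (M ^ j * M ^ 8))   ≡⟨ cong₂ (λ y z → y * (L ^ i * z)) (sym (^-distribˡ-+-* t k 8)) (sym (^-distribˡ-+-* M j 8)) ⟩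
        t ^ (k + 8) * (L ^ i * M ^ (j + 8))         ∎
        where
        e₁ : ∀ c w q l m → c * w * q * (l * m) ≡ c * (l * m) * (w * q)
        e₁ = solve-∀
        e₂ : ∀ c l m d n → c * (l * m) * (d * n) ≡ c * d * (l * (m * n))
        e₂ = solve-∀

      conclude : ∀ {y} i j k → i ≤ k + 8 → y ≤ t ^ k * W * Q * (L ^ i * M ^ j) → j ≡ k → y ≤ X ^ (k + 8)
      conclude i j k i≤ h refl = ≤-trans (substitute-W i j k h) (collect i (k + 8) i≤)

    -- Three uses of `mass` produce b³ N³, one use of `large` the fourth `N`, and the spare a³
    -- completes `Q`. This gives a^14 ≤ X^13, and a ≤ X the last degree.
    from-b³≤ : b * b * b ≤ t * (M * W) → a ^ 15 ≤ X ^ 14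
    from-b³≤ h = *-mono-≤ a≤X (conclude 3 5 5 (from-yes (3 ≤? 13)) (begin
      a ^ 14
        ≡⟨ e₁ a ⟩
      a * a * a * (a * a * a) * (a * a * a) * (a * a) * (a * a * a)
        ≤⟨ *-monoˡ-≤ (a * a * a) (*-mono-≤ (*-mono-≤ (*-mono-≤ mass mass) mass) large) ⟩
      m³ * m³ * m³ * (t * (M * N)) * (a * a * a)
        ≡⟨ e₂ t L M N b a ⟩
      b * b * b * (t ^ 4 * (Q * (L ^ 3 * M ^ 4)))
        ≤⟨ *-monoˡ-≤ (t ^ 4 * (Q * (L ^ 3 * M ^ 4))) h ⟩
      t * (M * W) * (t ^ 4 * (Q * (L ^ 3 * M ^ 4)))
        ≡⟨ e₃ t (t ^ 4) M W Q (L ^ 3) (M ^ 4) ⟩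
      t ^ 5 * W * Q * (L ^ 3 * M ^ 5) ∎) refl)
      where
      m³ = t * (L * M) * (N * b)
      e₁ : ∀ a → a ^ 14 ≡ a * a * a * (a * a * a) * (a * a * a) * (a * a) * (a * a * a)
      e₁ = solve 1 (λ a → a :^ 14 := a :* a :* a :* (a :* a :* a) :* (a :* a :* a) :* (a :* a) :* (a :* a :* a)) refl
      e₂ : ∀ t l m n b a → t * (l * m) * (n * b) * (t * (l * m) * (n * b)) * (t * (l * m) * (n * b)) * (t * (m * n)) * (a * a * a) ≡
             b * b * b * (t ^ 4 * (a * a * a * (n * n * n * n) * (l ^ 3 * m ^ 4)))
      e₂ = solve 6 (λ t l m n b a →
             t :* (l :* m) :* (n :* b) :* (t :* (l :* m) :* (n :* b)) :* (t :* (l :* m) :* (n :* b)) :* (t :* (m :* n)) :* (a :* a :* a) :=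
             b :* b :* b :* (t :^ 4 :* (a :* a :* a :* (n :* n :* n :* n) :* (l :^ 3 :* m :^ 4)))) refl
      e₃ : ∀ c d m w q l k → c * (m * w) * (d * (q * (l * k))) ≡ c * d * w * q * (l * (m * k))
      e₃ = solve-∀

    -- Two uses of `mass` and three of `large` produce b² N⁵: one `N` is consumed together with b²,
    -- the other four go into `Q`. No degree is left over, so this case is tight.
    from-b²N≤ : b * b * N ≤ t * (M * W) → a ^ 15 ≤ X ^ 14
    from-b²N≤ h = conclude 2 6 6 (from-yes (2 ≤? 14)) (begin
      a ^ 15
        ≡⟨ e₁ a ⟩
      a * a * a * (a * a * a) * (a * a * (a * a) * (a * a)) * (a * a * a)
        ≤⟨ *-monoˡ-≤ (a * a * a) (*-mono-≤ (*-mono-≤ mass mass) (*-mono-≤ (*-mono-≤ large large) large)) ⟩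
      m³ * m³ * (t * (M * N) * (t * (M * N)) * (t * (M * N))) * (a * a * a)
        ≡⟨ e₂ t L M N b a ⟩
      b * b * N * (t ^ 5 * (Q * (L ^ 2 * M ^ 5)))
        ≤⟨ *-monoˡ-≤ (t ^ 5 * (Q * (L ^ 2 * M ^ 5))) h ⟩
      t * (M * W) * (t ^ 5 * (Q * (L ^ 2 * M ^ 5)))
        ≡⟨ e₃ t (t ^ 5) M W Q (L ^ 2) (M ^ 5) ⟩
      t ^ 6 * W * Q * (L ^ 2 * M ^ 6) ∎) refl
      where
      m³ = t * (L * M) * (N * b)
      e₁ : ∀ a → a ^ 15 ≡ a * a * a * (a * a * a) * (a * a * (a * a) * (a * a)) * (a * a * a)
      e₁ = solve 1 (λ a → a :^ 15 := a :* a :* a :* (a :* a :* a) :* (a :* a :* (a :* a) :* (a :* a)) :* (a :* a :* a)) refl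
      e₂ : ∀ t l m n b a → t * (l * m) * (n * b) * (t * (l * m) * (n * b)) * (t * (m * n) * (t * (m * n)) * (t * (m * n))) * (a * a * a) ≡
             b * b * n * (t ^ 5 * (a * a * a * (n * n * n * n) * (l ^ 2 * m ^ 5)))
      e₂ = solve 6 (λ t l m n b a →
             t :* (l :* m) :* (n :* b) :* (t :* (l :* m) :* (n :* b)) :* (t :* (m :* n) :* (t :* (m :* n)) :* (t :* (m :* n))) :* (a :* a :* a) :=
             b :* b :* n :* (t :^ 5 :* (a :* a :* a :* (n :* n :* n :* n) :* (l :^ 2 :* m :^ 5)))) refl
      e₃ : ∀ c d m w q l k → c * (m * w) * (d * (q * (l * k))) ≡ c * d * w * q * (l * (m * k))
      e₃ = solve-∀

    -- Two uses each of `mass` and `large` produce b² N⁴.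
    from-b²≤ : b * b ≤ t * W → a ^ 15 ≤ X ^ 14
    from-b²≤ h = *-mono-≤ a≤X (conclude 2 5 5 (from-yes (2 ≤? 13)) (begin
      a ^ 14
        -- One factor `a` is given up for `M` so that the degrees in `t` and `M` agree, as
        -- `conclude` demands.
        ≤⟨ *-monoˡ-≤ (a ^ 13) a≤M ⟩
      M * a ^ 13
        ≡⟨ cong (M *_) (e₁ a) ⟩
      M * (a * a * a * (a * a * a) * (a * a * (a * a)) * (a * a * a))
        ≤⟨ *-monoʳ-≤ M (*-monoˡ-≤ (a * a * a) (*-mono-≤ (*-mono-≤ mass mass) (*-mono-≤ large large))) ⟩
      M * (m³ * m³ * (t * (M * N) * (t * (M * N))) * (a * a * a))
        ≡⟨ e₂ t L M N b a ⟩
      b * b * (t ^ 4 * (Q * (L ^ 2 * M ^ 5)))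
        ≤⟨ *-monoˡ-≤ (t ^ 4 * (Q * (L ^ 2 * M ^ 5))) h ⟩
      t * W * (t ^ 4 * (Q * (L ^ 2 * M ^ 5)))
        ≡⟨ e₃ t (t ^ 4) W Q (L ^ 2 * M ^ 5) ⟩
      t ^ 5 * W * Q * (L ^ 2 * M ^ 5) ∎) refl)
      where
      m³ = t * (L * M) * (N * b)
      e₁ : ∀ a → a ^ 13 ≡ a * a * a * (a * a * a) * (a * a * (a * a)) * (a * a * a)
      e₁ = solve 1 (λ a → a :^ 13 := a :* a :* a :* (a :* a :* a) :* (a :* a :* (a :* a)) :* (a :* a :* a)) refl
      e₂ : ∀ t l m n b a → m * (t * (l * m) * (n * b) * (t * (l * m) * (n * b)) * (t * (m * n) * (t * (m * n))) * (a * a * a)) ≡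
             b * b * (t ^ 4 * (a * a * a * (n * n * n * n) * (l ^ 2 * m ^ 5)))
      e₂ = solve 6 (λ t l m n b a →
             m :* (t :* (l :* m) :* (n :* b) :* (t :* (l :* m) :* (n :* b)) :* (t :* (m :* n) :* (t :* (m :* n))) :* (a :* a :* a)) :=
             b :* b :* (t :^ 4 :* (a :* a :* a :* (n :* n :* n :* n) :* (l :^ 2 :* m :^ 5)))) refl
      e₃ : ∀ c d w q k → c * w * (d * (q * k)) ≡ c * d * w * q * k
      e₃ = solve-∀

    -- Four uses of `mass` produce b⁴ N⁴, and the remaining a³ completes `Q`; the other tight case.
    from-b⁴≤ : b * b * (b * b) ≤ t * t * (M * M * W) → a ^ 15 ≤ X ^ 14
    from-b⁴≤ h = conclude 4 6 6 (from-yes (4 ≤? 14)) (begin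
      a ^ 15
        ≡⟨ e₁ a ⟩
      a * a * a * (a * a * a) * (a * a * a * (a * a * a)) * (a * a * a)
        ≤⟨ *-monoˡ-≤ (a * a * a) (*-mono-≤ (*-mono-≤ mass mass) (*-mono-≤ mass mass)) ⟩
      m³ * m³ * (m³ * m³) * (a * a * a)
        ≡⟨ e₂ t L M N b a ⟩
      b * b * (b * b) * (t ^ 4 * (Q * (L ^ 4 * M ^ 4)))
        ≤⟨ *-monoˡ-≤ (t ^ 4 * (Q * (L ^ 4 * M ^ 4))) h ⟩
      t * t * (M * M * W) * (t ^ 4 * (Q * (L ^ 4 * M ^ 4)))
        ≡⟨ e₃ t (t ^ 4) M W Q (L ^ 4) (M ^ 4) ⟩
      t ^ 6 * W * Q * (L ^ 4 * M ^ 6) ∎) refl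
      where
      m³ = t * (L * M) * (N * b)
      e₁ : ∀ a → a ^ 15 ≡ a * a * a * (a * a * a) * (a * a * a * (a * a * a)) * (a * a * a)
      e₁ = solve 1 (λ a → a :^ 15 := a :* a :* a :* (a :* a :* a) :* (a :* a :* a :* (a :* a :* a)) :* (a :* a :* a)) refl
      e₂ : ∀ t l m n b a → t * (l * m) * (n * b) * (t * (l * m) * (n * b)) * (t * (l * m) * (n * b) * (t * (l * m) * (n * b))) * (a * a * a) ≡
             b * b * (b * b) * (t ^ 4 * (a * a * a * (n * n * n * n) * (l ^ 4 * m ^ 4)))
      e₂ = solve 6 (λ t l m n b a →
             t :* (l :* m) :* (n :* b) :* (t :* (l :* m) :* (n :* b)) :* (t :* (l :* m) :* (n :* b) :* (t :* (l :* m) :* (n :* b))) :* (a :* a :* a) :=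
             b :* b :* (b :* b) :* (t :^ 4 :* (a :* a :* a :* (n :* n :* n :* n) :* (l :^ 4 :* m :^ 4)))) refl
      e₃ : ∀ c d m w q l k → c * c * (m * m * w) * (d * (q * (l * k))) ≡ c * (c * d) * w * q * (l * (m * (m * k)))
      e₃ = solve-∀

  module _ (N≤a : N ≤ a) {e : ℕ} (b≤e : b ≤ e) where

    private
      a²≤Xe : a * a ≤ X * e
      a²≤Xe = ≤-trans (a²≤ N≤a) (*-monoʳ-≤ X b≤e)

      power-of-a²≤ : ∀ k → a ^ (2 * k) ≤ X ^ k * e ^ k
      power-of-a²≤ k = begin
        a ^ (2 * k)       ≡⟨ sym (^-*-assoc a 2 k) ⟩
        (a ^ 2) ^ k       ≤⟨ ^-monoˡ-≤ k (subst (_≤ X * e) (cong (a *_) (sym (*-identityʳ a))) a²≤Xe) ⟩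
        (X * e) ^ k       ≡⟨ ^-distribʳ-* k X e ⟩
        X ^ k * e ^ k     ∎

    -- Since 175 = 7 · 25 and 150 = 6 · 25, the hypothesis is e⁷ ≤ a⁶; inserted into a^14 ≤ X⁷ e⁷ it
    -- leaves a⁸ ≤ X⁷.
    from-e⁷≤ : e ^ 175 ≤ a ^ 150 → a ^ 15 ≤ X ^ 14
    from-e⁷≤ h = begin
      a ^ 15      ≤⟨ ^-monoʳ-≤ a (from-yes (15 ≤? 16)) ⟩
      a ^ 16      ≡⟨ sym (^-*-assoc a 8 2) ⟩
      (a ^ 8) ^ 2 ≤⟨ ^-monoˡ-≤ 2 a⁸≤ ⟩
      (X ^ 7) ^ 2 ≡⟨ ^-*-assoc X 7 2 ⟩
      X ^ 14      ∎
      where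
      e⁷≤ : e ^ 7 ≤ a ^ 6
      e⁷≤ = ^-cancelˡ-≤ 25 (subst₂ _≤_ (sym (^-*-assoc e 7 25)) (sym (^-*-assoc a 6 25)) h)
      a⁸≤ : a ^ 8 ≤ X ^ 7
      a⁸≤ = *-cancelʳ-≤ (a ^ 8) (X ^ 7) (a ^ 6) ⦃ m^n≢0 a 6 ⦄ (begin
        a ^ 8 * a ^ 6     ≡⟨ sym (^-distribˡ-+-* a 8 6) ⟩
        a ^ (2 * 7)       ≤⟨ power-of-a²≤ 7 ⟩
        X ^ 7 * e ^ 7     ≤⟨ *-monoʳ-≤ (X ^ 7) e⁷≤ ⟩
        X ^ 7 * a ^ 6     ∎)

    -- Since 175 = 25 · 7 and 98 = 14 · 7, the hypothesis is e^25 ≤ g^14. The exponent 39 = 25 + 14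
    -- is chosen so that e^39 ≤ (g e)^14 ≤ X^28, whence a^78 ≤ X^67; fifth powers of the goal absorb
    -- the rounding.
    from-g*e≤ : ∀ {g} → e ^ 175 ≤ g ^ 98 → g * e ≤ 2 * (M * M) → a ^ 15 ≤ X ^ 14
    from-g*e≤ {g} h ge≤ = ^-cancelˡ-≤ 5 (begin
      (a ^ 15) ^ 5              ≡⟨ ^-*-assoc a 15 5 ⟩
      a ^ 75                    ≤⟨ ^-monoʳ-≤ a (from-yes (75 ≤? 78)) ⟩
      a ^ 78                    ≤⟨ power-of-a²≤ 39 ⟩
      X ^ 39 * e ^ 39           ≡⟨ cong (X ^ 39 *_) (^-distribˡ-+-* e 25 14) ⟩
      X ^ 39 * (e ^ 25 * e ^ 14) ≤⟨ *-monoʳ-≤ (X ^ 39) (*-monoˡ-≤ (e ^ 14) e²⁵≤) ⟩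
      X ^ 39 * (g ^ 14 * e ^ 14) ≡⟨ cong (X ^ 39 *_) (sym (^-distribʳ-* 14 g e)) ⟩
      X ^ 39 * (g * e) ^ 14     ≤⟨ *-monoʳ-≤ (X ^ 39) (^-monoˡ-≤ 14 ge≤X²) ⟩
      X ^ 39 * (X ^ 2) ^ 14     ≡⟨ cong (X ^ 39 *_) (^-*-assoc X 2 14) ⟩
      X ^ 39 * X ^ 28           ≡⟨ sym (^-distribˡ-+-* X 39 28) ⟩
      X ^ 67                    ≤⟨ ^-monoʳ-≤ X (from-yes (67 ≤? 70)) ⟩
      X ^ 70                    ≡⟨ sym (^-*-assoc X 14 5) ⟩
      (X ^ 14) ^ 5              ∎)
      where
      e²⁵≤ : e ^ 25 ≤ g ^ 14
      e²⁵≤ = ^-cancelˡ-≤ 7 (subst₂ _≤_ (sym (^-*-assoc e 25 7)) (sym (^-*-assoc g 14 7)) h)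
      ge≤X² : g * e ≤ X ^ 2
      ge≤X² = begin
        g * e                     ≤⟨ ge≤ ⟩
        2 * (M * M)               ≤⟨ *-monoˡ-≤ (M * M) 2≤t ⟩
        t * (M * M)               ≤⟨ m≤n*m (t * (M * M)) t ⟩
        t * (t * (M * M))         ≡⟨ expand t M ⟩
        t ^ 2 * (L ^ 0 * M ^ 2)   ≤⟨ collect 0 2 z≤n ⟩
        X ^ 2                     ∎
        where
        expand : ∀ t m → t * (t * (m * m)) ≡ t * (t * 1) * (1 * (m * (m * 1)))
        expand = solve-∀

  -- A set `B` with at most one element has no quotients, but then a² ≤ X b already gives a² ≤ X.
  from-b≤1 : N ≤ a → b ≤ 1 → a ^ 15 ≤ X ^ 14
  from-b≤1 N≤a b≤1 = begin
    a ^ 15          ≤⟨ ^-monoʳ-≤ a (from-yes (15 ≤? 28)) ⟩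
    a ^ 28          ≡⟨ sym (^-*-assoc a 2 14) ⟩
    (a ^ 2) ^ 14    ≤⟨ ^-monoˡ-≤ 14 a²≤X ⟩
    X ^ 14          ∎
    where
    a²≤X : a ^ 2 ≤ X
    a²≤X = begin
      a * (a * 1)   ≡⟨ cong (a *_) (*-identityʳ a) ⟩
      a * a         ≤⟨ a²≤ N≤a ⟩
      X * b         ≤⟨ *-monoʳ-≤ X b≤1 ⟩
      X * 1         ≡⟨ *-identityʳ X ⟩
      X             ∎

module SumProduct {q} (F : FiniteField q) where

  -- Arithmetic and subsets of a finite field

  open FiniteField F public renaming (_+_ to _+ᶠ_; _*_ to _·_; -_ to -ᶠ_; _≟_ to _≟ᶠ_)

  commutativeRing : CommutativeRing _ _
  commutativeRing = record { isCommutativeRing = isCommutativeRing }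

  open CommutativeRing commutativeRing public using (-‿inverseʳ)
    renaming (+-identityˡ to +ᶠ-identityˡ; +-identityʳ to +ᶠ-identityʳ; +-comm to +ᶠ-comm; +-assoc to +ᶠ-assoc;
              zeroˡ to ·-zeroˡ; zeroʳ to ·-zeroʳ; *-identityˡ to ·-identityˡ; *-identityʳ to ·-identityʳ;
              *-comm to ·-comm; *-assoc to ·-assoc; distribˡ to ·-distribˡ)

  private
    module R = CommutativeRing commutativeRing
    module RP = Algebra.Properties.Ring R.ring
    module Mult = Algebra.Properties.Semiring.Mult R.semiring
    open Mult using () renaming (_×_ to _×′_)

    acr : AlmostCommutativeRing _ _
    acr = fromCommutativeRing commutativeRing

    -- Integer coefficients, represented as formal differences m − n.
    differences : RawRing _ _
    differences = record
      { Carrier = ℕ × ℕ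
      ; _≈_ = _≡_
      ; _+_ = λ (a , b) (c , d) → a + c , b + d
      ; _*_ = λ (a , b) (c , d) → a * c + b * d , a * d + b * c
      ; -_ = λ (a , b) → b , a
      ; 0# = 0 , 0
      ; 1# = 1 , 0
      }

    value : ℕ × ℕ → Carrier
    value (a , b) = a ×′ 1# +ᶠ (-ᶠ (b ×′ 1#))

    module S = Algebra.Solver.Ring.NaturalCoefficients.Default R.commutativeSemiring
    open S using () renaming (_:+_ to _⊕_; _:*_ to _⊗_; _:=_ to _⊜_)

    value-+ : ∀ x y → value (RawRing._+_ differences x y) ≡ value x +ᶠ value y
    value-+ (a , b) (c , d)
      rewrite Mult.×-homo-+ 1# a c | Mult.×-homo-+ 1# b d | sym (RP.-‿+-comm (b ×′ 1#) (d ×′ 1#))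
      = S.solve 4 (λ a b c d → a ⊕ c ⊕ (b ⊕ d) ⊜ a ⊕ b ⊕ (c ⊕ d)) refl _ _ _ _

    value-* : ∀ x y → value (RawRing._*_ differences x y) ≡ value x · value y
    value-* (a , b) (c , d)
      rewrite Mult.×-homo-+ 1# (a * c) (b * d) | Mult.×-homo-+ 1# (a * d) (b * c)
            | Mult.×1-homo-* a c | Mult.×1-homo-* b d | Mult.×1-homo-* a d | Mult.×1-homo-* b c
            | sym (RP.-‿+-comm (a ×′ 1# · d ×′ 1#) (b ×′ 1# · c ×′ 1#))
            | RP.-‿distribʳ-* (a ×′ 1#) (d ×′ 1#) | RP.-‿distribˡ-* (b ×′ 1#) (c ×′ 1#)
      = trans (cong (λ z → a ×′ 1# · c ×′ 1# +ᶠ z +ᶠ (a ×′ 1# · -ᶠ (d ×′ 1#) +ᶠ (-ᶠ (b ×′ 1#)) · c ×′ 1#))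
                    (sym (trans (sym (RP.-‿distribˡ-* _ _)) (trans (cong -ᶠ_ (sym (RP.-‿distribʳ-* _ _))) (RP.-‿involutive _)))))
              (S.solve 4 (λ a b c d → a ⊗ c ⊕ b ⊗ d ⊕ (a ⊗ d ⊕ b ⊗ c) ⊜ (a ⊕ b) ⊗ (c ⊕ d)) refl
                 (a ×′ 1#) (-ᶠ (b ×′ 1#)) (c ×′ 1#) (-ᶠ (d ×′ 1#)))

    value-neg : ∀ x → value (RawRing.-_ differences x) ≡ -ᶠ value x
    value-neg (a , b) = trans (+ᶠ-comm (b ×′ 1#) _)
      (trans (cong (-ᶠ (a ×′ 1#) +ᶠ_) (sym (RP.-‿involutive _))) (RP.-‿+-comm (a ×′ 1#) _))

    morphism : differences -Raw-AlmostCommutative⟶ acr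
    morphism = record
      { ⟦_⟧ = value
      ; +-homo = value-+
      ; *-homo = value-*
      ; -‿homo = value-neg
      ; 0-homo = -‿inverseʳ 0#
      ; 1-homo = trans (cong₂ _+ᶠ_ (+ᶠ-identityʳ 1#) RP.-0#≈0#) (+ᶠ-identityʳ 1#)
      }

    -- Only equality of the represented integers is tested. This is sound in every characteristic
    -- and need not be complete, since the solver asks for a semi-decision.
    value≟ : ∀ x y → Maybe (value x ≡ value y)
    value≟ (a , b) (c , d) with a + d ≟ c + b
    ... | no _ = nothing
    ... | yes e = just (RP.x∙y⁻¹≈ε⇒x≈y _ _ (trans (cong (value (a , b) +ᶠ_) (sym (value-neg (c , d))))
                    (trans (sym (value-+ (a , b) (d , c))) (trans (cong (λ z → z ×′ 1# +ᶠ (-ᶠ ((b + c) ×′ 1#))) (trans e (+-comm c b)))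
                      (-‿inverseʳ _)))))

  open Algebra.Solver.Ring differences acr morphism value≟ public
    using (solve; _:=_; _:+_; _:*_; _:-_; :-_)

  infixl 6 _⊖_
  _⊖_ : Carrier → Carrier → Carrier
  x ⊖ y = x +ᶠ (-ᶠ y)

  x⊖y≡0⇒x≡y : ∀ {x y} → x ⊖ y ≡ 0# → x ≡ y
  x⊖y≡0⇒x≡y = RP.x∙y⁻¹≈ε⇒x≈y _ _

  ⊖-cancel : ∀ x y → x ⊖ y +ᶠ y ≡ x
  ⊖-cancel = solve 2 (λ x y → x :- y :+ y := x) refl

  +ᶠ-⊖-cancel : ∀ x y → x +ᶠ y ⊖ y ≡ x
  +ᶠ-⊖-cancel = solve 2 (λ x y → x :+ y :- y := x) refl

  ⊖≡⇒≡+ᶠ : ∀ {x y z} → x ⊖ y ≡ z → x ≡ z +ᶠ y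
  ⊖≡⇒≡+ᶠ {x} {y} refl = sym (⊖-cancel x y)

  ·-cancelˡ : ∀ {t x y} → t ≢ 0# → t · x ≡ t · y → x ≡ y
  ·-cancelˡ {t} {x} {y} t≢0 e with inverse t t≢0
  ... | s , ts≡1 = trans (unit x) (trans (cong (s ·_) e) (sym (unit y)))
    where
    unit : ∀ z → z ≡ s · (t · z)
    unit z = trans (sym (·-identityˡ z)) (trans (cong (_· z) (sym ts≡1))
      (solve 3 (λ t s z → t :* s :* z := s :* (t :* z)) refl t s z))

  ·-nonzero : ∀ {x y} → x ≢ 0# → y ≢ 0# → x · y ≢ 0#
  ·-nonzero {x} {y} x≢0 y≢0 e = y≢0 (·-cancelˡ x≢0 (trans e (sym (·-zeroʳ x))))

  -- The convention inv 0 = 0 makes inversion an involution of the whole field, so that it can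
  -- reindex sums and cardinalities.
  inv : Carrier → Carrier
  inv x with x ≟ᶠ 0#
  ... | yes _ = 0#
  ... | no x≢0 = proj₁ (inverse x x≢0)

  inv-0 : inv 0# ≡ 0#
  inv-0 with 0# ≟ᶠ 0#
  ... | yes _ = refl
  ... | no 0≢0 = contradiction refl 0≢0

  ·-inverseʳ : ∀ {x} → x ≢ 0# → x · inv x ≡ 1#
  ·-inverseʳ {x} x≢0 with x ≟ᶠ 0#
  ... | yes e = contradiction e x≢0
  ... | no x≢0′ = proj₂ (inverse x x≢0′)

  ·-inverseˡ : ∀ {x} → x ≢ 0# → inv x · x ≡ 1#
  ·-inverseˡ x≢0 = trans (·-comm _ _) (·-inverseʳ x≢0)

  inv-unique : ∀ {x y} → x · y ≡ 1# → y ≡ inv x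
  inv-unique {x} {y} e = ·-cancelˡ x≢0 (trans e (sym (·-inverseʳ x≢0)))
    where
    x≢0 : x ≢ 0#
    x≢0 refl = 0≢1 (trans (sym (·-zeroˡ y)) e)

  inv-involutive : ∀ x → inv (inv x) ≡ x
  inv-involutive x = by-case (x ≟ᶠ 0#)
    where
    by-case : Dec (x ≡ 0#) → inv (inv x) ≡ x
    by-case (yes refl) = trans (cong inv inv-0) inv-0
    by-case (no x≢0) = sym (inv-unique (·-inverseˡ x≢0))

  inv·-cancel : ∀ {t} → t ≢ 0# → ∀ x → inv t · (t · x) ≡ x
  inv·-cancel {t} t≢0 x = trans (sym (·-assoc _ _ _)) (trans (cong (_· x) (·-inverseˡ t≢0)) (·-identityˡ x))

  ·inv-cancel : ∀ {t} → t ≢ 0# → ∀ x → t · (inv t · x) ≡ x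
  ·inv-cancel {t} t≢0 x = trans (sym (·-assoc _ _ _)) (trans (cong (_· x) (·-inverseʳ t≢0)) (·-identityˡ x))

  infixr 8 _^ᶠ_
  _^ᶠ_ : Carrier → ℕ → Carrier
  x ^ᶠ zero = 1#
  x ^ᶠ suc n = x · x ^ᶠ n

  ^ᶠ-nonzero : ∀ {x} → x ≢ 0# → ∀ n → x ^ᶠ n ≢ 0#
  ^ᶠ-nonzero x≢0 zero e = 0≢1 (sym e)
  ^ᶠ-nonzero x≢0 (suc n) = ·-nonzero x≢0 (^ᶠ-nonzero x≢0 n)

  ^ᶠ-+ : ∀ x m n → x ^ᶠ (m + n) ≡ x ^ᶠ m · x ^ᶠ n
  ^ᶠ-+ x zero n = sym (·-identityˡ _)
  ^ᶠ-+ x (suc m) n = trans (cong (x ·_) (^ᶠ-+ x m n)) (sym (·-assoc _ _ _))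

  open Inverse enum using (to; from; strictlyInverseˡ)

  to-injective : ∀ {i j} → to i ≡ to j → i ≡ j
  to-injective {i} {j} e =
    trans (sym (Inverse.strictlyInverseʳ enum i)) (trans (cong from e) (Inverse.strictlyInverseʳ enum j))

  -- Cancelling x^a leaves x · x^k = 1. Inverses that are powers inherit every closure property that
  -- products have.
  inv-from-period : ∀ {x} → x ≢ 0# → ∀ a k → x ^ᶠ a ≡ x ^ᶠ (a + suc k) → inv x ≡ x ^ᶠ k
  inv-from-period {x} x≢0 a k e = sym (inv-unique (·-cancelˡ (^ᶠ-nonzero x≢0 a)
    (trans (sym (^ᶠ-+ x a (suc k))) (trans (sym e) (sym (·-identityʳ _))))))

  opaque
    -- The powers of x repeat, by pigeonhole.
    inv-power : ∀ {x} → x ≢ 0# → ∃ λ k → inv x ≡ x ^ᶠ k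
    inv-power {x} x≢0 = from-collision (Fin.pigeonhole (n<1+n q) (λ i → from (x ^ᶠ toℕ i)))
      where
      from-collision : (∃₂ λ (i j : Fin (suc q)) → toℕ i < toℕ j × from (x ^ᶠ toℕ i) ≡ from (x ^ᶠ toℕ j)) → ∃ λ k → inv x ≡ x ^ᶠ k
      from-collision (i , j , i<j , e) = k , inv-from-period x≢0 a k (trans
        (trans (sym (strictlyInverseˡ _)) (trans (cong to e) (strictlyInverseˡ _)))
        (cong (x ^ᶠ_) (sym (trans (+-suc a k) (m+[n∸m]≡n i<j)))))
        where
        a k : ℕ
        a = toℕ i
        k = toℕ j ∸ suc a

  opaque
    search : {P : Carrier → Set} → (∀ x → Dec (P x)) → Dec (∃ P)
    search {P} P? = map′ (λ (i , p) → to i , p) (λ (x , p) → from x , subst P (sym (strictlyInverseˡ x)) p)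
      (Fin.any? (λ i → P? (to i)))

  -- Sums and cardinalities over the field

  ∈-elems : ∀ x → x ∈ˡ elems
  ∈-elems x = subst (_∈ˡ elems) (strictlyInverseˡ x) (∈-map⁺ to (∈-allFin (from x)))

  elems-unique : Unique elems
  elems-unique = map⁺ to-injective (allFin⁺ q)

  ∑ : (Carrier → ℕ) → ℕ
  ∑ = ∑[ elems ]

  ∑-delta : ∀ y f → ∑ (λ x → ⟦ does (y ≟ᶠ x) ⟧ * f x) ≡ f y
  ∑-delta y f = ∑-δ _≟ᶠ_ elems-unique (∈-elems y) f

  ∑-reindex : (σ τ : Carrier → Carrier) → (∀ x → τ (σ x) ≡ x) → (∀ y → σ (τ y) ≡ y) →
              ∀ f → ∑ (f ∘ σ) ≡ ∑ f
  ∑-reindex σ τ τσ στ f = begin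
    ∑ (λ x → f (σ x))
      ≡⟨ ∑-cong elems (λ x → sym (∑-delta (σ x) f)) ⟩
    ∑ (λ x → ∑ (λ y → ⟦ does (σ x ≟ᶠ y) ⟧ * f y))
      ≡⟨ ∑-swap elems elems _ ⟩
    ∑ (λ y → ∑ (λ x → ⟦ does (σ x ≟ᶠ y) ⟧ * f y))
      ≡⟨ ∑-cong elems (λ y → ∑-cong elems (λ x → cong (λ b → ⟦ b ⟧ * f y) (same x y))) ⟩
    ∑ (λ y → ∑ (λ x → ⟦ does (τ y ≟ᶠ x) ⟧ * f y))
      ≡⟨ ∑-cong elems (λ y → ∑-delta (τ y) (λ _ → f y)) ⟩
    ∑ f ∎
    where
    open ≡-Reasoning
    same : ∀ x y → does (σ x ≟ᶠ y) ≡ does (τ y ≟ᶠ x)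
    same x y = bool-ext
      (λ e → dec-true (τ y ≟ᶠ x) (trans (cong τ (sym (does⇒ (σ x ≟ᶠ y) e))) (τσ x)))
      (λ e → dec-true (σ x ≟ᶠ y) (trans (cong σ (sym (does⇒ (τ y ≟ᶠ x) e))) (στ y)))

  ∑-translate : ∀ t f → ∑ (λ x → f (x +ᶠ t)) ≡ ∑ f
  ∑-translate t = ∑-reindex (_+ᶠ t) (_⊖ t) (λ x → +ᶠ-⊖-cancel x t) (λ x → ⊖-cancel x t)

  infix 4 _∈_ _⊆_
  _∈_ : Carrier → Subset → Set
  x ∈ S = S x ≡ true

  _⊆_ : Subset → Subset → Set
  S ⊆ T = ∀ {x} → x ∈ S → x ∈ T

  _∈?_ : ∀ x S → Dec (x ∈ S)
  x ∈? S = S x Bool.≟ true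

  opaque
    card : Subset → ℕ
    card S = ∣ S ∣

    card≡∑ : ∀ S → card S ≡ ∑ (λ x → ⟦ S x ⟧)
    card≡∑ S = ∑-filter S elems

  ∑-⟦⟧-* : ∀ S c → ∑ (λ x → ⟦ S x ⟧ * c) ≡ card S * c
  ∑-⟦⟧-* S c = trans (∑-*ʳ elems (λ x → ⟦ S x ⟧) c) (cong (_* c) (sym (card≡∑ S)))

  card-mono : ∀ {S T} → S ⊆ T → card S ≤ card T
  card-mono {S} {T} h rewrite card≡∑ S | card≡∑ T = ∑-mono elems (λ x → ⟦⟧-mono h)

  card-reindex : (σ τ : Carrier → Carrier) → (∀ x → τ (σ x) ≡ x) → (∀ y → σ (τ y) ≡ y) →
                 ∀ S → card (S ∘ σ) ≡ card S
  card-reindex σ τ τσ στ S =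
    trans (card≡∑ (S ∘ σ)) (trans (∑-reindex σ τ τσ στ (λ x → ⟦ S x ⟧)) (sym (card≡∑ S)))

  card-translate : ∀ t S → card (λ x → S (x ⊖ t)) ≡ card S
  card-translate t = card-reindex (_⊖ t) (_+ᶠ t) (λ x → ⊖-cancel x t) (λ x → +ᶠ-⊖-cancel x t)

  ∈⇒1≤card : ∀ {S x} → x ∈ S → 1 ≤ card S
  ∈⇒1≤card {S} {x} x∈S = begin
    1                   ≡⟨ cong ⟦_⟧ (sym x∈S) ⟩
    ⟦ S x ⟧             ≤⟨ ∈⇒≤∑ (λ x → ⟦ S x ⟧) (∈-elems x) ⟩
    ∑ (λ x → ⟦ S x ⟧)   ≡⟨ sym (card≡∑ S) ⟩
    card S              ∎
    where open ≤-Reasoning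

  card-empty : ∀ {S} → (∀ x → ¬ x ∈ S) → card S ≡ 0
  card-empty {S} empty = trans (card≡∑ S) (trans (∑-cong elems absent) (∑-zero elems))
    where
    absent : ∀ x → ⟦ S x ⟧ ≡ 0
    absent x with S x in e
    ... | false = refl
    ... | true = contradiction e (empty x)

  1≤card⇒∃ : ∀ {S} → 1 ≤ card S → ∃ λ x → x ∈ S
  1≤card⇒∃ {S} h with search (_∈? S)
  ... | yes p = p
  ... | no ¬p = contradiction h (<-irrefl (sym (card-empty λ x x∈S → ¬p (x , x∈S))))

  -- The bound is an indicator and not 1, so that summing it over all fibres of a map gives the size
  -- of the image.
  card-subsingleton : ∀ {S} b → (∀ x → x ∈ S → b ≡ true) → (∀ {x y} → x ∈ S → y ∈ S → x ≡ y) → card S ≤ ⟦ b ⟧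
  card-subsingleton {S} b h unique with search (_∈? S)
  ... | no ¬p = ≤-trans (≤-reflexive (card-empty λ x x∈S → ¬p (x , x∈S))) z≤n
  ... | yes (y , y∈S) = begin
    card S                                   ≤⟨ card-mono (λ {x} x∈S → dec-true (y ≟ᶠ x) (unique y∈S x∈S)) ⟩
    card (λ x → does (y ≟ᶠ x))               ≡⟨ card≡∑ _ ⟩
    ∑ (λ x → ⟦ does (y ≟ᶠ x) ⟧)              ≡⟨ ∑-cong elems (λ x → sym (Data.Nat.Properties.*-identityʳ _)) ⟩
    ∑ (λ x → ⟦ does (y ≟ᶠ x) ⟧ * 1)          ≡⟨ ∑-delta y (λ _ → 1) ⟩
    1                                        ≡⟨ cong ⟦_⟧ (sym (h y y∈S)) ⟩
    ⟦ b ⟧                                    ∎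
    where open ≤-Reasoning

  infixr 5 _∪_
  _∪_ : Subset → Subset → Subset
  (S ∪ T) x = S x ∨ T x

  ∪-elim : ∀ {S T x} → x ∈ S ∪ T → x ∈ S ⊎ x ∈ T
  ∪-elim {S} {T} {x} h with S x
  ... | true = inj₁ refl
  ... | false = inj₂ h

  ∪-introˡ : ∀ {S T x} → x ∈ S → x ∈ S ∪ T
  ∪-introˡ {S} {T} {x} e rewrite e = refl

  ∪-introʳ : ∀ {S T x} → x ∈ T → x ∈ S ∪ T
  ∪-introʳ {S} {T} {x} e rewrite e = Bool.∨-zeroʳ (S x)

  card-∪-∩ : ∀ S T → card (S ∪ T) + card (S ∩ T) ≡ card S + card T
  card-∪-∩ S T rewrite card≡∑ (S ∪ T) | card≡∑ (S ∩ T) | card≡∑ S | card≡∑ T =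
    trans (sym (∑-+ elems _ _)) (trans (∑-cong elems pointwise) (∑-+ elems _ _))
    where
    pointwise : ∀ x → ⟦ (S ∪ T) x ⟧ + ⟦ (S ∩ T) x ⟧ ≡ ⟦ S x ⟧ + ⟦ T x ⟧
    pointwise x with S x | T x
    ... | false | false = refl
    ... | false | true = refl
    ... | true | false = refl
    ... | true | true = refl

  ⊆-card-≥ : ∀ {S T} → S ⊆ T → card T ≤ card S → T ⊆ S
  ⊆-card-≥ {S} {T} S⊆T T≤S {x} x∈T with x ∈? S
  ... | yes x∈S = x∈S
  ... | no x∉S = contradiction T≤S (<⇒≱ (begin
    suc (card S)                      ≡⟨ +-comm 1 (card S) ⟩
    card S + 1                        ≤⟨ +-monoʳ-≤ (card S) (∈⇒1≤card {δ} {x} (dec-true (x ≟ᶠ x) refl)) ⟩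
    card S + card δ                   ≡⟨ sym (card-∪-∩ S δ) ⟩
    card (S ∪ δ) + card (S ∩ δ)       ≡⟨ cong (card (S ∪ δ) +_) (card-empty {S ∩ δ} disjoint) ⟩
    card (S ∪ δ) + 0                  ≡⟨ +-identityʳ _ ⟩
    card (S ∪ δ)                      ≤⟨ card-mono {S ∪ δ} {T} union ⟩
    card T                            ∎))
    where
    open ≤-Reasoning
    δ : Subset
    δ y = does (x ≟ᶠ y)
    disjoint : ∀ y → ¬ y ∈ S ∩ δ
    disjoint y h with does⇒ (x ≟ᶠ y) (proj₂ (∧-elim {S y} h))
    ... | refl = x∉S (proj₁ (∧-elim h))
    union : S ∪ δ ⊆ T
    union {y} h with ∪-elim {S} {δ} {y} h
    ... | inj₁ y∈S = S⊆T y∈S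
    ... | inj₂ e with does⇒ (x ≟ᶠ y) e
    ...   | refl = x∈T

  any-intro : ∀ {ss : List Carrier} {S : Subset} {x} → x ∈ˡ ss → x ∈ S → any S ss ≡ true
  any-intro {S = S} (here refl) e rewrite e = refl
  any-intro {s ∷ _} {S} (there p) e rewrite any-intro {S = S} p e = Bool.∨-zeroʳ (S s)

  any-elim : ∀ {ss : List Carrier} {S : Subset} → any S ss ≡ true → ∃ λ x → x ∈ˡ ss × x ∈ S
  any-elim {s ∷ ss} {S} h with S s in e
  ... | true = s , here refl , e
  ... | false with any-elim {ss} {S} h
  ...   | x , p , x∈S = x , there p , x∈S

  -- The sumset with a list as second summand; Petridis' induction adds that summand one element at
  -- a time.
  translates : Subset → List Carrier → Subset
  translates U ss x = any (λ s → U (x ⊖ s)) ss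

  members : Subset → List Carrier
  members S = filterᵇ S elems

  ∈-members⁺ : ∀ {S x} → x ∈ S → x ∈ˡ members S
  ∈-members⁺ {S} {x} x∈S = go elems (∈-elems x)
    where
    go : ∀ xs → x ∈ˡ xs → x ∈ˡ filterᵇ S xs
    go (y ∷ ys) (here refl) rewrite x∈S = here refl
    go (y ∷ ys) (there p) with S y
    ... | true = there (go ys p)
    ... | false = go ys p

  ∈-members⁻ : ∀ {S x} → x ∈ˡ members S → x ∈ S
  ∈-members⁻ {S} {x} = go elems
    where
    go : ∀ xs → x ∈ˡ filterᵇ S xs → x ∈ S
    go (y ∷ ys) h with S y in e
    go (y ∷ ys) (here refl) | true = e
    go (y ∷ ys) (there p) | true = go ys p
    go (y ∷ ys) p | false = go ys p

  infixl 6 _⊞_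
  opaque
    _⊞_ : Subset → Subset → Subset
    U ⊞ V = translates U (members V)

    ⊞-intro : ∀ {U V u v} → u ∈ U → v ∈ V → u +ᶠ v ∈ U ⊞ V
    ⊞-intro {U} {V} {u} {v} u∈U v∈V =
      any-intro {S = λ s → U (u +ᶠ v ⊖ s)} (∈-members⁺ v∈V) (trans (cong U (+ᶠ-⊖-cancel u v)) u∈U)

    ⊞-elim : ∀ {U V x} → x ∈ U ⊞ V → ∃₂ λ u v → u ∈ U × v ∈ V × x ≡ u +ᶠ v
    ⊞-elim {U} {V} {x} h with any-elim {members V} {λ s → U (x ⊖ s)} h
    ... | v , v∈ , u∈U = x ⊖ v , v , u∈U , ∈-members⁻ v∈ , sym (⊖-cancel x v)

  ⊞-mono : ∀ {U U′ V V′} → U ⊆ U′ → V ⊆ V′ → U ⊞ V ⊆ U′ ⊞ V′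
  ⊞-mono hU hV {x} x∈ with ⊞-elim x∈
  ... | u , v , u∈ , v∈ , refl = ⊞-intro (hU u∈) (hV v∈)

  ⊞-comm-⊆ : ∀ {U V} → U ⊞ V ⊆ V ⊞ U
  ⊞-comm-⊆ {U} {V} {x} x∈ with ⊞-elim x∈
  ... | u , v , u∈ , v∈ , refl = subst (_∈ V ⊞ U) (+ᶠ-comm v u) (⊞-intro v∈ u∈)

  card-⊞-comm : ∀ U V → card (U ⊞ V) ≤ card (V ⊞ U)
  card-⊞-comm U V = card-mono ⊞-comm-⊆

  card≤card-⊞ʳ : ∀ {U V u} → u ∈ U → card V ≤ card (U ⊞ V)
  card≤card-⊞ʳ {U} {V} {u} u∈U = begin
    card V                      ≡⟨ sym (card-translate u V) ⟩
    card (λ x → V (x ⊖ u))      ≤⟨ card-mono (λ {x} h → subst (_∈ U ⊞ V) (trans (+ᶠ-comm u _) (⊖-cancel x u)) (⊞-intro u∈U h)) ⟩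
    card (U ⊞ V)                ∎
    where open ≤-Reasoning

  infixr 7 _⊙_
  opaque
    -- An image and not a preimage under division, so that dilation by 0 makes sense: 0 may occur as
    -- a quotient.
    _⊙_ : Carrier → Subset → Subset
    (t ⊙ S) y = any (λ s → does ((t · s) ≟ᶠ y)) (members S)

    ⊙-intro : ∀ {t S x} → x ∈ S → t · x ∈ t ⊙ S
    ⊙-intro {t} {S} {x} x∈S =
      any-intro {S = λ s → does ((t · s) ≟ᶠ (t · x))} (∈-members⁺ x∈S) (dec-true ((t · x) ≟ᶠ (t · x)) refl)

    ⊙-elim : ∀ {t S x} → x ∈ t ⊙ S → ∃ λ s → s ∈ S × x ≡ t · s
    ⊙-elim {t} {S} {x} h with any-elim {members S} {λ s → does ((t · s) ≟ᶠ x)} h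
    ... | s , s∈ , e = s , ∈-members⁻ s∈ , sym (does⇒ ((t · s) ≟ᶠ x) e)

  ⊙-mono : ∀ {t S T} → S ⊆ T → t ⊙ S ⊆ t ⊙ T
  ⊙-mono S⊆T x∈ with ⊙-elim x∈
  ... | s , s∈ , refl = ⊙-intro (S⊆T s∈)

  card-⊙ : ∀ {t} → t ≢ 0# → ∀ S → card (t ⊙ S) ≡ card S
  card-⊙ {t} t≢0 S = trans
    (≤-antisym (card-mono {t ⊙ S} {S ∘ (inv t ·_)} forth) (card-mono {S ∘ (inv t ·_)} {t ⊙ S} back))
    (card-reindex (inv t ·_) (t ·_) (·inv-cancel t≢0) (inv·-cancel t≢0) S)
    where
    forth : ∀ {x} → x ∈ t ⊙ S → inv t · x ∈ S
    forth x∈ with ⊙-elim x∈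
    ... | s , s∈ , refl = trans (cong S (inv·-cancel t≢0 s)) s∈
    back : ∀ {x} → inv t · x ∈ S → x ∈ t ⊙ S
    back {x} h = subst (_∈ t ⊙ S) (·inv-cancel t≢0 x) (⊙-intro h)

  card-⊙-⊞ : ∀ {t} → t ≢ 0# → ∀ U V → card (t ⊙ U ⊞ t ⊙ V) ≤ card (U ⊞ V)
  card-⊙-⊞ {t} t≢0 U V = begin
    card (t ⊙ U ⊞ t ⊙ V)   ≤⟨ card-mono {t ⊙ U ⊞ t ⊙ V} {t ⊙ (U ⊞ V)} distribute ⟩
    card (t ⊙ (U ⊞ V))     ≡⟨ card-⊙ t≢0 (U ⊞ V) ⟩
    card (U ⊞ V)           ∎
    where
    open ≤-Reasoning
    distribute : t ⊙ U ⊞ t ⊙ V ⊆ t ⊙ (U ⊞ V)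
    distribute x∈ with ⊞-elim x∈
    ... | _ , _ , tu∈ , tv∈ , refl with ⊙-elim tu∈ | ⊙-elim tv∈
    ...   | u , u∈ , refl | v , v∈ , refl = subst (_∈ t ⊙ (U ⊞ V)) (·-distribˡ t u v) (⊙-intro (⊞-intro u∈ v∈))

  -- Plünnecke's inequality

  -- Growth ratios telescope: a / b ≤ m / x and b ≤ c / y.
  *-chain : ∀ {a b c m x y} → a * x ≤ m * b → b * y ≤ c → a * (x * y) ≤ m * c
  *-chain {a} {b} {c} {m} {x} {y} h k = begin
    a * (x * y)   ≡⟨ sym (*-assoc a x y) ⟩
    a * x * y     ≤⟨ *-monoˡ-≤ y h ⟩
    m * b * y     ≡⟨ *-assoc m b y ⟩
    m * (b * y)   ≤⟨ *-monoʳ-≤ m k ⟩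
    m * c         ∎
    where open ≤-Reasoning

  Weights : Set
  Weights = List (ℕ × Subset)

  -- The weights play the role of 1 / |X + Y| with denominators cleared. Minimising one total over
  -- |Z| treats all the summands `Y` at once, which yields Plünnecke's inequality for different
  -- summands.
  weighted : Weights → Subset → ℕ
  weighted ws Z = ∑[ ws ] (λ (w , Y) → w * card (Z ⊞ Y))

  weighted-mono : ∀ ws {Z Z′} → Z ⊆ Z′ → weighted ws Z ≤ weighted ws Z′
  weighted-mono ws h = ∑-mono ws (λ (w , Y) → *-monoʳ-≤ w (card-mono (⊞-mono h id)))

  weighted-empty : ∀ ws {Z} → (∀ x → ¬ x ∈ Z) → weighted ws Z ≡ 0
  weighted-empty ws {Z} empty = trans (∑-cong ws λ (w , Y) → trans (cong (w *_) (card-empty {Z ⊞ Y} none)) (*-zeroʳ w)) (∑-zero ws)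
    where
    none : ∀ {Y} x → ¬ x ∈ Z ⊞ Y
    none x h with ⊞-elim h
    ... | u , _ , u∈ , _ = empty u u∈

  module _ (P X : Subset) (t : Carrier) where

    -- `hit` is (X + t) ∩ P moved back by `t`; as a subset of `X` it can be compared with `X` by
    -- minimality.
    shifted hit : Subset
    shifted x = X (x ⊖ t)
    hit x = X x ∧ P (x +ᶠ t)

    card-∩≤hit : card (shifted ∩ P) ≤ card hit
    card-∩≤hit = begin
      card (shifted ∩ P)              ≤⟨ card-mono (λ {x} h → ∧-intro (proj₁ (∧-elim h)) (trans (cong P (⊖-cancel x t)) (proj₂ (∧-elim h)))) ⟩
      card (λ x → hit (x ⊖ t))    ≡⟨ card-translate t hit ⟩
      card hit                    ∎
      where open ≤-Reasoning

    -- The translate of hit + Y by `t` lies in both shifted + Y and P + Y, whose union is (shifted ∪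
    -- P) + Y; inclusion-exclusion does the rest.
    card-⊞-submodular : ∀ Y → card ((shifted ∪ P) ⊞ Y) + card (hit ⊞ Y) ≤ card (X ⊞ Y) + card (P ⊞ Y)
    card-⊞-submodular Y = begin
      card ((shifted ∪ P) ⊞ Y) + card (hit ⊞ Y)
        ≤⟨ +-mono-≤ (card-mono {(shifted ∪ P) ⊞ Y} {(shifted ⊞ Y) ∪ (P ⊞ Y)} union) hit≤ ⟩
      card ((shifted ⊞ Y) ∪ (P ⊞ Y)) + card ((shifted ⊞ Y) ∩ (P ⊞ Y))
        ≡⟨ card-∪-∩ (shifted ⊞ Y) (P ⊞ Y) ⟩
      card (shifted ⊞ Y) + card (P ⊞ Y)
        ≤⟨ +-monoˡ-≤ _ shifted≤ ⟩
      card (X ⊞ Y) + card (P ⊞ Y) ∎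
      where
      open ≤-Reasoning
      union : (shifted ∪ P) ⊞ Y ⊆ (shifted ⊞ Y) ∪ (P ⊞ Y)
      union {x} h with ⊞-elim h
      ... | u , v , u∈ , v∈ , refl with ∪-elim {shifted} {P} {u} u∈
      ...   | inj₁ u∈ˢ = ∪-introˡ {shifted ⊞ Y} {P ⊞ Y} (⊞-intro u∈ˢ v∈)
      ...   | inj₂ u∈P = ∪-introʳ {shifted ⊞ Y} {P ⊞ Y} (⊞-intro u∈P v∈)
      move : ∀ u v x → x ⊖ t ≡ u +ᶠ v → x ≡ (u +ᶠ t) +ᶠ v
      move u v x e = trans (⊖≡⇒≡+ᶠ e) (solve 3 (λ u v t → u :+ v :+ t := u :+ t :+ v) refl u v t)
      hit≤ : card (hit ⊞ Y) ≤ card ((shifted ⊞ Y) ∩ (P ⊞ Y))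
      hit≤ = begin
        card (hit ⊞ Y)                  ≡⟨ sym (card-translate t (hit ⊞ Y)) ⟩
        card (λ x → (hit ⊞ Y) (x ⊖ t))  ≤⟨ card-mono {λ x → (hit ⊞ Y) (x ⊖ t)} {(shifted ⊞ Y) ∩ (P ⊞ Y)} both ⟩
        card ((shifted ⊞ Y) ∩ (P ⊞ Y))      ∎
        where
        both : ∀ {x} → (hit ⊞ Y) (x ⊖ t) ≡ true → ((shifted ⊞ Y) ∩ (P ⊞ Y)) x ≡ true
        both {x} h with ⊞-elim h
        ... | u , v , u∈ , v∈ , e rewrite move u v x e =
          ∧-intro (⊞-intro (trans (cong X (+ᶠ-⊖-cancel u t)) (proj₁ (∧-elim u∈))) v∈)
                  (⊞-intro (proj₂ (∧-elim {X u} u∈)) v∈)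
      shifted≤ : card (shifted ⊞ Y) ≤ card (X ⊞ Y)
      shifted≤ = begin
        card (shifted ⊞ Y)               ≤⟨ card-mono {shifted ⊞ Y} {λ x → (X ⊞ Y) (x ⊖ t)} back ⟩
        card (λ x → (X ⊞ Y) (x ⊖ t))     ≡⟨ card-translate t (X ⊞ Y) ⟩
        card (X ⊞ Y)                     ∎
        where
        back : ∀ {x} → x ∈ shifted ⊞ Y → (X ⊞ Y) (x ⊖ t) ≡ true
        back h with ⊞-elim h
        ... | u , v , u∈ , v∈ , refl =
          subst (_∈ X ⊞ Y) (solve 3 (λ u v t → u :- t :+ v := u :+ v :- t) refl u v t) (⊞-intro u∈ v∈)

    weighted-submodular : ∀ ws → weighted ws (shifted ∪ P) + weighted ws hit ≤ weighted ws X + weighted ws P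
    weighted-submodular ws = begin
      weighted ws (shifted ∪ P) + weighted ws hit
        ≡⟨ sym (∑-+ ws _ _) ⟩
      ∑[ ws ] (λ (w , Y) → w * card ((shifted ∪ P) ⊞ Y) + w * card (hit ⊞ Y))
        ≤⟨ ∑-mono ws pointwise ⟩
      ∑[ ws ] (λ (w , Y) → w * card (X ⊞ Y) + w * card (P ⊞ Y))
        ≡⟨ ∑-+ ws _ _ ⟩
      weighted ws X + weighted ws P ∎
      where
      open ≤-Reasoning
      pointwise : ∀ ((w , Y) : ℕ × Subset) →
        w * card ((shifted ∪ P) ⊞ Y) + w * card (hit ⊞ Y) ≤ w * card (X ⊞ Y) + w * card (P ⊞ Y)
      pointwise (w , Y) = begin
        w * card ((shifted ∪ P) ⊞ Y) + w * card (hit ⊞ Y)   ≡⟨ sym (*-distribˡ-+ w _ _) ⟩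
        w * (card ((shifted ∪ P) ⊞ Y) + card (hit ⊞ Y))     ≤⟨ *-monoʳ-≤ w (card-⊞-submodular Y) ⟩
        w * (card (X ⊞ Y) + card (P ⊞ Y))                       ≡⟨ *-distribˡ-+ w _ _ ⟩
        w * card (X ⊞ Y) + w * card (P ⊞ Y)                     ∎

  module _ (ws : Weights) where

    -- The ratio of `weighted` to size is least at `X` among its nonempty subsets, cross-multiplied;
    -- for empty `T` both sides vanish.
    Minimal : Subset → Set
    Minimal X = ∀ T → T ⊆ X → weighted ws X * card T ≤ weighted ws T * card X

    -- Petridis' argument: adding the translate of X by s to P = X + ss changes the weighted sumset by at most
    -- weighted X − weighted T and the cardinality by exactly |X| − |T|, where T is the part of X that s moves into P.
    weighted-translates : ∀ {X} → Minimal X → ∀ ss →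
      weighted ws (translates X ss) * card X ≤ weighted ws X * card (translates X ss)
    weighted-translates {X} _ [] rewrite weighted-empty ws {translates X []} (λ _ ()) = z≤n
    weighted-translates {X} minimal (s ∷ ss) = +-cancelʳ-≤ (f T * x) _ _ (begin
      f (Q ∪ P) * x + f T * x                  ≡⟨ sym (*-distribʳ-+ x (f (Q ∪ P)) (f T)) ⟩
      (f (Q ∪ P) + f T) * x                    ≤⟨ *-monoˡ-≤ x (weighted-submodular P X s ws) ⟩
      (f X + f P) * x                          ≡⟨ *-distribʳ-+ x (f X) (f P) ⟩
      f X * x + f P * x                        ≤⟨ +-monoʳ-≤ (f X * x) (weighted-translates minimal ss) ⟩
      f X * x + f X * card P                   ≡⟨ sym (*-distribˡ-+ (f X) x (card P)) ⟩
      f X * (x + card P)                       ≡⟨ cong (λ z → f X * (z + card P)) (sym (card-translate s X)) ⟩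
      f X * (card Q + card P)                  ≡⟨ cong (f X *_) (sym (card-∪-∩ Q P)) ⟩
      f X * (card (Q ∪ P) + card (Q ∩ P))      ≤⟨ *-monoʳ-≤ (f X) (+-monoʳ-≤ (card (Q ∪ P)) (card-∩≤hit P X s)) ⟩
      f X * (card (Q ∪ P) + card T)            ≡⟨ *-distribˡ-+ (f X) _ _ ⟩
      f X * card (Q ∪ P) + f X * card T        ≤⟨ +-monoʳ-≤ (f X * card (Q ∪ P)) (minimal T (λ h → proj₁ (∧-elim h))) ⟩
      f X * card (Q ∪ P) + f T * x             ∎)
      where
      open ≤-Reasoning
      f = weighted ws
      x = card X
      P = translates X ss
      Q = shifted P X s
      T = hit P X s

    -- What Petridis' argument leaves for use: a subset whose ratio does not exceed that of `X`, and
    -- keeps this bound after any `S` is added. Both bounds refer to `X`, so the ratio of `X′`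
    -- itself never has to be known.
    record Reduced (X : Subset) : Set where
      field
        X′        : Subset
        X′⊆X      : X′ ⊆ X
        nonempty  : 1 ≤ card X′
        ratio     : weighted ws X′ * card X ≤ weighted ws X * card X′
        growth    : ∀ S → weighted ws (X′ ⊞ S) * card X ≤ weighted ws X * card (X′ ⊞ S)

    -- Descent on size: a set that is not minimal has a strictly smaller nonempty subset of better
    -- ratio. Whether a set is minimal is not decided here, hence the double negation.
    minimiser : ∀ n X → card X ≤ n → 1 ≤ card X →
      ¬ ¬ ∃ λ X′ → X′ ⊆ X × 1 ≤ card X′ × Minimal X′ × weighted ws X′ * card X ≤ weighted ws X * card X′
    minimiser zero X ≤n pos _ = contradiction (≤-trans pos ≤n) λ ()
    minimiser (suc n) X ≤n pos none = none (X , id , pos , minimal , ≤-refl)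
      where
      f = weighted ws
      minimal : Minimal X
      minimal T T⊆X = ≮⇒≥ λ better → descend T T⊆X better (1≤card-T T better) (smaller T T⊆X better)
        where
        1≤card-T : ∀ T → f T * card X < f X * card T → 1 ≤ card T
        1≤card-T T better = n≢0⇒n>0 λ e → n≮0 (subst (f T * card X <_) (trans (cong (f X *_) e) (*-zeroʳ (f X))) better)
        smaller : ∀ T → T ⊆ X → f T * card X < f X * card T → card T < card X
        smaller T T⊆X better = ≰⇒> λ X≤T → <⇒≱ better
          (*-mono-≤ (weighted-mono ws (⊆-card-≥ T⊆X X≤T)) (card-mono T⊆X))
        descend : ∀ T → T ⊆ X → f T * card X < f X * card T → 1 ≤ card T → ¬ card T < card X
        descend T T⊆X better pos T<X = minimiser n T (≤-pred (≤-trans T<X ≤n)) pos λ (X′ , X′⊆T , pos′ , min , ratio) →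
          none (X′ , (λ h → T⊆X (X′⊆T h)) , pos′ , min , *-cancelʳ-≤ _ _ (card T) ⦃ >-nonZero pos ⦄ (begin
            f X′ * card X * card T     ≡⟨ swap₂₃ (f X′) (card X) (card T) ⟩
            f X′ * card T * card X     ≤⟨ *-monoˡ-≤ (card X) ratio ⟩
            f T * card X′ * card X     ≡⟨ swap₂₃ (f T) (card X′) (card X) ⟩
            f T * card X * card X′     ≤⟨ *-monoˡ-≤ (card X′) (<⇒≤ better) ⟩
            f X * card T * card X′     ≡⟨ swap₂₃ (f X) (card T) (card X′) ⟩
            f X * card X′ * card T     ∎))
          where
          open ≤-Reasoning
          swap₂₃ : ∀ a b c → a * b * c ≡ a * c * b
          swap₂₃ = solve-∀

    reduce : ∀ {X} → 1 ≤ card X → ¬ ¬ Reduced X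
    reduce {X} pos none = minimiser (card X) X ≤-refl pos λ (X′ , X′⊆X , pos′ , min , ratio) → none record
      { X′ = X′ ; X′⊆X = X′⊆X ; nonempty = pos′ ; ratio = ratio
      ; growth = λ S → *-cancelʳ-≤ _ _ (card X′) ⦃ >-nonZero pos′ ⦄ (begin
          f (X′ ⊞ S) * card X * card X′     ≡⟨ swap₂₃ (f (X′ ⊞ S)) (card X) (card X′) ⟩
          f (X′ ⊞ S) * card X′ * card X     ≤⟨ *-monoˡ-≤ (card X) (⊞-growth min S) ⟩
          f X′ * card (X′ ⊞ S) * card X     ≡⟨ swap₂₃ (f X′) (card (X′ ⊞ S)) (card X) ⟩
          f X′ * card X * card (X′ ⊞ S)     ≤⟨ *-monoˡ-≤ (card (X′ ⊞ S)) ratio ⟩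
          f X * card X′ * card (X′ ⊞ S)     ≡⟨ swap₂₃ (f X) (card X′) (card (X′ ⊞ S)) ⟩
          f X * card (X′ ⊞ S) * card X′     ∎) }
      where
      open ≤-Reasoning
      f = weighted ws
      swap₂₃ : ∀ a b c → a * b * c ≡ a * c * b
      swap₂₃ = solve-∀
      opaque
        unfolding _⊞_
        ⊞-growth : ∀ {X′} → Minimal X′ → ∀ S → f (X′ ⊞ S) * card X′ ≤ f X′ * card (X′ ⊞ S)
        ⊞-growth min S = weighted-translates min (members S)

  ⊞-assoc-⊆ : ∀ {U V W} → U ⊞ (V ⊞ W) ⊆ (U ⊞ V) ⊞ W
  ⊞-assoc-⊆ {U} {V} {W} {x} x∈ with ⊞-elim x∈
  ... | u , _ , u∈ , vw∈ , refl with ⊞-elim vw∈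
  ...   | v , w , v∈ , w∈ , refl = subst (_∈ (U ⊞ V) ⊞ W) (+ᶠ-assoc u v w) (⊞-intro (⊞-intro u∈ v∈) w∈)

  card≤card-⊞ˡ : ∀ {U V v} → v ∈ V → card U ≤ card (U ⊞ V)
  card≤card-⊞ˡ {U} {V} v∈V = ≤-trans (card≤card-⊞ʳ v∈V) (card-⊞-comm V U)

  module _ {ws : Weights} {X : Subset} (reduced : Reduced ws X) (k P : ℕ) (total : weighted ws X ≡ k * P) where
    open Reduced reduced

    -- A single term is at most the whole total k P, and P = w m, so the weight cancels and leaves
    -- growth by k m / |X|. The price of treating `k` summands together is the factor `k`.
    weighted-summand : ∀ {w Y} → (w , Y) ∈ˡ ws → 1 ≤ w → ∀ m → w * m ≡ P → ∀ {Z} →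
      weighted ws Z * card X ≤ weighted ws X * card Z → card (Z ⊞ Y) * card X ≤ k * m * card Z
    weighted-summand {w} {Y} wY∈ pos m w*m≡P {Z} h = *-cancelˡ-≤ w ⦃ >-nonZero pos ⦄ (begin
      w * (card (Z ⊞ Y) * card X)     ≡⟨ sym (*-assoc w _ _) ⟩
      w * card (Z ⊞ Y) * card X       ≤⟨ *-monoˡ-≤ (card X) (∈⇒≤∑ (λ (w , Y) → w * card (Z ⊞ Y)) wY∈) ⟩
      weighted ws Z * card X          ≤⟨ h ⟩
      weighted ws X * card Z          ≡⟨ cong (_* card Z) (trans total (cong (k *_) (sym w*m≡P))) ⟩
      k * (w * m) * card Z            ≡⟨ e k w m (card Z) ⟩
      w * (k * m * card Z)            ∎)
      where
      open ≤-Reasoning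
      e : ∀ k w m z → k * (w * m) * z ≡ w * (k * m * z)
      e = solve-∀

    growth-first : ∀ {w Y} → (w , Y) ∈ˡ ws → 1 ≤ w → ∀ m → w * m ≡ P →
      card (X′ ⊞ Y) * card X ≤ k * m * card X′
    growth-first wY∈ pos m e = weighted-summand wY∈ pos m e ratio

    growth-next : ∀ {w Y} → (w , Y) ∈ˡ ws → 1 ≤ w → ∀ m → w * m ≡ P → ∀ S →
      card (X′ ⊞ (S ⊞ Y)) * card X ≤ k * m * card (X′ ⊞ S)
    growth-next wY∈ pos m e S =
      ≤-trans (*-monoˡ-≤ (card X) (card-mono ⊞-assoc-⊆)) (weighted-summand wY∈ pos m e (growth S))

  -- The constant is 2², one factor 2 for each of two summands. The subset `X′` is kept in the
  -- conclusion because injectivity is later applied to it directly.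
  plünnecke₂ : ∀ {X U V} → 1 ≤ card X → 1 ≤ card (X ⊞ U) → 1 ≤ card (X ⊞ V) →
    ¬ ¬ ∃ λ X′ → X′ ⊆ X × 1 ≤ card X′ ×
      card (X′ ⊞ (U ⊞ V)) * (card X * card X) ≤ 4 * (card (X ⊞ U) * card (X ⊞ V)) * card X′
  plünnecke₂ {X} {U} {V} posX posU posV none = reduce ws posX λ r → let open Reduced r in
    none (X′ , X′⊆X , nonempty ,
      ≤-trans (*-chain {card (X′ ⊞ (U ⊞ V))} {m = 2 * v} {card X} {card X}
                 (growth-next r 2 (u * v) (e u v) (there (here refl)) posU v refl U)
                 (growth-first r 2 (u * v) (e u v) (here refl) posV u (*-comm v u)))
              (≤-reflexive (e′ u v (card X′))))
    where
    u = card (X ⊞ U)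
    v = card (X ⊞ V)
    ws : Weights
    ws = (v , U) ∷ (u , V) ∷ []
    e : ∀ u v → v * u + (u * v + 0) ≡ 2 * (u * v)
    e = solve-∀
    e′ : ∀ u v x → 2 * v * (2 * u * x) ≡ 4 * (u * v) * x
    e′ = solve-∀

  -- The weight of each summand is the product of the other three sizes, so the four terms of the
  -- total agree; 256 = 4⁴. The goal is a decidable inequality, which removes the double negation.
  plünnecke₄ : ∀ {X Y₁ Y₂ Y₃ Y₄ m₁ m₂ m₃ m₄} → 1 ≤ card X →
    m₁ ≡ card (X ⊞ Y₁) → m₂ ≡ card (X ⊞ Y₂) → m₃ ≡ card (X ⊞ Y₃) → m₄ ≡ card (X ⊞ Y₄) →
    1 ≤ m₁ → 1 ≤ m₂ → 1 ≤ m₃ → 1 ≤ m₄ →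
    card (Y₁ ⊞ Y₂ ⊞ Y₃ ⊞ Y₄) * (card X * (card X * card X)) ≤ 256 * (m₁ * m₂ * m₃ * m₄)
  plünnecke₄ {X} {Y₁} {Y₂} {Y₃} {Y₄} {m₁} {m₂} {m₃} {m₄} posX e₁ e₂ e₃ e₄ p₁ p₂ p₃ p₄ =
    decidable-stable (_ ≤? _) λ absurd → reduce ws posX λ r → let open Reduced r in
    absurd (*-cancelʳ-≤ _ _ x ⦃ >-nonZero posX ⦄ (begin
      card Y * (x * (x * x)) * x
        ≡⟨ e₅ (card Y) x ⟩
      card Y * (x * (x * (x * x)))
        ≤⟨ *-monoˡ-≤ (x * (x * (x * x))) (card≤card-⊞ʳ {X′} (proj₂ (1≤card⇒∃ nonempty))) ⟩
      card (X′ ⊞ Y) * (x * (x * (x * x)))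
        ≤⟨ *-chain {card (X′ ⊞ Y)} {m = 4 * m₄} {x} {x * (x * x)}
             (growth-next r 4 P total (there (there (there (here refl)))) (pos p₁ p₂ p₃) m₄ refl (Y₁ ⊞ Y₂ ⊞ Y₃))
             (*-chain {card (X′ ⊞ (Y₁ ⊞ Y₂ ⊞ Y₃))} {m = 4 * m₃} {x} {x * x}
               (growth-next r 4 P total (there (there (here refl))) (pos p₁ p₂ p₄) m₃ (w₃ m₁ m₂ m₃ m₄) (Y₁ ⊞ Y₂))
               (*-chain {card (X′ ⊞ (Y₁ ⊞ Y₂))} {m = 4 * m₂} {x} {x}
                 (growth-next r 4 P total (there (here refl)) (pos p₁ p₃ p₄) m₂ (w₂ m₁ m₂ m₃ m₄) Y₁)
                 (growth-first r 4 P total (here refl) (pos p₂ p₃ p₄) m₁ (w₁ m₁ m₂ m₃ m₄)))) ⟩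
      4 * m₄ * (4 * m₃ * (4 * m₂ * (4 * m₁ * card X′)))
        ≡⟨ e₆ m₁ m₂ m₃ m₄ (card X′) ⟩
      256 * P * card X′
        ≤⟨ *-monoʳ-≤ (256 * P) (card-mono X′⊆X) ⟩
      256 * P * x ∎))
    where
    open ≤-Reasoning
    x = card X
    P = m₁ * m₂ * m₃ * m₄
    Y = Y₁ ⊞ Y₂ ⊞ Y₃ ⊞ Y₄
    ws : Weights
    ws = (m₂ * m₃ * m₄ , Y₁) ∷ (m₁ * m₃ * m₄ , Y₂) ∷ (m₁ * m₂ * m₄ , Y₃) ∷ (m₁ * m₂ * m₃ , Y₄) ∷ []
    pos : ∀ {a b c} → 1 ≤ a → 1 ≤ b → 1 ≤ c → 1 ≤ a * b * c
    pos p q r = *-mono-≤ (*-mono-≤ p q) r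
    w₁ : ∀ a b c d → b * c * d * a ≡ a * b * c * d
    w₁ = solve-∀
    w₂ : ∀ a b c d → a * c * d * b ≡ a * b * c * d
    w₂ = solve-∀
    w₃ : ∀ a b c d → a * b * d * c ≡ a * b * c * d
    w₃ = solve-∀
    t : ∀ a b c d → b * c * d * a + (a * c * d * b + (a * b * d * c + (a * b * c * d + 0))) ≡ 4 * (a * b * c * d)
    t = solve-∀
    total : weighted ws X ≡ 4 * P
    total rewrite sym e₁ | sym e₂ | sym e₃ | sym e₄ = t m₁ m₂ m₃ m₄
    e₅ : ∀ y x → y * (x * (x * x)) * x ≡ y * (x * (x * (x * x)))
    e₅ = solve-∀
    e₆ : ∀ a b c d x → 4 * d * (4 * c * (4 * b * (4 * a * x))) ≡ 256 * (a * b * c * d) * x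
    e₆ = solve-∀

  -- Ruzsa's triangle inequality with sums only. The usual injection needs a difference, so the
  -- proof goes through Plünnecke's inequality at the cost of a factor 4.
  sum-triangle : ∀ {Z U V} → 1 ≤ card Z → 1 ≤ card U → 1 ≤ card V →
    card (U ⊞ V) * card Z ≤ 4 * (card (Z ⊞ U) * card (Z ⊞ V))
  sum-triangle {Z} {U} {V} posZ posU posV = decidable-stable (_ ≤? _) λ absurd →
    plünnecke₂ posZ (pos posU) (pos posV) λ (Z′ , Z′⊆Z , pos′ , h) → absurd
      (*-cancelʳ-≤ _ _ z ⦃ >-nonZero posZ ⦄ (begin
        card (U ⊞ V) * z * z                              ≡⟨ *-assoc (card (U ⊞ V)) z z ⟩
        card (U ⊞ V) * (z * z)                            ≤⟨ *-monoˡ-≤ (z * z) (card≤card-⊞ʳ {Z′} (proj₂ (1≤card⇒∃ pos′))) ⟩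
        card (Z′ ⊞ (U ⊞ V)) * (z * z)                     ≤⟨ h ⟩
        4 * (card (Z ⊞ U) * card (Z ⊞ V)) * card Z′       ≤⟨ *-monoʳ-≤ (4 * (card (Z ⊞ U) * card (Z ⊞ V))) (card-mono Z′⊆Z) ⟩
        4 * (card (Z ⊞ U) * card (Z ⊞ V)) * z             ∎))
    where
    open ≤-Reasoning
    z = card Z
    pos : ∀ {U} → 1 ≤ card U → 1 ≤ card (Z ⊞ U)
    pos {U} p = ≤-trans p (card≤card-⊞ʳ {Z} (proj₂ (1≤card⇒∃ posZ)))

  -- Counting representations: direct sums and Ruzsa's difference inequality

  representations : Subset → Subset → Carrier → Subset
  representations U V s v = V v ∧ U (s ⊖ v)

  card-*-card : ∀ U V → card U * card V ≡ ∑ (λ s → card (representations U V s))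
  card-*-card U V = begin
    card U * card V
      ≡⟨ cong (card U *_) (card≡∑ V) ⟩
    card U * ∑ (λ v → ⟦ V v ⟧)
      ≡⟨ sym (∑-*ˡ elems (card U) _) ⟩
    ∑ (λ v → card U * ⟦ V v ⟧)
      ≡⟨ ∑-cong elems (λ v → trans (*-comm (card U) _) (cong (⟦ V v ⟧ *_) (trans (sym (card-translate v U)) (card≡∑ _)))) ⟩
    ∑ (λ v → ⟦ V v ⟧ * ∑ (λ s → ⟦ U (s ⊖ v) ⟧))
      ≡⟨ ∑-cong elems (λ v → sym (∑-*ˡ elems ⟦ V v ⟧ _)) ⟩
    ∑ (λ v → ∑ (λ s → ⟦ V v ⟧ * ⟦ U (s ⊖ v) ⟧))
      ≡⟨ ∑-swap elems elems _ ⟩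
    ∑ (λ s → ∑ (λ v → ⟦ V v ⟧ * ⟦ U (s ⊖ v) ⟧))
      ≡⟨ ∑-cong elems (λ s → trans (∑-cong elems (λ v → sym (⟦∧⟧ (V v) _))) (sym (card≡∑ _))) ⟩
    ∑ (λ s → card (representations U V s)) ∎
    where open ≡-Reasoning

  card-⊞-direct : ∀ {U V} → (∀ {u u′ v v′} → u ∈ U → u′ ∈ U → v ∈ V → v′ ∈ V → u +ᶠ v ≡ u′ +ᶠ v′ → v ≡ v′) →
    card U * card V ≤ card (U ⊞ V)
  card-⊞-direct {U} {V} unique = begin
    card U * card V                               ≡⟨ card-*-card U V ⟩
    ∑ (λ s → card (representations U V s))        ≤⟨ ∑-mono elems at-most-one ⟩
    ∑ (λ s → ⟦ (U ⊞ V) s ⟧)                       ≡⟨ sym (card≡∑ (U ⊞ V)) ⟩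
    card (U ⊞ V)                                  ∎
    where
    open ≤-Reasoning
    at-most-one : ∀ s → card (representations U V s) ≤ ⟦ (U ⊞ V) s ⟧
    at-most-one s = card-subsingleton {representations U V s} ((U ⊞ V) s)
      (λ v h → subst (_∈ U ⊞ V) (⊖-cancel s v) (⊞-intro (proj₂ (∧-elim {V v} h)) (proj₁ (∧-elim h))))
      (λ {v} {v′} h h′ → unique (proj₂ (∧-elim {V v} h)) (proj₂ (∧-elim {V v′} h′)) (proj₁ (∧-elim h)) (proj₁ (∧-elim h′))
        (trans (⊖-cancel s v) (sym (⊖-cancel s v′))))

  -- For d = u + w fixed, each z ∈ Z gives t = z - w in V + Z with d + t = u + z in U + Z. So every
  -- `d` has at least |Z| such `t`, while the pairs (t , d + t) number at most |V + Z| |U + Z| in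
  -- all.
  difference-triangle : ∀ {U V W Z} → (∀ {w} → w ∈ W → -ᶠ w ∈ V) →
    card (U ⊞ W) * card Z ≤ card (U ⊞ Z) * card (V ⊞ Z)
  difference-triangle {U} {V} {W} {Z} neg = begin
    card (U ⊞ W) * card Z
      ≡⟨ sym (∑-⟦⟧-* (U ⊞ W) (card Z)) ⟩
    ∑ (λ d → ⟦ (U ⊞ W) d ⟧ * card Z)
      ≤⟨ ∑-mono elems (λ d → at-least d ((U ⊞ W) d) refl) ⟩
    ∑ (λ d → card (fibre d))
      ≡⟨ ∑-cong elems (λ d → trans (card≡∑ (fibre d)) (∑-cong elems (λ t → ⟦∧⟧ (Q t) (P (d +ᶠ t))))) ⟩
    ∑ (λ d → ∑ (λ t → ⟦ Q t ⟧ * ⟦ P (d +ᶠ t) ⟧))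
      ≡⟨ ∑-swap elems elems _ ⟩
    ∑ (λ t → ∑ (λ d → ⟦ Q t ⟧ * ⟦ P (d +ᶠ t) ⟧))
      ≡⟨ ∑-cong elems (λ t → trans (∑-*ˡ elems ⟦ Q t ⟧ _) (cong (⟦ Q t ⟧ *_) (trans (∑-translate t (λ s → ⟦ P s ⟧)) (sym (card≡∑ P))))) ⟩
    ∑ (λ t → ⟦ Q t ⟧ * card P)
      ≡⟨ ∑-⟦⟧-* Q (card P) ⟩
    card Q * card P
      ≡⟨ *-comm (card Q) (card P) ⟩
    card P * card Q ∎
    where
    open ≤-Reasoning
    P = U ⊞ Z
    Q = V ⊞ Z
    fibre : Carrier → Subset
    fibre d t = Q t ∧ P (d +ᶠ t)
    at-least : ∀ d b → (U ⊞ W) d ≡ b → ⟦ b ⟧ * card Z ≤ card (fibre d)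
    at-least d false _ = z≤n
    at-least d true d∈ with ⊞-elim d∈
    ... | u , w , u∈ , w∈ , refl = begin
      card Z + 0                       ≡⟨ +-identityʳ _ ⟩
      card Z                           ≡⟨ sym (card-translate (-ᶠ w) Z) ⟩
      card (λ t → Z (t ⊖ (-ᶠ w)))      ≤⟨ card-mono {λ t → Z (t ⊖ (-ᶠ w))} {fibre (u +ᶠ w)} inclusion ⟩
      card (fibre (u +ᶠ w))            ∎
      where
      inclusion : ∀ {t} → Z (t ⊖ (-ᶠ w)) ≡ true → fibre (u +ᶠ w) t ≡ true
      inclusion {t} h = ∧-intro
        (subst (_∈ Q) (solve 2 (λ w t → :- w :+ (t :- :- w) := t) refl w t) (⊞-intro (neg w∈) h))
        (subst (_∈ P) (solve 3 (λ u w t → u :+ (t :- :- w) := u :+ w :+ t) refl u w t) (⊞-intro u∈ h))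

  -- Multiplicative energy

  -- Cauchy–Schwarz for the multiplicative energy, then averaging over one of its variables.
  popular-dilate : ∀ {A P M} → (∀ {x} → x ∈ A → x ≢ 0#) → (∀ {x y} → x ∈ A → y ∈ A → x · y ∈ P) → card P ≤ M → 1 ≤ card A →
    ∃ λ a → a ∈ A × card A * card A * card A ≤ M * ∑ (λ b → ⟦ A b ⟧ * card ((b ⊙ A) ∩ (a ⊙ A)))
  popular-dilate {A} {P} {M} nonzero AA⊆P P≤M pos =
    from-average (∃-below-average elems (λ x → ⟦ A x ⟧) (λ _ → E) (λ a → α * S a) (subst (1 ≤_) (card≡∑ A) pos) average)
    where
    open ≤-Reasoning
    α = card A
    S : Carrier → ℕ
    S a = ∑ (λ b → ⟦ A b ⟧ * card ((b ⊙ A) ∩ (a ⊙ A)))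
    E = ∑ (λ a → ⟦ A a ⟧ * S a)
    average : ∑ (λ x → ⟦ A x ⟧ * E) ≤ ∑ (λ x → ⟦ A x ⟧ * (α * S x))
    average = ≤-reflexive (trans (∑-⟦⟧-* A E)
      (trans (sym (∑-*ˡ elems α (λ x → ⟦ A x ⟧ * S x))) (∑-cong elems λ x → e α ⟦ A x ⟧ (S x))))
      where
      e : ∀ a b c → a * (b * c) ≡ b * (a * c)
      e = solve-∀
    e₁ : ∀ a → a * (a * a * a) ≡ a * a * (a * a)
    e₁ = solve-∀
    e₂ : ∀ m a s → m * (a * s) ≡ a * (m * s)
    e₂ = solve-∀
    -- `r y` counts the factorisations of `y` over `A`; its first moment is |A|², its second the
    -- multiplicative energy `E`.
    r : Carrier → ℕ
    r y = ∑ (λ a → ⟦ A a ⟧ * ⟦ (a ⊙ A) y ⟧)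
    ∑r : ∑ r ≡ α * α
    ∑r = trans (∑-swap elems elems _) (trans (∑-cong elems row) (∑-⟦⟧-* A α))
      where
      row : ∀ a → ∑ (λ y → ⟦ A a ⟧ * ⟦ (a ⊙ A) y ⟧) ≡ ⟦ A a ⟧ * α
      row a = trans (∑-*ˡ elems ⟦ A a ⟧ _) (size (a ∈? A))
        where
        size : Dec (a ∈ A) → ⟦ A a ⟧ * ∑ (λ y → ⟦ (a ⊙ A) y ⟧) ≡ ⟦ A a ⟧ * α
        size (yes a∈A) = cong (⟦ A a ⟧ *_) (trans (sym (card≡∑ (a ⊙ A))) (card-⊙ (nonzero a∈A) A))
        size (no a∉A) with A a
        ... | true = contradiction refl a∉A
        ... | false = refl
    supp : ∀ y → P y ≢ true → r y ≡ 0
    supp y y∉P = trans (∑-cong elems absent) (∑-zero elems)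
      where
      absent : ∀ a → ⟦ A a ⟧ * ⟦ (a ⊙ A) y ⟧ ≡ 0
      absent a with A a in a∈ | (a ⊙ A) y in y∈
      ... | false | _ = refl
      ... | true | false = refl
      ... | true | true with ⊙-elim y∈
      ...   | s , s∈ , refl = contradiction (AA⊆P a∈ s∈) y∉P
    ∑r² : ∑ (λ y → r y * r y) ≡ E
    ∑r² = begin-equality
      ∑ (λ y → r y * r y)
        ≡⟨ ∑-cong elems (λ y → ∑-* elems elems (term y) (term y)) ⟩
      ∑ (λ y → ∑ (λ a → ∑ (λ b → term y a * term y b)))
        ≡⟨ ∑-swap elems elems _ ⟩
      ∑ (λ a → ∑ (λ y → ∑ (λ b → term y a * term y b)))
        ≡⟨ ∑-cong elems (λ a → ∑-swap elems elems _) ⟩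
      ∑ (λ a → ∑ (λ b → ∑ (λ y → term y a * term y b)))
        ≡⟨ ∑-cong elems (λ a → ∑-cong elems (cell a)) ⟩
      ∑ (λ a → ∑ (λ b → ⟦ A a ⟧ * (⟦ A b ⟧ * card ((b ⊙ A) ∩ (a ⊙ A)))))
        ≡⟨ ∑-cong elems (λ a → ∑-*ˡ elems ⟦ A a ⟧ _) ⟩
      E ∎
      where
      term : Carrier → Carrier → ℕ
      term y a = ⟦ A a ⟧ * ⟦ (a ⊙ A) y ⟧
      e₃ : ∀ a y b z → a * y * (b * z) ≡ a * b * (z * y)
      e₃ = solve-∀
      cell : ∀ a b → ∑ (λ y → term y a * term y b) ≡ ⟦ A a ⟧ * (⟦ A b ⟧ * card ((b ⊙ A) ∩ (a ⊙ A)))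
      cell a b = begin-equality
        ∑ (λ y → term y a * term y b)
          ≡⟨ ∑-cong elems (λ y → trans (e₃ ⟦ A a ⟧ _ ⟦ A b ⟧ _) (cong (⟦ A a ⟧ * ⟦ A b ⟧ *_) (sym (⟦∧⟧ ((b ⊙ A) y) ((a ⊙ A) y))))) ⟩
        ∑ (λ y → ⟦ A a ⟧ * ⟦ A b ⟧ * ⟦ ((b ⊙ A) ∩ (a ⊙ A)) y ⟧)
          ≡⟨ ∑-*ˡ elems (⟦ A a ⟧ * ⟦ A b ⟧) _ ⟩
        ⟦ A a ⟧ * ⟦ A b ⟧ * ∑ (λ y → ⟦ ((b ⊙ A) ∩ (a ⊙ A)) y ⟧)
          ≡⟨ cong (⟦ A a ⟧ * ⟦ A b ⟧ *_) (sym (card≡∑ ((b ⊙ A) ∩ (a ⊙ A)))) ⟩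
        ⟦ A a ⟧ * ⟦ A b ⟧ * card ((b ⊙ A) ∩ (a ⊙ A))
          ≡⟨ *-assoc ⟦ A a ⟧ ⟦ A b ⟧ _ ⟩
        ⟦ A a ⟧ * (⟦ A b ⟧ * card ((b ⊙ A) ∩ (a ⊙ A))) ∎
    from-average : (∃ λ a → 1 ≤ ⟦ A a ⟧ × E ≤ α * S a) → ∃ λ a → a ∈ A × α * α * α ≤ M * S a
    from-average (a , wa , E≤αS) = a , 1≤⟦⟧⇒ wa , *-cancelˡ-≤ α ⦃ >-nonZero pos ⦄ (begin
      α * (α * α * α)                     ≡⟨ e₁ α ⟩
      α * α * (α * α)                     ≡⟨ cong₂ _*_ (sym ∑r) (sym ∑r) ⟩
      ∑ r * ∑ r                           ≤⟨ ∑²≤ elems P r supp ⟩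
      ∑ (λ y → ⟦ P y ⟧) * ∑ (λ y → r y * r y)   ≡⟨ cong₂ _*_ (sym (card≡∑ P)) ∑r² ⟩
      card P * E                          ≤⟨ *-mono-≤ P≤M E≤αS ⟩
      M * (α * S a)                       ≡⟨ e₂ M α (S a) ⟩
      α * (M * S a)                       ∎)

  -- To be applied with v(b) = |bA ∩ zA|. The factor `suc L` is the number of dyadic levels 2^0,
  -- ..., 2^L.
  record LevelSet (A : Subset) (v : Carrier → ℕ) (M L : ℕ) : Set where
    field
      B     : Subset
      N     : ℕ
      B⊆A   : B ⊆ A
      N≤v   : ∀ {b} → b ∈ B → N ≤ v b
      1≤N   : 1 ≤ N
      large : card A * card A ≤ 2 * M * N
      mass  : card A * card A * card A ≤ 2 * M * (suc L * (N * card B))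

  -- Values of v below τ ≈ |A|²/2M contribute at most half of the total; the rest is split into dyadic levels.
  level-set : ∀ {A v M L} → 1 ≤ M → (∀ b → v b < 2 ^ suc L) →
    card A * card A * card A ≤ M * ∑ (λ b → ⟦ A b ⟧ * v b) → LevelSet A v M L
  level-set {A} {v} {M} {L} 1≤M v<2^k h = from-level (∃-max-term L (λ j → 2 ^ j * c j))
    where
    open ≤-Reasoning
    α = card A
    instance
      2M-nonZero : NonZero (2 * M)
      2M-nonZero = >-nonZero (*-mono-≤ {1} {2} (s≤s z≤n) 1≤M)
    τ = α * α / (2 * M)
    -- Raising every threshold above τ makes even the low levels popular, and loses nothing because
    -- values up to τ are accounted for separately.
    N : ℕ → ℕ
    N j = 2 ^ j ⊔ suc τ
    B : ℕ → Subset
    B j b = A b ∧ does (N j ≤? v b)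
    c : ℕ → ℕ
    c j = card (B j)
    T = ∑< (suc L) (λ j → 2 ^ j * c j)
    τ-upper : α * α ≤ 2 * M * suc τ
    τ-upper = begin
      α * α                                     ≡⟨ m≡m%n+[m/n]*n (α * α) (2 * M) ⟩
      α * α % (2 * M) + τ * (2 * M)             ≤⟨ +-monoˡ-≤ _ (<⇒≤ (m%n<n (α * α) (2 * M))) ⟩
      2 * M + τ * (2 * M)                       ≡⟨ *-comm (suc τ) (2 * M) ⟩
      2 * M * suc τ                             ∎
    S = ∑ (λ b → ⟦ A b ⟧ * v b)
    levels : ∀ b → v b ≤ τ + ∑< (suc L) (λ j → 2 ^ j * ⟦ does (N j ≤? v b) ⟧)
    levels b with suc τ ≤? v b
    ... | no p = ≤-trans (≤-pred (≰⇒> p)) (m≤m+n τ _)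
    ... | yes τ<v = ≤-trans (v≤dyadic (suc L) (v<2^k b)) (≤-trans (∑<-mono (suc L) λ j →
            *-monoʳ-≤ (2 ^ j) (⟦⟧-mono λ e → dec-true (N j ≤? v b) (⊔-lub (does⇒ (2 ^ j ≤? v b) e) τ<v))) (m≤n+m _ τ))
    weighted-levels : ∀ b → ⟦ A b ⟧ * v b ≤ ⟦ A b ⟧ * τ + ∑< (suc L) (λ j → 2 ^ j * ⟦ B j b ⟧)
    weighted-levels b with A b
    ... | false = z≤n
    ... | true = ≤-trans (≤-reflexive (+-identityʳ (v b)))
                   (subst (λ z → v b ≤ z + ∑< (suc L) (λ j → 2 ^ j * ⟦ does (N j ≤? v b) ⟧)) (sym (+-identityʳ τ)) (levels b))
    S≤ : S ≤ α * τ + T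
    S≤ = begin
      S
        ≤⟨ ∑-mono elems weighted-levels ⟩
      ∑ (λ b → ⟦ A b ⟧ * τ + ∑< (suc L) (λ j → 2 ^ j * ⟦ B j b ⟧))
        ≡⟨ ∑-+ elems _ _ ⟩
      ∑ (λ b → ⟦ A b ⟧ * τ) + ∑ (λ b → ∑< (suc L) (λ j → 2 ^ j * ⟦ B j b ⟧))
        ≡⟨ cong₂ _+_ (∑-⟦⟧-* A τ)
             (trans (∑-∑< elems (suc L) (λ j b → 2 ^ j * ⟦ B j b ⟧))
               (∑<-cong (suc L) (λ j → trans (∑-*ˡ elems (2 ^ j) (λ b → ⟦ B j b ⟧)) (cong (2 ^ j *_) (sym (card≡∑ (B j))))))) ⟩
      α * τ + T ∎
    -- The low values contribute at most α τ to the sum, and 2 M α τ ≤ α³ is half of the 2 α³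
    -- available.
    α³≤2MT : α * α * α ≤ 2 * M * T
    α³≤2MT = +-cancelˡ-≤ (α * α * α) _ _ (begin
      α * α * α + α * α * α             ≤⟨ +-mono-≤ h h ⟩
      M * S + M * S                     ≡⟨ e₁ M S ⟩
      2 * M * S                         ≤⟨ *-monoʳ-≤ (2 * M) S≤ ⟩
      2 * M * (α * τ + T)               ≡⟨ e₂ (2 * M) α τ T ⟩
      τ * (2 * M) * α + 2 * M * T       ≤⟨ +-monoˡ-≤ (2 * M * T) (*-monoˡ-≤ α (m/n*n≤m (α * α) (2 * M))) ⟩
      α * α * α + 2 * M * T             ∎)
      where
      e₁ : ∀ m s → m * s + m * s ≡ 2 * m * s
      e₁ = solve-∀
      e₂ : ∀ m a τ t → m * (a * τ + t) ≡ τ * m * a + m * t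
      e₂ = solve-∀
    from-level : (∃ λ j → j ≤ L × T ≤ suc L * (2 ^ j * c j)) → LevelSet A v M L
    from-level (j , _ , T≤) = record
      { B = B j
      ; N = N j
      ; B⊆A = λ b∈ → proj₁ (∧-elim b∈)
      ; N≤v = λ {b} b∈ → does⇒ (N j ≤? v b) (proj₂ (∧-elim {A b} b∈))
      ; 1≤N = ≤-trans (s≤s z≤n) (m≤n⊔m (2 ^ j) (suc τ))
      ; large = ≤-trans τ-upper (*-monoʳ-≤ (2 * M) (m≤n⊔m (2 ^ j) (suc τ)))
      ; mass = ≤-trans α³≤2MT (*-monoʳ-≤ (2 * M) (≤-trans T≤ (*-monoʳ-≤ (suc L) (*-monoˡ-≤ (c j) (m≤m⊔n (2 ^ j) (suc τ))))))
      }

  -- Quotient sets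

  Quotient : Subset → Carrier → Carrier → Carrier → Carrier → Carrier → Set
  Quotient B x a c d e = a ∈ B × c ∈ B × d ∈ B × e ∈ B × d ≢ e × x · (d ⊖ e) ≡ a ⊖ c

  quotient? : ∀ B x → Dec (∃ λ a → ∃ λ c → ∃ λ d → ∃ λ e → Quotient B x a c d e)
  quotient? B x = search λ a → search λ c → search λ d → search λ e →
    (a ∈? B) ×-dec (c ∈? B) ×-dec (d ∈? B) ×-dec (e ∈? B) ×-dec ¬? (d ≟ᶠ e) ×-dec ((x · (d ⊖ e)) ≟ᶠ (a ⊖ c))

  opaque
    quotients : Subset → Subset
    quotients B x = does (quotient? B x)

    quotients-intro : ∀ {B x a c d e} → Quotient B x a c d e → x ∈ quotients B
    quotients-intro {B} {x} {a} {c} {d} {e} Q = dec-true (quotient? B x) (a , c , d , e , Q)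

    quotients-elim : ∀ {B x} → x ∈ quotients B → ∃ λ a → ∃ λ c → ∃ λ d → ∃ λ e → Quotient B x a c d e
    quotients-elim {B} {x} h = does⇒ (quotient? B x) h

  module _ {B : Subset} where

    private
      R = quotients B

    0∈quotients : ∀ {d e} → d ∈ B → e ∈ B → d ≢ e → 0# ∈ R
    0∈quotients {d} {e} d∈ e∈ d≢e =
      quotients-intro (d∈ , d∈ , d∈ , e∈ , d≢e , trans (·-zeroˡ _) (sym (-‿inverseʳ d)))

    1∈quotients : ∀ {d e} → d ∈ B → e ∈ B → d ≢ e → 1# ∈ R
    1∈quotients {d} {e} d∈ e∈ d≢e = quotients-intro (d∈ , e∈ , d∈ , e∈ , d≢e , ·-identityˡ _)

    neg-quotients : ∀ {x} → x ∈ R → -ᶠ x ∈ R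
    neg-quotients {x} x∈ with quotients-elim x∈
    ... | a , c , d , e , a∈ , c∈ , d∈ , e∈ , d≢e , eq = quotients-intro (c∈ , a∈ , d∈ , e∈ , d≢e ,
      trans (solve 2 (λ x y → :- x :* y := :- (x :* y)) refl x (d ⊖ e))
        (trans (cong -ᶠ_ eq) (solve 2 (λ a c → :- (a :- c) := c :- a) refl a c)))

    module _ (nonzero : ∀ {β} → β ∈ B → β ≢ 0#) {d₀ e₀} (d₀∈ : d₀ ∈ B) (e₀∈ : e₀ ∈ B) (d₀≢e₀ : d₀ ≢ e₀)
             (+1-closed : ∀ {x} → x ∈ R → x +ᶠ 1# ∈ R) (B·-closed : ∀ {β x} → β ∈ B → x ∈ R → β · x ∈ R) where

      private
        -- `AddStable` is the additive stabiliser of `R`, a group containing 1, and `MulStable` the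
        -- ring of multipliers of that group. The ring contains `B` and inverses of its nonzero
        -- elements, hence all of `R`; conversely w = w · 1 + 0 lies in `R` for every multiplier. So
        -- `R` equals the ring of multipliers, which is a field.
        AddStable MulStable : Carrier → Set
        AddStable t = ∀ {r} → r ∈ R → t +ᶠ r ∈ R
        MulStable w = ∀ {t} → AddStable t → AddStable (w · t)

        inv-closed′ : ∀ {β x} → β ∈ B → x ∈ R → inv β · x ∈ R
        inv-closed′ {β} {x} β∈ x∈ with inv-power (nonzero β∈)
        ... | k , e = subst (λ z → z · x ∈ R) (sym e) (power k)
          where
          power : ∀ k → β ^ᶠ k · x ∈ R
          power zero = subst (_∈ R) (sym (·-identityˡ x)) x∈
          power (suc k) = subst (_∈ R) (sym (·-assoc β (β ^ᶠ k) x)) (B·-closed β∈ (power k))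

        add-1 : AddStable 1#
        add-1 r∈ = subst (_∈ R) (+ᶠ-comm _ 1#) (+1-closed r∈)

        add-+ : ∀ {s t} → AddStable s → AddStable t → AddStable (s +ᶠ t)
        add-+ {s} {t} hs ht r∈ = subst (_∈ R) (sym (+ᶠ-assoc s t _)) (hs (ht r∈))

        add-neg : ∀ {t} → AddStable t → AddStable (-ᶠ t)
        add-neg {t} ht {r} r∈ = subst (_∈ R) (solve 2 (λ t r → :- (t :- r) := :- t :+ r) refl t r)
          (neg-quotients (ht (neg-quotients r∈)))

        add⇒∈ : ∀ {t} → AddStable t → t ∈ R
        add⇒∈ ht = subst (_∈ R) (+ᶠ-identityʳ _) (ht (0∈quotients d₀∈ e₀∈ d₀≢e₀))

        -- Because β t + r = β (t + β⁻¹ r), and both β and β⁻¹ map `R` into itself.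
        B⇒mul : ∀ {β} → β ∈ B → MulStable β
        B⇒mul {β} β∈ {t} ht {r} r∈ = subst (_∈ R)
          (trans (·-distribˡ β t (inv β · r)) (cong (β · t +ᶠ_) (·inv-cancel (nonzero β∈) r)))
          (B·-closed β∈ (ht (inv-closed′ β∈ r∈)))

        mul-⊖ : ∀ {v w} → MulStable v → MulStable w → MulStable (v ⊖ w)
        mul-⊖ {v} {w} hv hw {t} ht = subst AddStable
          (solve 3 (λ v w t → v :* t :- w :* t := (v :- w) :* t) refl v w t) (add-+ (hv ht) (add-neg (hw ht)))

        mul-· : ∀ {v w} → MulStable v → MulStable w → MulStable (v · w)
        mul-· {v} {w} hv hw {t} ht = subst AddStable (sym (·-assoc v w t)) (hv (hw ht))

        mul-inv : ∀ {w} → w ≢ 0# → MulStable w → MulStable (inv w)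
        mul-inv {w} w≢0 hw with inv-power w≢0
        ... | k , e = subst MulStable (sym e) (power k)
          where
          power : ∀ k → MulStable (w ^ᶠ k)
          power zero {t} ht = subst AddStable (sym (·-identityˡ t)) ht
          power (suc k) = mul-· hw (power k)

        mul⇒add : ∀ {w} → MulStable w → AddStable w
        mul⇒add {w} hw = subst AddStable (·-identityʳ w) (hw add-1)

        ∈⇒mul : ∀ {x} → x ∈ R → MulStable x
        ∈⇒mul {x} x∈ with quotients-elim x∈
        ... | a , c , d , e , a∈ , c∈ , d∈ , e∈ , d≢e , eq = subst MulStable (sym x≡)
          (mul-· (mul-inv d⊖e≢0 (mul-⊖ (B⇒mul d∈) (B⇒mul e∈))) (mul-⊖ (B⇒mul a∈) (B⇒mul c∈)))
          where
          d⊖e≢0 : d ⊖ e ≢ 0#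
          d⊖e≢0 z = d≢e (x⊖y≡0⇒x≡y z)
          x≡ : x ≡ inv (d ⊖ e) · (a ⊖ c)
          x≡ = trans (sym (inv·-cancel d⊖e≢0 x)) (cong (inv (d ⊖ e) ·_) (trans (·-comm (d ⊖ e) x) eq))

        mul⇒∈ : ∀ {w} → MulStable w → w ∈ R
        mul⇒∈ hw = add⇒∈ (mul⇒add hw)

      quotients-subfield : IsSubfield R
      quotients-subfield = record
        { has-0 = 0∈quotients d₀∈ e₀∈ d₀≢e₀
        ; has-1 = 1∈quotients d₀∈ e₀∈ d₀≢e₀
        ; +-closed = λ x y x∈ y∈ → mul⇒add (∈⇒mul x∈) y∈
        ; neg-closed = λ x → neg-quotients
        ; *-closed = λ x y x∈ y∈ → mul⇒∈ (mul-· (∈⇒mul x∈) (∈⇒mul y∈))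
        ; inv-closed = λ x y x∈ xy≡1 → subst (_∈ R) (sym (inv-unique xy≡1)) (mul⇒∈ (mul-inv (nz xy≡1) (∈⇒mul x∈)))
        }
        where
        nz : ∀ {x y} → x · y ≡ 1# → x ≢ 0#
        nz {y = y} e refl = 0≢1 (trans (sym (·-zeroˡ y)) e)

      ⊆quotients : B ⊆ R
      ⊆quotients β∈ = mul⇒∈ (B⇒mul β∈)

  -- Sumsets with dilates

  -- A coincidence u + y v = u′ + y v′ with v ≠ v′ would exhibit `y` as the quotient (u′ - u) / (v -
  -- v′).
  card-⊞-⊙-direct : ∀ {B U V y} → U ⊆ B → V ⊆ B → y ≢ 0# → ¬ y ∈ quotients B → card U * card V ≤ card (U ⊞ y ⊙ V)
  card-⊞-⊙-direct {B} {U} {V} {y} U⊆B V⊆B y≢0 y∉ =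
    subst (λ z → card U * z ≤ card (U ⊞ y ⊙ V)) (card-⊙ y≢0 V) (card-⊞-direct unique)
    where
    rearrange : ∀ {u u′ v v′} → u +ᶠ y · v ≡ u′ +ᶠ y · v′ → y · (v ⊖ v′) ≡ u′ ⊖ u
    rearrange {u} {u′} {v} {v′} e = trans
      (solve 4 (λ u y v v′ → y :* (v :- v′) := (u :+ y :* v) :- u :- y :* v′) refl u y v v′)
      (trans (cong (λ z → z ⊖ u ⊖ y · v′) e)
        (solve 4 (λ u u′ y v′ → u′ :+ y :* v′ :- u :- y :* v′ := u′ :- u) refl u u′ y v′))
    unique : ∀ {u u′ w w′} → u ∈ U → u′ ∈ U → w ∈ y ⊙ V → w′ ∈ y ⊙ V → u +ᶠ w ≡ u′ +ᶠ w′ → w ≡ w′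
    unique u∈ u′∈ w∈ w′∈ e with ⊙-elim w∈ | ⊙-elim w′∈
    ... | v , v∈ , refl | v′ , v′∈ , refl with v ≟ᶠ v′
    ...   | yes v≡v′ = cong (y ·_) v≡v′
    ...   | no v≢v′ = contradiction (quotients-intro (U⊆B u′∈ , U⊆B u∈ , V⊆B v∈ , V⊆B v′∈ , v≢v′ , rearrange e)) y∉

  module _ {A B : Subset} {M N : ℕ} (nonzero : ∀ {x} → x ∈ A → x ≢ 0#) (A⊞A≤M : card (A ⊞ A) ≤ M)
           (1≤A : 1 ≤ card A) (B⊆A : B ⊆ A) (1≤N : 1 ≤ N) (N≤ : ∀ {b} → b ∈ B → N ≤ card (A ∩ (b ⊙ A))) where

    open ≤-Reasoning

    private
      ⊞≤M : ∀ {t U V} → t ≢ 0# → U ⊆ t ⊙ A → V ⊆ t ⊙ A → card (U ⊞ V) ≤ M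
      ⊞≤M t≢0 U⊆ V⊆ = ≤-trans (card-mono (⊞-mono U⊆ V⊆)) (≤-trans (card-⊙-⊞ t≢0 A A) A⊞A≤M)

      1≤⊙ : ∀ {t} → t ≢ 0# → 1 ≤ card (t ⊙ A)
      1≤⊙ t≢0 = subst (1 ≤_) (sym (card-⊙ t≢0 A)) 1≤A

      popular : ∀ {b} → b ∈ B → Subset
      popular {b} _ = A ∩ (b ⊙ A)

    -- Triangle inequality through Z = A ∩ bA: Z + A lies in A + A, and Z + bA in b (A + A), both of
    -- size at most `M`.
    card-⊞-dilate : ∀ {b} → b ∈ B → card (A ⊞ b ⊙ A) * N ≤ 4 * (M * M)
    card-⊞-dilate {b} b∈ = begin
      card (A ⊞ b ⊙ A) * N             ≤⟨ *-monoʳ-≤ (card (A ⊞ b ⊙ A)) (N≤ b∈) ⟩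
      card (A ⊞ b ⊙ A) * card Z        ≤⟨ sum-triangle (≤-trans 1≤N (N≤ b∈)) 1≤A (1≤⊙ b≢0) ⟩
      4 * (card (Z ⊞ A) * card (Z ⊞ b ⊙ A))
        ≤⟨ *-monoʳ-≤ 4 (*-mono-≤ (≤-trans (card-mono (⊞-mono (λ h → proj₁ (∧-elim h)) id)) A⊞A≤M)
                                 (⊞≤M b≢0 (λ {x} h → proj₂ (∧-elim {A x} h)) id)) ⟩
      4 * (M * M)                      ∎
      where
      Z = popular b∈
      b≢0 = nonzero (B⊆A b∈)

    -- The same `Z` serves for A - bA, now with the difference inequality. The factor 4 is added
    -- only for uniformity with the previous bound.
    card-⊞-neg-dilate : ∀ {b} → b ∈ B → card (A ⊞ (-ᶠ b) ⊙ A) * N ≤ 4 * (M * M)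
    card-⊞-neg-dilate {b} b∈ = begin
      card (A ⊞ (-ᶠ b) ⊙ A) * N             ≤⟨ *-monoʳ-≤ (card (A ⊞ (-ᶠ b) ⊙ A)) (N≤ b∈) ⟩
      card (A ⊞ (-ᶠ b) ⊙ A) * card Z        ≤⟨ difference-triangle {A} {b ⊙ A} negate ⟩
      card (A ⊞ Z) * card (b ⊙ A ⊞ Z)
        ≤⟨ *-mono-≤ (≤-trans (card-mono (⊞-mono id (λ h → proj₁ (∧-elim h)))) A⊞A≤M)
                    (⊞≤M b≢0 id (λ {x} h → proj₂ (∧-elim {A x} h))) ⟩
      M * M                                 ≤⟨ m≤m+n (M * M) _ ⟩
      4 * (M * M)                           ∎
      where
      Z = popular b∈
      b≢0 = nonzero (B⊆A b∈)
      negate : ∀ {w} → w ∈ (-ᶠ b) ⊙ A → -ᶠ w ∈ b ⊙ A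
      negate w∈ with ⊙-elim w∈
      ... | s , s∈ , refl = subst (_∈ b ⊙ A) (solve 2 (λ b s → b :* s := :- (:- b :* s)) refl b s) (⊙-intro s∈)

    -- With x = (a - c) / (d - e), the dilate (d - e)(A + xA) lies in dA - eA + aA - cA. Plünnecke
    -- splits this into four dilates, and each bound consumes one `N`.
    card-⊞-quotient : ∀ {x} → x ∈ quotients B →
      card (A ⊞ x ⊙ A) * (card A * (card A * card A)) * (N * N * N * N) ≤ 256 * (4 * (M * M) * (4 * (M * M)) * (4 * (M * M)) * (4 * (M * M)))
    card-⊞-quotient {x} x∈ with quotients-elim x∈
    ... | a , c , d , e , a∈ , c∈ , d∈ , e∈ , d≢e , eq = begin
      card (A ⊞ x ⊙ A) * α³ * (N * N * N * N)
        ≤⟨ *-monoˡ-≤ (N * N * N * N) (*-monoˡ-≤ α³ expand) ⟩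
      card (d ⊙ A ⊞ (-ᶠ e) ⊙ A ⊞ a ⊙ A ⊞ (-ᶠ c) ⊙ A) * α³ * (N * N * N * N)
        ≤⟨ *-monoˡ-≤ (N * N * N * N) (plünnecke₄ 1≤A refl refl refl refl (pos _) (pos _) (pos _) (pos _)) ⟩
      256 * (m₁ * m₂ * m₃ * m₄) * (N * N * N * N)
        ≡⟨ regroup m₁ m₂ m₃ m₄ N ⟩
      256 * (m₁ * N * (m₂ * N) * (m₃ * N) * (m₄ * N))
        ≤⟨ *-monoʳ-≤ 256 (*-mono-≤ (*-mono-≤ (*-mono-≤ (card-⊞-dilate d∈) (card-⊞-neg-dilate e∈)) (card-⊞-dilate a∈)) (card-⊞-neg-dilate c∈)) ⟩
      256 * (4 * (M * M) * (4 * (M * M)) * (4 * (M * M)) * (4 * (M * M))) ∎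
      where
      α³ = card A * (card A * card A)
      m₁ = card (A ⊞ d ⊙ A)
      m₂ = card (A ⊞ (-ᶠ e) ⊙ A)
      m₃ = card (A ⊞ a ⊙ A)
      m₄ = card (A ⊞ (-ᶠ c) ⊙ A)
      regroup : ∀ a b c d n → 256 * (a * b * c * d) * (n * n * n * n) ≡ 256 * (a * n * (b * n) * (c * n) * (d * n))
      regroup = solve-∀
      pos : ∀ t → 1 ≤ card (A ⊞ t ⊙ A)
      pos t = ≤-trans 1≤A (card≤card-⊞ˡ {A} {t ⊙ A} (⊙-intro (proj₂ (1≤card⇒∃ 1≤A))))
      d⊖e≢0 : d ⊖ e ≢ 0#
      d⊖e≢0 z = d≢e (x⊖y≡0⇒x≡y z)
      Σ⁴ = d ⊙ A ⊞ (-ᶠ e) ⊙ A ⊞ a ⊙ A ⊞ (-ᶠ c) ⊙ A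
      inclusion : (d ⊖ e) ⊙ (A ⊞ x ⊙ A) ⊆ Σ⁴
      inclusion y∈ with ⊙-elim y∈
      ... | _ , s∈ , refl with ⊞-elim s∈
      ...   | u , _ , u∈ , w∈ , refl with ⊙-elim w∈
      ...     | v , v∈ , refl = subst (_∈ Σ⁴) (sym identity)
                (⊞-intro (⊞-intro (⊞-intro (⊙-intro u∈) (⊙-intro u∈)) (⊙-intro v∈)) (⊙-intro v∈))
        where
        identity : (d ⊖ e) · (u +ᶠ x · v) ≡ d · u +ᶠ (-ᶠ e) · u +ᶠ a · v +ᶠ (-ᶠ c) · v
        identity = trans (solve 5 (λ d e u x v → (d :- e) :* (u :+ x :* v) := (d :- e) :* u :+ (x :* (d :- e)) :* v) refl d e u x v)
          (trans (cong (λ z → (d ⊖ e) · u +ᶠ z · v) eq)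
            (solve 6 (λ d e u a c v → (d :- e) :* u :+ (a :- c) :* v := d :* u :+ :- e :* u :+ a :* v :+ :- c :* v) refl d e u a c v))
      expand : card (A ⊞ x ⊙ A) ≤ card Σ⁴
      expand = ≤-trans (≤-reflexive (sym (card-⊙ d⊖e≢0 (A ⊞ x ⊙ A)))) (card-mono inclusion)

    -- Plünnecke gives X ⊆ B with X + B + xB small, and this set contains X + (x + 1)B, which has
    -- size |X| |B| as x + 1 is no quotient.
    card³≤ : ∀ {x} → x +ᶠ 1# ≢ 0# → ¬ x +ᶠ 1# ∈ quotients B → 1 ≤ card B →
      card B * card B * card B ≤ 4 * (M * card (A ⊞ x ⊙ A))
    card³≤ {x} x+1≢0 x+1∉ 1≤B = decidable-stable (_ ≤? _) λ absurd →
      plünnecke₂ 1≤B (pos B 1≤B) (≤-trans 1≤B (card≤card-⊞ˡ {B} {x ⊙ B} (⊙-intro (proj₂ (1≤card⇒∃ 1≤B))))) λ (X , X⊆B , 1≤X , h) → absurd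
        (*-cancelʳ-≤ _ _ (card X) ⦃ >-nonZero 1≤X ⦄ (begin
          b * b * b * card X
            ≡⟨ regroup b (card X) ⟩
          card X * b * (b * b)
            ≤⟨ *-monoˡ-≤ (b * b) (card-⊞-⊙-direct X⊆B id x+1≢0 x+1∉) ⟩
          card (X ⊞ (x +ᶠ 1#) ⊙ B) * (b * b)
            ≤⟨ *-monoˡ-≤ (b * b) (card-mono (⊞-mono {X} id split)) ⟩
          card (X ⊞ (B ⊞ x ⊙ B)) * (b * b)
            ≤⟨ h ⟩
          4 * (card (B ⊞ B) * card (B ⊞ x ⊙ B)) * card X
            ≤⟨ *-monoˡ-≤ (card X) (*-monoʳ-≤ 4 (*-mono-≤ (≤-trans (card-mono (⊞-mono B⊆A B⊆A)) A⊞A≤M) (card-mono (⊞-mono B⊆A (⊙-mono B⊆A))))) ⟩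
          4 * (M * card (A ⊞ x ⊙ A)) * card X ∎))
      where
      b = card B
      pos : ∀ U → 1 ≤ card U → 1 ≤ card (B ⊞ U)
      pos U 1≤U = ≤-trans 1≤U (card≤card-⊞ʳ {B} (proj₂ (1≤card⇒∃ 1≤B)))
      regroup : ∀ b x → b * b * b * x ≡ x * b * (b * b)
      regroup = solve-∀
      split : (x +ᶠ 1#) ⊙ B ⊆ B ⊞ x ⊙ B
      split y∈ with ⊙-elim y∈
      ... | s , s∈ , refl = subst (_∈ B ⊞ x ⊙ B) (trans (cong (_+ᶠ x · s) (sym (·-identityˡ s)))
        (solve 3 (λ x o s → o :* s :+ x :* s := (x :+ o) :* s) refl x 1# s)) (⊞-intro s∈ (⊙-intro s∈))

    -- The set x (A ∩ βA) lies in both xA and βxA. A triangle through it bounds |B + βxB|, which is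
    -- at least |B|², by |A + xA| and the size of βx (A + A).
    card²*N≤ : ∀ {x β} → x ≢ 0# → β ∈ B → ¬ β · x ∈ quotients B →
      card B * card B * N ≤ 4 * (M * card (A ⊞ x ⊙ A))
    card²*N≤ {x} {β} x≢0 β∈ βx∉ = begin
      card B * card B * N
        ≤⟨ *-mono-≤ (card-⊞-⊙-direct id id βx≢0 βx∉) (N≤ β∈) ⟩
      card (B ⊞ (β · x) ⊙ B) * card (popular β∈)
        ≡⟨ cong (card (B ⊞ (β · x) ⊙ B) *_) (sym (card-⊙ x≢0 (popular β∈))) ⟩
      card (B ⊞ (β · x) ⊙ B) * card Z
        ≤⟨ sum-triangle (subst (1 ≤_) (sym (card-⊙ x≢0 _)) (≤-trans 1≤N (N≤ β∈))) (∈⇒1≤card β∈)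
             (subst (1 ≤_) (sym (card-⊙ βx≢0 B)) (∈⇒1≤card β∈)) ⟩
      4 * (card (Z ⊞ B) * card (Z ⊞ (β · x) ⊙ B))
        ≤⟨ *-monoʳ-≤ 4 (*-mono-≤
             (≤-trans (card-⊞-comm Z B) (card-mono (⊞-mono B⊆A (⊙-mono (λ h → proj₁ (∧-elim h))))))
             (⊞≤M βx≢0 Z⊆ (⊙-mono B⊆A))) ⟩
      4 * (card (A ⊞ x ⊙ A) * M)
        ≡⟨ cong (4 *_) (*-comm _ M) ⟩
      4 * (M * card (A ⊞ x ⊙ A)) ∎
      where
      Z = x ⊙ popular β∈
      βx≢0 : β · x ≢ 0#
      βx≢0 = ·-nonzero (nonzero (B⊆A β∈)) x≢0
      Z⊆ : Z ⊆ (β · x) ⊙ A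
      Z⊆ z∈ with ⊙-elim z∈
      ... | p , p∈ , refl with ⊙-elim (proj₂ (∧-elim {A p} p∈))
      ...   | s , s∈ , refl = subst (_∈ (β · x) ⊙ A) (solve 3 (λ x β s → β :* x :* s := x :* (β :* s)) refl x β s) (⊙-intro s∈)

  -- Incidences

  ∑-affine : ∀ {t} → t ≢ 0# → ∀ S u → ∑ (λ x → ⟦ S (u +ᶠ x · t) ⟧) ≡ card S
  ∑-affine {t} t≢0 S u = trans
    (∑-reindex (λ x → u +ᶠ x · t) (λ y → (y ⊖ u) · inv t)
      (λ x → trans (solve 4 (λ u x t i → (u :+ x :* t :- u) :* i := x :* (t :* i)) refl u x t (inv t))
               (trans (cong (x ·_) (·-inverseʳ t≢0)) (·-identityʳ x)))
      (λ y → trans (solve 4 (λ u y t i → u :+ (y :- u) :* i :* t := u :+ (y :- u) :* (i :* t)) refl u y t (inv t))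
               (trans (cong (λ z → u +ᶠ (y ⊖ u) · z) (·-inverseˡ t≢0))
                 (trans (cong (u +ᶠ_) (·-identityʳ (y ⊖ u))) (solve 2 (λ u y → u :+ (y :- u) := y) refl u y))))
      (λ y → ⟦ S y ⟧))
    (sym (card≡∑ S))

  ⟦⟧²≡ : ∀ b → ⟦ b ⟧ * ⟦ b ⟧ ≡ ⟦ b ⟧
  ⟦⟧²≡ false = refl
  ⟦⟧²≡ true = refl

  ⟦⟧≤1 : ∀ b → ⟦ b ⟧ ≤ 1
  ⟦⟧≤1 b = ⟦⟧-mono {b} {true} (λ _ → refl)

  -- Each (b , c) ∈ B₁ × B₂ is the line s = c + x b in the (x , s) plane; incidences x s counts the lines through (x , s).
  module Lines (B₁ B₂ : Subset) where

    private
      b₁ = card B₁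
      b₂ = card B₂
      B₂-term : Carrier → Carrier → Carrier → ℕ
      B₂-term x s b = ⟦ B₂ (s ⊖ x · b) ⟧

    incidences : Carrier → Carrier → ℕ
    incidences x s = ∑ (λ b → ⟦ B₁ b ⟧ * ⟦ B₂ (s ⊖ x · b) ⟧)

    ∑-incidences : ∀ x → ∑ (incidences x) ≡ b₁ * b₂
    ∑-incidences x = begin
      ∑ (λ s → ∑ (λ b → ⟦ B₁ b ⟧ * B₂-term x s b))
        ≡⟨ ∑-swap elems elems _ ⟩
      ∑ (λ b → ∑ (λ s → ⟦ B₁ b ⟧ * B₂-term x s b))
        ≡⟨ ∑-cong elems (λ b → trans (∑-*ˡ elems ⟦ B₁ b ⟧ _)
             (cong (⟦ B₁ b ⟧ *_) (trans (sym (card≡∑ (λ s → B₂ (s ⊖ x · b)))) (card-translate (x · b) B₂)))) ⟩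
      ∑ (λ b → ⟦ B₁ b ⟧ * b₂)
        ≡⟨ ∑-⟦⟧-* B₁ b₂ ⟩
      b₁ * b₂ ∎
      where open ≡-Reasoning

    module _ (G : Subset) where

      private
        g = card G
        -- Pairs of lines of slopes `b` and `c`, counted with their common points whose abscissa
        -- lies in `G`.
        common : Carrier → Carrier → ℕ
        common b c = ∑ (λ x → ∑ (λ s → ⟦ G x ⟧ * (B₂-term x s b * B₂-term x s c)))

        common-same : ∀ b → common b b ≤ g * b₂
        common-same b = ≤-reflexive (begin
          common b b
            ≡⟨ ∑-cong elems (λ x → trans (∑-*ˡ elems ⟦ G x ⟧ _) (cong (⟦ G x ⟧ *_)
                 (trans (∑-cong elems (λ s → ⟦⟧²≡ (B₂ (s ⊖ x · b))))
                   (trans (sym (card≡∑ (λ s → B₂ (s ⊖ x · b)))) (card-translate (x · b) B₂))))) ⟩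
          ∑ (λ x → ⟦ G x ⟧ * b₂)
            ≡⟨ ∑-⟦⟧-* G b₂ ⟩
          g * b₂ ∎)
          where open ≡-Reasoning

        -- Lines of different slopes meet exactly once: after s = u + x b, the intercept `u` is free
        -- and x ↦ u + x (b - c) is a bijection.
        common-distinct : ∀ {b c} → b ≢ c → common b c ≤ b₂ * b₂
        common-distinct {b} {c} b≢c = begin
          common b c
            ≤⟨ ∑-mono elems (λ x → ∑-mono elems (λ s →
                 ≤-trans (*-monoˡ-≤ (B₂-term x s b * B₂-term x s c) (⟦⟧≤1 (G x))) (≤-reflexive (+-identityʳ (B₂-term x s b * B₂-term x s c))))) ⟩
          ∑ (λ x → ∑ (λ s → B₂-term x s b * B₂-term x s c))
            ≡⟨ ∑-cong elems (λ x → trans (sym (∑-translate (x · b) (λ s → B₂-term x s b * B₂-term x s c)))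
                 (∑-cong elems (λ u → cong₂ (λ y z → ⟦ B₂ y ⟧ * ⟦ B₂ z ⟧) (+ᶠ-⊖-cancel u (x · b))
                   (solve 4 (λ u x b c → u :+ x :* b :- x :* c := u :+ x :* (b :- c)) refl u x b c)))) ⟩
          ∑ (λ x → ∑ (λ u → ⟦ B₂ u ⟧ * ⟦ B₂ (u +ᶠ x · (b ⊖ c)) ⟧))
            ≡⟨ ∑-swap elems elems _ ⟩
          ∑ (λ u → ∑ (λ x → ⟦ B₂ u ⟧ * ⟦ B₂ (u +ᶠ x · (b ⊖ c)) ⟧))
            ≡⟨ ∑-cong elems (λ u → trans (∑-*ˡ elems ⟦ B₂ u ⟧ _) (cong (⟦ B₂ u ⟧ *_) (∑-affine (λ e → b≢c (x⊖y≡0⇒x≡y e)) B₂ u))) ⟩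
          ∑ (λ u → ⟦ B₂ u ⟧ * b₂)
            ≡⟨ ∑-⟦⟧-* B₂ b₂ ⟩
          b₂ * b₂ ∎
          where open ≤-Reasoning

        common≤ : ∀ b c → common b c ≤ ⟦ does (b ≟ᶠ c) ⟧ * (g * b₂) + b₂ * b₂
        common≤ b c = by-case (b ≟ᶠ c)
          where
          by-case : (d : Dec (b ≡ c)) → common b c ≤ ⟦ does d ⟧ * (g * b₂) + b₂ * b₂
          by-case (yes refl) = ≤-trans (common-same b) (≤-trans (≤-reflexive (sym (+-identityʳ (g * b₂)))) (m≤m+n _ _))
          by-case (no b≢c) = common-distinct b≢c

      second-moment : ∑ (λ x → ⟦ G x ⟧ * ∑ (λ s → incidences x s * incidences x s)) ≤ g * (b₁ * b₂) + b₁ * b₂ * (b₁ * b₂)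
      second-moment = begin
        ∑ (λ x → ⟦ G x ⟧ * ∑ (λ s → incidences x s * incidences x s))
          ≡⟨ ∑-cong elems (λ x → sym (∑-*ˡ elems ⟦ G x ⟧ _)) ⟩
        ∑ (λ x → ∑ (λ s → ⟦ G x ⟧ * (incidences x s * incidences x s)))
          ≡⟨ ∑-cong elems (λ x → ∑-cong elems (λ s → expand x s)) ⟩
        ∑ (λ x → ∑ (λ s → ∑ (λ b → ∑ (λ c → term b c x s))))
          ≡⟨ ∑-cong elems (λ x → ∑-swap elems elems _) ⟩
        ∑ (λ x → ∑ (λ b → ∑ (λ s → ∑ (λ c → term b c x s))))
          ≡⟨ ∑-swap elems elems _ ⟩
        ∑ (λ b → ∑ (λ x → ∑ (λ s → ∑ (λ c → term b c x s))))
          ≡⟨ ∑-cong elems (λ b → trans (∑-cong elems (λ x → ∑-swap elems elems _)) (∑-swap elems elems _)) ⟩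
        ∑ (λ b → ∑ (λ c → ∑ (λ x → ∑ (λ s → term b c x s))))
          ≡⟨ ∑-cong elems (λ b → ∑-cong elems (λ c → trans (∑-cong elems (λ x → ∑-*ˡ elems (⟦ B₁ b ⟧ * ⟦ B₁ c ⟧) _))
               (∑-*ˡ elems (⟦ B₁ b ⟧ * ⟦ B₁ c ⟧) _))) ⟩
        ∑ (λ b → ∑ (λ c → ⟦ B₁ b ⟧ * ⟦ B₁ c ⟧ * common b c))
          ≤⟨ ∑-mono elems (λ b → ∑-mono elems (λ c → *-monoʳ-≤ (⟦ B₁ b ⟧ * ⟦ B₁ c ⟧) (common≤ b c))) ⟩
        ∑ (λ b → ∑ (λ c → ⟦ B₁ b ⟧ * ⟦ B₁ c ⟧ * (⟦ does (b ≟ᶠ c) ⟧ * (g * b₂) + b₂ * b₂)))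
          ≡⟨ ∑-cong elems row ⟩
        ∑ (λ b → ⟦ B₁ b ⟧ * (g * b₂ + b₁ * (b₂ * b₂)))
          ≡⟨ ∑-⟦⟧-* B₁ (g * b₂ + b₁ * (b₂ * b₂)) ⟩
        b₁ * (g * b₂ + b₁ * (b₂ * b₂))
          ≡⟨ e₁ b₁ g b₂ ⟩
        g * (b₁ * b₂) + b₁ * b₂ * (b₁ * b₂) ∎
        where
        open ≤-Reasoning
        e₁ : ∀ a g c → a * (g * c + a * (c * c)) ≡ g * (a * c) + a * c * (a * c)
        e₁ = solve-∀
        e₂ : ∀ g a s b t → g * (a * s * (b * t)) ≡ a * b * (g * (s * t))
        e₂ = solve-∀
        e₃ : ∀ p r d h k → p * r * (d * h + k) ≡ d * (p * r * h) + p * k * r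
        e₃ = solve-∀
        e₄ : ∀ p h k b → p * h + p * k * b ≡ p * (h + b * k)
        e₄ = solve-∀
        term : Carrier → Carrier → Carrier → Carrier → ℕ
        term b c x s = ⟦ B₁ b ⟧ * ⟦ B₁ c ⟧ * (⟦ G x ⟧ * (B₂-term x s b * B₂-term x s c))
        expand : ∀ x s → ⟦ G x ⟧ * (incidences x s * incidences x s) ≡ ∑ (λ b → ∑ (λ c → term b c x s))
        expand x s = trans (cong (⟦ G x ⟧ *_) (∑-* elems elems _ _)) (trans (sym (∑-*ˡ elems ⟦ G x ⟧ _))
          (∑-cong elems (λ b → trans (sym (∑-*ˡ elems ⟦ G x ⟧ _)) (∑-cong elems (λ c →
            e₂ ⟦ G x ⟧ ⟦ B₁ b ⟧ (B₂-term x s b) ⟦ B₁ c ⟧ (B₂-term x s c))))))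
        row : ∀ b → ∑ (λ c → ⟦ B₁ b ⟧ * ⟦ B₁ c ⟧ * (⟦ does (b ≟ᶠ c) ⟧ * (g * b₂) + b₂ * b₂)) ≡ ⟦ B₁ b ⟧ * (g * b₂ + b₁ * (b₂ * b₂))
        row b = begin-equality
          ∑ (λ c → ⟦ B₁ b ⟧ * ⟦ B₁ c ⟧ * (⟦ does (b ≟ᶠ c) ⟧ * (g * b₂) + b₂ * b₂))
            ≡⟨ ∑-cong elems (λ c → e₃ ⟦ B₁ b ⟧ ⟦ B₁ c ⟧ ⟦ does (b ≟ᶠ c) ⟧ (g * b₂) (b₂ * b₂)) ⟩
          ∑ (λ c → ⟦ does (b ≟ᶠ c) ⟧ * (⟦ B₁ b ⟧ * ⟦ B₁ c ⟧ * (g * b₂)) + ⟦ B₁ b ⟧ * (b₂ * b₂) * ⟦ B₁ c ⟧)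
            ≡⟨ ∑-+ elems _ _ ⟩
          ∑ (λ c → ⟦ does (b ≟ᶠ c) ⟧ * (⟦ B₁ b ⟧ * ⟦ B₁ c ⟧ * (g * b₂))) + ∑ (λ c → ⟦ B₁ b ⟧ * (b₂ * b₂) * ⟦ B₁ c ⟧)
            ≡⟨ cong₂ _+_ (∑-delta b (λ c → ⟦ B₁ b ⟧ * ⟦ B₁ c ⟧ * (g * b₂)))
                 (trans (∑-*ˡ elems (⟦ B₁ b ⟧ * (b₂ * b₂)) _) (cong (⟦ B₁ b ⟧ * (b₂ * b₂) *_) (sym (card≡∑ B₁)))) ⟩
          ⟦ B₁ b ⟧ * ⟦ B₁ b ⟧ * (g * b₂) + ⟦ B₁ b ⟧ * (b₂ * b₂) * b₁
            ≡⟨ cong (λ z → z * (g * b₂) + ⟦ B₁ b ⟧ * (b₂ * b₂) * b₁) (⟦⟧²≡ (B₁ b)) ⟩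
          ⟦ B₁ b ⟧ * (g * b₂) + ⟦ B₁ b ⟧ * (b₂ * b₂) * b₁
            ≡⟨ e₄ ⟦ B₁ b ⟧ (g * b₂) (b₂ * b₂) b₁ ⟩
          ⟦ B₁ b ⟧ * (g * b₂ + b₁ * (b₂ * b₂)) ∎

  -- The first moment over `s` is |B|² for every `x`, so Cauchy-Schwarz bounds |B + xB| below by
  -- |B|⁴ over the additive energy `Q x`; some x ∈ G has `Q x` at most average.
  ∃-large-⊞-⊙ : ∀ {B G} → 1 ≤ card B → 1 ≤ card G →
    ∃ λ x → x ∈ G × card B * card B * card G ≤ card (B ⊞ x ⊙ B) * (card G + card B * card B)
  ∃-large-⊞-⊙ {B} {G} 1≤B 1≤G =
    from-average (∃-below-average elems (λ x → ⟦ G x ⟧) (λ x → g * Q x) (λ _ → g * h + h * h) (subst (1 ≤_) (card≡∑ G) 1≤G) average)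
    where
    open ≤-Reasoning
    open Lines B B
    g = card G
    h = card B * card B
    Q : Carrier → ℕ
    Q x = ∑ (λ s → incidences x s * incidences x s)
    average : ∑ (λ x → ⟦ G x ⟧ * (g * Q x)) ≤ ∑ (λ x → ⟦ G x ⟧ * (g * h + h * h))
    average = begin
      ∑ (λ x → ⟦ G x ⟧ * (g * Q x))
        ≡⟨ trans (∑-cong elems (λ x → e ⟦ G x ⟧ g (Q x))) (∑-*ˡ elems g _) ⟩
      g * ∑ (λ x → ⟦ G x ⟧ * Q x)
        ≤⟨ *-monoʳ-≤ g (second-moment G) ⟩
      g * (g * h + h * h)
        ≡⟨ sym (∑-⟦⟧-* G (g * h + h * h)) ⟩
      ∑ (λ x → ⟦ G x ⟧ * (g * h + h * h)) ∎
      where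
      e : ∀ a b c → a * (b * c) ≡ b * (a * c)
      e = solve-∀
    instance
      h-nonZero : NonZero h
      h-nonZero = >-nonZero (*-mono-≤ 1≤B 1≤B)
    supp : ∀ x s → (B ⊞ x ⊙ B) s ≢ true → incidences x s ≡ 0
    supp x s s∉ = trans (∑-cong elems absent) (∑-zero elems)
      where
      absent : ∀ b → ⟦ B b ⟧ * ⟦ B (s ⊖ x · b) ⟧ ≡ 0
      absent b with B b in b∈ | B (s ⊖ x · b) in c∈
      ... | false | _ = refl
      ... | true | false = refl
      ... | true | true = contradiction (subst (_∈ B ⊞ x ⊙ B) (⊖-cancel s (x · b)) (⊞-intro c∈ (⊙-intro b∈))) s∉
    from-average : (∃ λ x → 1 ≤ ⟦ G x ⟧ × g * Q x ≤ g * h + h * h) →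
      ∃ λ x → x ∈ G × h * g ≤ card (B ⊞ x ⊙ B) * (g + h)
    from-average (x , x∈ , gQ≤) = x , 1≤⟦⟧⇒ x∈ , *-cancelˡ-≤ h (begin
      h * (h * g)                                           ≡⟨ sym (*-assoc h h g) ⟩
      h * h * g                                             ≡⟨ cong (_* g) (sym (cong₂ _*_ (∑-incidences x) (∑-incidences x))) ⟩
      ∑ (incidences x) * ∑ (incidences x) * g               ≤⟨ *-monoˡ-≤ g (∑²≤ elems (B ⊞ x ⊙ B) (incidences x) (supp x)) ⟩
      ∑ (λ s → ⟦ (B ⊞ x ⊙ B) s ⟧) * Q x * g                 ≡⟨ cong (λ z → z * Q x * g) (sym (card≡∑ (B ⊞ x ⊙ B))) ⟩
      w * Q x * g                                           ≡⟨ e₁ w (Q x) g ⟩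
      w * (g * Q x)                                         ≤⟨ *-monoʳ-≤ w gQ≤ ⟩
      w * (g * h + h * h)                                   ≡⟨ e₂ w g h ⟩
      h * (w * (g + h))                                     ∎)
      where
      w = card (B ⊞ x ⊙ B)
      e₁ : ∀ a b c → a * b * c ≡ a * (c * b)
      e₁ = solve-∀
      e₂ : ∀ w g h → w * (g * h + h * h) ≡ h * (w * (g + h))
      e₂ = solve-∀

  -- The variance bound Σ (g r − h)² over G × G, in subtraction-free form: it is obtained by summing
  -- 2 (μ g r) (μ h + λ ω) ≤ (μ g r)² + (μ h + λ ω)², where ω is the indicator of U × V.
  module _ {G B₁ B₂ U V : Subset} (U⊆G : U ⊆ G) (V⊆G : V ⊆ G)
           (invariant : ∀ {x b s} → x ∈ G → b ∈ B₁ → s ⊖ x · b ∈ B₂ → s ∈ G) where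

    open Lines B₁ B₂

    private
      g = card G
      h = card B₁ * card B₂
      P = card U * card V
      I = ∑ (λ x → ⟦ U x ⟧ * ∑ (λ s → ⟦ V s ⟧ * incidences x s))

    incidences-outside : ∀ {x s} → x ∈ G → ¬ s ∈ G → incidences x s ≡ 0
    incidences-outside {x} {s} x∈G s∉G = trans (∑-cong elems absent) (∑-zero elems)
      where
      absent : ∀ b → ⟦ B₁ b ⟧ * ⟦ B₂ (s ⊖ x · b) ⟧ ≡ 0
      absent b with B₁ b in b∈ | B₂ (s ⊖ x · b) in c∈
      ... | false | _ = refl
      ... | true | false = refl
      ... | true | true = contradiction (invariant x∈G b∈ c∈) s∉G

    private
      γ ω : Carrier → Carrier → ℕ
      γ x s = ⟦ G x ⟧ * ⟦ G s ⟧
      ω x s = ⟦ U x ⟧ * ⟦ V s ⟧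

      ∑∑ : (Carrier → Carrier → ℕ) → ℕ
      ∑∑ f = ∑ (λ x → ∑ (f x))

      ∑∑-+ : ∀ f k → ∑∑ (λ x s → f x s + k x s) ≡ ∑∑ f + ∑∑ k
      ∑∑-+ f k = trans (∑-cong elems (λ x → ∑-+ elems (f x) (k x))) (∑-+ elems _ _)

      ∑∑-*ˡ : ∀ c f → ∑∑ (λ x s → c * f x s) ≡ c * ∑∑ f
      ∑∑-*ˡ c f = trans (∑-cong elems (λ x → ∑-*ˡ elems c (f x))) (∑-*ˡ elems c _)

      -- Exact, because over x ∈ G no incidence leaves G × G. This fixes the mean of `r` at h / g.
      ∑γr : ∑∑ (λ x s → γ x s * incidences x s) ≡ g * h
      ∑γr = trans (∑-cong elems row) (∑-⟦⟧-* G h)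
        where
        cell : ∀ x s → γ x s * incidences x s ≡ ⟦ G x ⟧ * incidences x s
        cell x s with G x in x∈ | G s in s∈
        ... | false | _ = refl
        ... | true | true = refl
        ... | true | false = sym (trans (+-identityʳ _) (incidences-outside x∈ λ e → contradiction (trans (sym s∈) e) λ ()))
        row : ∀ x → ∑ (λ s → γ x s * incidences x s) ≡ ⟦ G x ⟧ * h
        row x = trans (∑-cong elems (cell x)) (trans (∑-*ˡ elems ⟦ G x ⟧ _) (cong (⟦ G x ⟧ *_) (∑-incidences x)))

      ∑γr² : ∑∑ (λ x s → γ x s * (incidences x s * incidences x s)) ≤ g * h + h * h
      ∑γr² = ≤-trans (∑-mono elems row) (second-moment G)
        where
        row : ∀ x → ∑ (λ s → γ x s * (incidences x s * incidences x s)) ≤ ⟦ G x ⟧ * ∑ (λ s → incidences x s * incidences x s)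
        row x = ≤-trans (∑-mono elems (λ s → *-monoˡ-≤ (incidences x s * incidences x s)
                  (≤-trans (*-monoʳ-≤ ⟦ G x ⟧ (⟦⟧≤1 (G s))) (≤-reflexive (*-identityʳ ⟦ G x ⟧)))))
                (≤-reflexive (∑-*ˡ elems ⟦ G x ⟧ _))

      ∑-rectangle : ∀ S T → ∑∑ (λ x s → ⟦ S x ⟧ * ⟦ T s ⟧) ≡ card S * card T
      ∑-rectangle S T = trans (sym (∑-* elems elems _ _)) (sym (cong₂ _*_ (card≡∑ S) (card≡∑ T)))

      ∑ωr : ∑∑ (λ x s → ω x s * incidences x s) ≡ I
      ∑ωr = ∑-cong elems (λ x → trans (∑-cong elems (λ s → *-assoc ⟦ U x ⟧ ⟦ V s ⟧ (incidences x s))) (∑-*ˡ elems ⟦ U x ⟧ _))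

      -- Off U × V the λ-term is absent; it is kept with factor 0 to match the shape of `pointwise`.
      outside : ∀ μ l c r → 2 * (μ * μ * g * h) * (c * r) + 2 * (μ * g * l) * 0 ≤
        μ * μ * (g * g) * (c * (r * r)) + (μ * μ * (h * h) * c + (2 * (μ * h * l) + l * l) * 0)
      outside μ l c r = subst₂ _≤_ (e₁ μ g h l c r) (e₂ μ g h l c r) (*-monoʳ-≤ c (2ab≤a²+b² (μ * g * r) (μ * h)))
        where
        e₁ : ∀ μ g h l c r → c * (2 * (μ * g * r * (μ * h))) ≡ 2 * (μ * μ * g * h) * (c * r) + 2 * (μ * g * l) * 0
        e₁ = solve-∀
        e₂ : ∀ μ g h l c r → c * (μ * g * r * (μ * g * r) + μ * h * (μ * h)) ≡
               μ * μ * (g * g) * (c * (r * r)) + (μ * μ * (h * h) * c + (2 * (μ * h * l) + l * l) * 0)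
        e₂ = solve-∀

      pointwise : ∀ μ l x s → 2 * (μ * μ * g * h) * (γ x s * incidences x s) + 2 * (μ * g * l) * (ω x s * incidences x s)
        ≤ μ * μ * (g * g) * (γ x s * (incidences x s * incidences x s)) + (μ * μ * (h * h) * γ x s + (2 * (μ * h * l) + l * l) * ω x s)
      pointwise μ l x s with U x in x∈U | V s in s∈V
      ... | true | true rewrite U⊆G x∈U | V⊆G s∈V =
        subst₂ _≤_ (e₁ μ g h l r) (e₂ μ g h l r) (2ab≤a²+b² (μ * g * r) (μ * h + l))
        where
        r = incidences x s
        e₁ : ∀ μ g h l r → 2 * (μ * g * r * (μ * h + l)) ≡ 2 * (μ * μ * g * h) * (1 * r) + 2 * (μ * g * l) * (1 * r)
        e₁ = solve-∀
        e₂ : ∀ μ g h l r → μ * g * r * (μ * g * r) + (μ * h + l) * (μ * h + l) ≡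
               μ * μ * (g * g) * (1 * (r * r)) + (μ * μ * (h * h) * 1 + (2 * (μ * h * l) + l * l) * 1)
        e₂ = solve-∀
      ... | false | _ = outside μ l (γ x s) (incidences x s)
      ... | true | false = outside μ l (γ x s) (incidences x s)

    incidence-variance : ∀ μ l → 2 * (μ * g * l) * I ≤ μ * μ * (g * g) * (g * h) + (2 * (μ * h * l) + l * l) * P
    incidence-variance μ l = +-cancelˡ-≤ (2 * (μ * μ * g * h) * (g * h)) _ _ (begin
      2 * (μ * μ * g * h) * (g * h) + 2 * (μ * g * l) * I
        ≡⟨ cong₂ (λ y z → 2 * (μ * μ * g * h) * y + 2 * (μ * g * l) * z) (sym ∑γr) (sym ∑ωr) ⟩
      2 * (μ * μ * g * h) * ∑∑ (λ x s → γ x s * incidences x s) + 2 * (μ * g * l) * ∑∑ (λ x s → ω x s * incidences x s)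
        ≡⟨ sym (trans (∑∑-+ _ _) (cong₂ _+_ (∑∑-*ˡ (2 * (μ * μ * g * h)) _) (∑∑-*ˡ (2 * (μ * g * l)) _))) ⟩
      ∑∑ (λ x s → 2 * (μ * μ * g * h) * (γ x s * incidences x s) + 2 * (μ * g * l) * (ω x s * incidences x s))
        ≤⟨ ∑-mono elems (λ x → ∑-mono elems (pointwise μ l x)) ⟩
      ∑∑ (λ x s → c₁ * (γ x s * (incidences x s * incidences x s)) + (c₂ * γ x s + c₃ * ω x s))
        ≡⟨ trans (∑∑-+ _ _) (cong₂ _+_ (∑∑-*ˡ c₁ _) (trans (∑∑-+ _ _) (cong₂ _+_ (∑∑-*ˡ c₂ _) (∑∑-*ˡ c₃ _)))) ⟩
      c₁ * ∑∑ (λ x s → γ x s * (incidences x s * incidences x s)) + (c₂ * ∑∑ γ + c₃ * ∑∑ ω)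
        ≤⟨ +-mono-≤ (*-monoʳ-≤ c₁ ∑γr²) (≤-reflexive (cong₂ (λ y z → c₂ * y + c₃ * z) (∑-rectangle G G) (∑-rectangle U V))) ⟩
      c₁ * (g * h + h * h) + (c₂ * (g * g) + c₃ * P)
        -- The h² part of the second moment and the constant term c₂ g² are both μ² g² h²; together
        -- they match the first term on the left, which cancels.
        ≡⟨ e μ g h (c₃ * P) ⟩
      2 * (μ * μ * g * h) * (g * h) + (c₁ * (g * h) + c₃ * P) ∎)
      where
      open ≤-Reasoning
      c₁ = μ * μ * (g * g)
      c₂ = μ * μ * (h * h)
      c₃ = 2 * (μ * h * l) + l * l
      e : ∀ μ g h p → μ * μ * (g * g) * (g * h + h * h) + (μ * μ * (h * h) * (g * g) + p) ≡
            2 * (μ * μ * g * h) * (g * h) + (μ * μ * (g * g) * (g * h) + p)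
      e = solve-∀

    -- The ratio l / μ = gI / 2P is optimal up to a constant factor; the scaling by μ avoids the division.
    incidence-bound : 1 ≤ P → 1 ≤ g → g * I < 2 * P * h ⊎ I * I ≤ 4 * P * (g * h)
    incidence-bound 1≤P 1≤g with g * I <? 2 * P * h
    ... | yes few = inj₁ few
    ... | no many = inj₂ (*-cancelˡ-≤ (P * (g * g)) ⦃ >-nonZero (*-mono-≤ 1≤P (*-mono-≤ 1≤g 1≤g)) ⦄
      -- Since 2 P h ≤ g I, the last summand of the variance bound absorbs three of the four copies
      -- of P (g I)²; the fourth is the gain.
      (+-cancelˡ-≤ (3 * (P * (g * I * (g * I)))) _ _ (begin
        3 * (P * (g * I * (g * I))) + P * (g * g) * (I * I)
          ≡⟨ e₁ P g I ⟩
        2 * (2 * P * g * (g * I)) * I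
          ≤⟨ incidence-variance (2 * P) (g * I) ⟩
        2 * P * (2 * P) * (g * g) * (g * h) + (2 * (2 * P * h * (g * I)) + g * I * (g * I)) * P
          ≤⟨ +-monoʳ-≤ _ (*-monoˡ-≤ P (+-monoˡ-≤ _ (*-monoʳ-≤ 2 (*-monoˡ-≤ (g * I) (≮⇒≥ many))))) ⟩
        2 * P * (2 * P) * (g * g) * (g * h) + (2 * (g * I * (g * I)) + g * I * (g * I)) * P
          ≡⟨ e₂ P g h I ⟩
        3 * (P * (g * I * (g * I))) + P * (g * g) * (4 * P * (g * h)) ∎)))
      where
      open ≤-Reasoning
      e₁ : ∀ p g i → 3 * (p * (g * i * (g * i))) + p * (g * g) * (i * i) ≡ 2 * (2 * p * g * (g * i)) * i
      e₁ = solve-∀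
      e₂ : ∀ p g h i → 2 * p * (2 * p) * (g * g) * (g * h) + (2 * (g * i * (g * i)) + g * i * (g * i)) * p ≡
             3 * (p * (g * i * (g * i))) + p * (g * g) * (4 * p * (g * h))
      e₂ = solve-∀

  -- The lines s = c + x / f (c, f ∈ E) each contain the |E| points (f e , c + e) of EE × (E + E).
  sum-product-in-subfield : ∀ {G E U V} → IsSubfield G → E ⊆ G → (∀ {x} → x ∈ E → x ≢ 0#) → 1 ≤ card E →
    U ⊆ G → V ⊆ G → (∀ {x y} → x ∈ E → y ∈ E → x · y ∈ U) → (∀ {x y} → x ∈ E → y ∈ E → x +ᶠ y ∈ V) →
    card G * card E ≤ 2 * (card U * card V) ⊎ card E * card E * (card E * card E) ≤ 4 * (card U * card V) * card G
  sum-product-in-subfield {G} {E} {U} {V} subfield E⊆G nonzero 1≤E U⊆G V⊆G EE⊆U E+E⊆V =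
    simplify (incidence-bound {G} {E⁻¹} {E} U⊆G V⊆G invariant 1≤P (∈⇒1≤card (E⊆G (proj₂ e₀))))
    where
    open ≤-Reasoning
    open IsSubfield subfield
    E⁻¹ : Subset
    E⁻¹ b = E (inv b)
    open Lines E⁻¹ E
    g = card G
    e = card E
    P = card U * card V
    I = ∑ (λ x → ⟦ U x ⟧ * ∑ (λ s → ⟦ V s ⟧ * incidences x s))
    e₀ : ∃ λ x → x ∈ E
    e₀ = 1≤card⇒∃ 1≤E
    1≤P : 1 ≤ P
    1≤P = *-mono-≤ (∈⇒1≤card (EE⊆U (proj₂ e₀) (proj₂ e₀))) (∈⇒1≤card (E+E⊆V (proj₂ e₀) (proj₂ e₀)))
    instance
      e-nonZero : NonZero e
      e-nonZero = >-nonZero 1≤E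
    E⁻¹≡e : card E⁻¹ ≡ e
    E⁻¹≡e = card-reindex inv inv inv-involutive inv-involutive E
    E⁻¹-nonzero : ∀ {b} → b ∈ E⁻¹ → b ≢ 0#
    E⁻¹-nonzero b∈ refl = nonzero b∈ inv-0
    E⁻¹⊆G : ∀ {b} → b ∈ E⁻¹ → b ∈ G
    E⁻¹⊆G {b} b∈ = inv-closed (inv b) b (E⊆G b∈) (·-inverseˡ (E⁻¹-nonzero b∈))
    invariant : ∀ {x b s} → x ∈ G → b ∈ E⁻¹ → s ⊖ x · b ∈ E → s ∈ G
    invariant {x} {b} {s} x∈ b∈ c∈ = subst (_∈ G) (⊖-cancel s (x · b)) (+-closed _ _ (E⊆G c∈) (*-closed _ _ x∈ (E⁻¹⊆G b∈)))
    -- If f = x b and c = s - f are in `E`, then x = f b⁻¹ with b⁻¹ ∈ E, so (x , s) lies in EE × (E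
    -- + E).
    on-line : ∀ x s b → b ∈ E⁻¹ → ⟦ E (x · b) ⟧ * ⟦ E (s ⊖ x · b) ⟧ ≤ ⟦ U x ⟧ * (⟦ V s ⟧ * ⟦ E (s ⊖ x · b) ⟧)
    on-line x s b b∈ with E (x · b) in f∈ | E (s ⊖ x · b) in c∈
    ... | false | _ = z≤n
    ... | true | false = z≤n
    ... | true | true = ≤-reflexive (cong₂ (λ u v → ⟦ u ⟧ * (⟦ v ⟧ * 1)) (sym x∈U) (sym s∈V))
      where
      x∈U : x ∈ U
      x∈U = subst (_∈ U) (trans (·-assoc x b (inv b)) (trans (cong (x ·_) (·-inverseʳ (E⁻¹-nonzero b∈))) (·-identityʳ x))) (EE⊆U f∈ b∈)
      s∈V : s ∈ V
      s∈V = subst (_∈ V) (⊖-cancel s (x · b)) (E+E⊆V c∈ f∈)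
    line : ∀ b → b ∈ E⁻¹ → e * e ≤ ∑ (λ x → ∑ (λ s → ⟦ U x ⟧ * (⟦ V s ⟧ * ⟦ E (s ⊖ x · b) ⟧)))
    line b b∈ = begin
      e * e
        ≡⟨ cong (_* e) (trans (sym (∑-affine (E⁻¹-nonzero b∈) E 0#)) (∑-cong elems (λ x → cong (λ z → ⟦ E z ⟧) (+ᶠ-identityˡ (x · b))))) ⟩
      ∑ (λ x → ⟦ E (x · b) ⟧) * e
        ≡⟨ sym (∑-*ʳ elems _ e) ⟩
      ∑ (λ x → ⟦ E (x · b) ⟧ * e)
        ≡⟨ ∑-cong elems (λ x → trans (cong (⟦ E (x · b) ⟧ *_) (trans (sym (card-translate (x · b) E)) (card≡∑ _))) (sym (∑-*ˡ elems ⟦ E (x · b) ⟧ _))) ⟩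
      ∑ (λ x → ∑ (λ s → ⟦ E (x · b) ⟧ * ⟦ E (s ⊖ x · b) ⟧))
        ≤⟨ ∑-mono elems (λ x → ∑-mono elems (λ s → on-line x s b b∈)) ⟩
      ∑ (λ x → ∑ (λ s → ⟦ U x ⟧ * (⟦ V s ⟧ * ⟦ E (s ⊖ x · b) ⟧))) ∎
    line′ : ∀ b → ⟦ E⁻¹ b ⟧ * (e * e) ≤ ⟦ E⁻¹ b ⟧ * ∑ (λ x → ∑ (λ s → ⟦ U x ⟧ * (⟦ V s ⟧ * ⟦ E (s ⊖ x · b) ⟧)))
    line′ b = by-case (b ∈? E⁻¹)
      where
      by-case : Dec (b ∈ E⁻¹) → ⟦ E⁻¹ b ⟧ * (e * e) ≤ ⟦ E⁻¹ b ⟧ * ∑ (λ x → ∑ (λ s → ⟦ U x ⟧ * (⟦ V s ⟧ * ⟦ E (s ⊖ x · b) ⟧)))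
      by-case (yes b∈) = *-monoʳ-≤ ⟦ E⁻¹ b ⟧ (line b b∈)
      by-case (no b∉) with E⁻¹ b
      ... | false = z≤n
      ... | true = contradiction refl b∉
    e³≤I : e * (e * e) ≤ I
    e³≤I = begin
      e * (e * e)
        ≡⟨ trans (cong (_* (e * e)) (sym E⁻¹≡e)) (sym (∑-⟦⟧-* E⁻¹ (e * e))) ⟩
      ∑ (λ b → ⟦ E⁻¹ b ⟧ * (e * e))
        ≤⟨ ∑-mono elems line′ ⟩
      ∑ (λ b → ⟦ E⁻¹ b ⟧ * ∑ (λ x → ∑ (λ s → ⟦ U x ⟧ * (⟦ V s ⟧ * ⟦ E (s ⊖ x · b) ⟧))))
        ≡⟨ ∑-cong elems (λ b → trans (sym (∑-*ˡ elems ⟦ E⁻¹ b ⟧ _)) (∑-cong elems (λ x → trans (sym (∑-*ˡ elems ⟦ E⁻¹ b ⟧ _))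
             (∑-cong elems (λ s → swap ⟦ E⁻¹ b ⟧ ⟦ U x ⟧ ⟦ V s ⟧ ⟦ E (s ⊖ x · b) ⟧))))) ⟩
      ∑ (λ b → ∑ (λ x → ∑ (λ s → ⟦ U x ⟧ * (⟦ V s ⟧ * (⟦ E⁻¹ b ⟧ * ⟦ E (s ⊖ x · b) ⟧)))))
        ≡⟨ ∑-swap elems elems _ ⟩
      ∑ (λ x → ∑ (λ b → ∑ (λ s → ⟦ U x ⟧ * (⟦ V s ⟧ * (⟦ E⁻¹ b ⟧ * ⟦ E (s ⊖ x · b) ⟧)))))
        ≡⟨ ∑-cong elems (λ x → trans (∑-swap elems elems _) (trans (∑-cong elems (λ s →
             trans (∑-*ˡ elems ⟦ U x ⟧ _) (cong (⟦ U x ⟧ *_) (∑-*ˡ elems ⟦ V s ⟧ _)))) (∑-*ˡ elems ⟦ U x ⟧ _))) ⟩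
      I ∎
      where
      swap : ∀ b u v c → b * (u * (v * c)) ≡ u * (v * (b * c))
      swap = solve-∀
    simplify : g * I < 2 * P * (card E⁻¹ * e) ⊎ I * I ≤ 4 * P * (g * (card E⁻¹ * e)) →
               g * e ≤ 2 * P ⊎ e * e * (e * e) ≤ 4 * P * g
    simplify (inj₁ few) = inj₁ (*-cancelʳ-≤ (g * e) (2 * P) (e * e) ⦃ m*n≢0 e e ⦄ (begin
      g * e * (e * e)               ≡⟨ *-assoc g e (e * e) ⟩
      g * (e * (e * e))             ≤⟨ *-monoʳ-≤ g e³≤I ⟩
      g * I                         ≤⟨ <⇒≤ few ⟩
      2 * P * (card E⁻¹ * e)        ≡⟨ cong (λ z → 2 * P * (z * e)) E⁻¹≡e ⟩
      2 * P * (e * e)               ∎))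
    simplify (inj₂ bound) = inj₂ (*-cancelʳ-≤ _ _ (e * e) ⦃ m*n≢0 e e ⦄ (begin
      e * e * (e * e) * (e * e)     ≡⟨ e₁ e ⟩
      e * (e * e) * (e * (e * e))   ≤⟨ *-mono-≤ e³≤I e³≤I ⟩
      I * I                         ≤⟨ bound ⟩
      4 * P * (g * (card E⁻¹ * e))  ≡⟨ cong (λ z → 4 * P * (g * (z * e))) E⁻¹≡e ⟩
      4 * P * (g * (e * e))         ≡⟨ sym (*-assoc (4 * P) g (e * e)) ⟩
      4 * P * g * (e * e)           ∎))
      where
      e₁ : ∀ e → e * e * (e * e) * (e * e) ≡ e * (e * e) * (e * (e * e))
      e₁ = solve-∀

  -- The sum-product estimate

  card-∩≤ˡ : ∀ S T → card (S ∩ T) ≤ card S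
  card-∩≤ˡ S T = card-mono {S ∩ T} {S} (λ h → proj₁ (∧-elim h))

  -- A is normalised so that the popular dilate is A itself.
  module _ {t : ℕ} (4≤t : 4 ≤ t) (256≤t⁴ : 256 ≤ t ^ 4)
    {A B U : Subset} {M N L : ℕ} (nonzero : ∀ {x} → x ∈ A → x ≢ 0#) (1≤A : 1 ≤ card A) (1≤L : 1 ≤ L)
    (A⊞A≤M : card (A ⊞ A) ≤ M) (AA⊆U : ∀ {x y} → x ∈ A → y ∈ A → x · y ∈ U) (U≤M : card U ≤ M)
    (B⊆A : B ⊆ A) (1≤N : 1 ≤ N) (N≤ : ∀ {b} → b ∈ B → N ≤ card (A ∩ (b ⊙ A)))
    (large : card A * card A ≤ 2 * M * N) (mass : card A * card A * card A ≤ 2 * M * (suc L * (N * card B)))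
    (sparse : ∀ G → IsSubfield G → card (A ∩ G) ^ 175 ≤ card G ^ 98 ⊔ card A ^ 150) where

    open ≤-Reasoning

    private
      a = card A
      b = card B
      R = quotients B

      1≤B : 1 ≤ b
      1≤B = n≢0⇒n>0 λ b≡0 → n≮0 (≤-trans (*-mono-≤ (*-mono-≤ 1≤A 1≤A) 1≤A) (≤-trans mass (≤-reflexive (vanish b≡0))))
        where
        vanish : b ≡ 0 → 2 * M * (suc L * (N * b)) ≡ 0
        vanish e rewrite e | *-zeroʳ N | *-zeroʳ L = *-zeroʳ (2 * M)

      N≤a : N ≤ a
      N≤a = ≤-trans (N≤ (proj₂ (1≤card⇒∃ 1≤B))) (card-∩≤ˡ A _)

      a≤M : a ≤ M
      a≤M = ≤-trans (card≤card-⊞ʳ (proj₂ (1≤card⇒∃ 1≤A))) A⊞A≤M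

      2≤t : 2 ≤ t
      2≤t = ≤-trans (s≤s (s≤s z≤n)) 4≤t

      large′ : a * a ≤ t * (M * N)
      large′ = begin
        a * a         ≤⟨ large ⟩
        2 * M * N     ≡⟨ *-assoc 2 M N ⟩
        2 * (M * N)   ≤⟨ *-monoˡ-≤ (M * N) 2≤t ⟩
        t * (M * N)   ∎

      mass′ : a * a * a ≤ t * (L * M) * (N * b)
      mass′ = begin
        a * a * a                         ≤⟨ mass ⟩
        2 * M * (suc L * (N * b))         ≤⟨ *-monoʳ-≤ (2 * M) (*-monoˡ-≤ (N * b) (+-monoˡ-≤ L 1≤L)) ⟩
        2 * M * ((L + L) * (N * b))       ≡⟨ e M L (N * b) ⟩
        4 * (L * M) * (N * b)             ≤⟨ *-monoˡ-≤ (N * b) (*-monoˡ-≤ (L * M) 4≤t) ⟩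
        t * (L * M) * (N * b)             ∎
        where
        e : ∀ m l x → 2 * m * ((l + l) * x) ≡ 4 * (l * m) * x
        e = solve-∀

      -- `W` depends on the quotient `x` at hand. Bounds without `W` are taken at the placeholder
      -- `0#`.
      module Bounds {x : Carrier} = Exponents {t} {a} {b} {N} {M} {L} {card (A ⊞ x ⊙ A)} 2≤t 1≤A 1≤L a≤M large′ mass′

      Goal : Set
      Goal = a ^ 15 ≤ (t * (M * L)) ^ 14

      W-bound : ∀ {x} → x ∈ R → card (A ⊞ x ⊙ A) * (a * a * a * (N * N * N * N)) ≤ t ^ 8 * M ^ 8
      W-bound {x} x∈ = begin
        card (A ⊞ x ⊙ A) * (a * a * a * (N * N * N * N))
          ≡⟨ e₁ (card (A ⊞ x ⊙ A)) a (N * N * N * N) ⟩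
        card (A ⊞ x ⊙ A) * (a * (a * a)) * (N * N * N * N)
          ≤⟨ card-⊞-quotient nonzero A⊞A≤M 1≤A B⊆A 1≤N N≤ x∈ ⟩
        256 * (4 * (M * M) * (4 * (M * M)) * (4 * (M * M)) * (4 * (M * M)))
          ≤⟨ *-mono-≤ 256≤t⁴ (*-mono-≤ (*-mono-≤ (*-mono-≤ 4M²≤ 4M²≤) 4M²≤) 4M²≤) ⟩
        t ^ 4 * (t * (M * M) * (t * (M * M)) * (t * (M * M)) * (t * (M * M)))
          ≡⟨ fourth-power t M ⟩
        t ^ 8 * M ^ 8 ∎
        where
        4M²≤ : 4 * (M * M) ≤ t * (M * M)
        4M²≤ = *-monoˡ-≤ (M * M) 4≤t
        e₁ : ∀ w a n → w * (a * a * a * n) ≡ w * (a * (a * a)) * n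
        e₁ = solve-∀

      module Subfield (R-subfield : IsSubfield R) (B⊆R : B ⊆ R) where

        E = A ∩ R
        e = card E
        g = card R

        b≤e : b ≤ e
        b≤e = card-mono {B} {E} (λ x∈ → ∧-intro (B⊆A x∈) (B⊆R x∈))

        1≤R : 1 ≤ g
        1≤R = ∈⇒1≤card (IsSubfield.has-0 R-subfield)

        P≤ : card (U ∩ R) * card ((A ⊞ A) ∩ R) ≤ M * M
        P≤ = *-mono-≤ (≤-trans (card-∩≤ˡ U R) U≤M) (≤-trans (card-∩≤ˡ (A ⊞ A) R) A⊞A≤M)

        -- An upper bound on `g` is missing here. Some dilate by an element of `R` spreads `B` out:
        -- if g ≤ b² this gives g ≪ W, and otherwise b² ≪ W directly.
        incidences-large : e * e * (e * e) ≤ 4 * (M * M) * g → Goal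
        incidences-large h = from-spread (∃-large-⊞-⊙ {B} {R} 1≤B 1≤R)
          where
          from-spread : (∃ λ x → x ∈ R × b * b * g ≤ card (B ⊞ x ⊙ B) * (g + b * b)) → Goal
          from-spread (x , x∈ , spread) = [ small-field , large-field ]′ (≤-total g (b * b))
            where
            W = card (A ⊞ x ⊙ A)
            spread′ : b * b * g ≤ W * (g + b * b)
            spread′ = ≤-trans spread (*-monoˡ-≤ (g + b * b) (card-mono (⊞-mono B⊆A (⊙-mono B⊆A))))
            small-field : g ≤ b * b → Goal
            small-field g≤b² = Bounds.from-b⁴≤ (W-bound x∈) (begin
              b * b * (b * b)               ≤⟨ *-mono-≤ (*-mono-≤ b≤e b≤e) (*-mono-≤ b≤e b≤e) ⟩
              e * e * (e * e)               ≤⟨ h ⟩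
              4 * (M * M) * g               ≤⟨ *-monoʳ-≤ (4 * (M * M)) g≤tW ⟩
              4 * (M * M) * (t * W)         ≤⟨ *-monoˡ-≤ (t * W) (*-monoˡ-≤ (M * M) 4≤t) ⟩
              t * (M * M) * (t * W)         ≡⟨ e₁ t (M * M) W ⟩
              t * t * (M * M * W)           ∎)
              where
              e₁ : ∀ c m w → c * m * (c * w) ≡ c * c * (m * w)
              e₁ = solve-∀
              e₂ : ∀ w c → w * (c + c) ≡ 2 * w * c
              e₂ = solve-∀
              g≤tW : g ≤ t * W
              g≤tW = *-cancelˡ-≤ (b * b) ⦃ >-nonZero (*-mono-≤ 1≤B 1≤B) ⦄ (begin
                b * b * g                   ≤⟨ spread′ ⟩
                W * (g + b * b)             ≤⟨ *-monoʳ-≤ W (+-monoˡ-≤ (b * b) g≤b²) ⟩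
                W * (b * b + b * b)         ≡⟨ e₂ W (b * b) ⟩
                2 * W * (b * b)             ≤⟨ *-monoˡ-≤ (b * b) (*-monoˡ-≤ W 2≤t) ⟩
                t * W * (b * b)             ≡⟨ *-comm (t * W) (b * b) ⟩
                b * b * (t * W)             ∎)
            large-field : b * b ≤ g → Goal
            large-field b²≤g = Bounds.from-b²≤ (W-bound x∈) (*-cancelʳ-≤ (b * b) (t * W) g ⦃ >-nonZero 1≤R ⦄ (begin
              b * b * g                     ≤⟨ spread′ ⟩
              W * (g + b * b)               ≤⟨ *-monoʳ-≤ W (+-monoʳ-≤ g b²≤g) ⟩
              W * (g + g)                   ≡⟨ e₁ W g ⟩
              2 * W * g                     ≤⟨ *-monoˡ-≤ g (*-monoˡ-≤ W 2≤t) ⟩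
              t * W * g                     ∎))
              where
              e₁ : ∀ w g → w * (g + g) ≡ 2 * w * g
              e₁ = solve-∀

        closed : Goal
        closed = [ from-sparse , Bounds.from-e⁷≤ {0#} N≤a {e} b≤e ]′ (≤⊔⇒⊎ (sparse R R-subfield))
          where
          in-A : ∀ {x} → x ∈ E → x ∈ A
          in-A h = proj₁ (∧-elim h)
          in-R : ∀ {x} → x ∈ E → x ∈ R
          in-R {x} h = proj₂ (∧-elim {A x} h)
          dichotomy : g * e ≤ 2 * (card (U ∩ R) * card ((A ⊞ A) ∩ R)) ⊎ e * e * (e * e) ≤ 4 * (card (U ∩ R) * card ((A ⊞ A) ∩ R)) * g
          dichotomy = sum-product-in-subfield {R} {E} {U ∩ R} {(A ⊞ A) ∩ R} R-subfield in-R (λ h → nonzero (in-A h)) (≤-trans 1≤B b≤e)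
            (λ {x} h → proj₂ (∧-elim {U x} h)) (λ {x} h → proj₂ (∧-elim {(A ⊞ A) x} h))
            (λ {x} {y} hx hy → ∧-intro (AA⊆U (in-A hx) (in-A hy)) (IsSubfield.*-closed R-subfield x y (in-R hx) (in-R hy)))
            (λ {x} {y} hx hy → ∧-intro (⊞-intro (in-A hx) (in-A hy)) (IsSubfield.+-closed R-subfield x y (in-R hx) (in-R hy)))
          from-sparse : e ^ 175 ≤ g ^ 98 → Goal
          from-sparse e¹⁷⁵≤ = [ (λ ge≤ → Bounds.from-g*e≤ {0#} N≤a {e} b≤e {g} e¹⁷⁵≤ (≤-trans ge≤ (*-monoʳ-≤ 2 P≤)))
                              , (λ e⁴≤ → incidences-large (≤-trans e⁴≤ (*-monoˡ-≤ g (*-monoʳ-≤ 4 P≤)))) ]′ dichotomy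

      with-two-elements : ∀ {d e} → d ∈ B → e ∈ B → d ≢ e → Goal
      with-two-elements {d} {e} d∈ e∈ d≢e = by-+1 (search λ x → (x ∈? R) ×-dec ¬? ((x +ᶠ 1#) ∈? R))
        where
        0∈R : 0# ∈ R
        0∈R = 0∈quotients d∈ e∈ d≢e
        by-· : (∀ {x} → x ∈ R → x +ᶠ 1# ∈ R) → Dec (∃ λ β → ∃ λ x → β ∈ B × x ∈ R × ¬ β · x ∈ R) → Goal
        by-· _ (yes (β , x , β∈ , x∈ , βx∉)) = Bounds.from-b²N≤ (W-bound x∈) (≤-trans
          (card²*N≤ nonzero A⊞A≤M 1≤A B⊆A 1≤N N≤ x≢0 β∈ βx∉) (*-monoˡ-≤ (M * card (A ⊞ x ⊙ A)) 4≤t))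
          where
          -- The witness cannot be 0, since β · 0 = 0 is a quotient.
          x≢0 : x ≢ 0#
          x≢0 refl = βx∉ (subst (_∈ R) (sym (·-zeroʳ β)) 0∈R)
        by-· +1-closed (no none) = Subfield.closed
          (quotients-subfield (λ β∈ → nonzero (B⊆A β∈)) d∈ e∈ d≢e +1-closed B·-closed)
          (⊆quotients (λ β∈ → nonzero (B⊆A β∈)) d∈ e∈ d≢e +1-closed B·-closed)
          where
          B·-closed : ∀ {β x} → β ∈ B → x ∈ R → β · x ∈ R
          B·-closed {β} {x} β∈ x∈ = decidable-stable ((β · x) ∈? R) λ βx∉ → none (β , x , β∈ , x∈ , βx∉)
        by-+1 : Dec (∃ λ x → x ∈ R × ¬ x +ᶠ 1# ∈ R) → Goal
        by-+1 (yes (x , x∈ , x+1∉)) = Bounds.from-b³≤ (W-bound x∈) (≤-trans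
          (card³≤ nonzero A⊞A≤M 1≤A B⊆A 1≤N N≤ (λ x+1≡0 → x+1∉ (subst (_∈ R) (sym x+1≡0) 0∈R)) x+1∉ 1≤B)
          (*-monoˡ-≤ (M * card (A ⊞ x ⊙ A)) 4≤t))
        by-+1 (no none) = by-·
          (λ {x} x∈ → decidable-stable ((x +ᶠ 1#) ∈? R) λ x+1∉ → none (x , x∈ , x+1∉))
          (search λ β → search λ x → (β ∈? B) ×-dec (x ∈? R) ×-dec ¬? ((β · x) ∈? R))

    normalised-sum-product : a ^ 15 ≤ (t * (M * L)) ^ 14
    normalised-sum-product = by-distinct (search λ d → search λ e → (d ∈? B) ×-dec (e ∈? B) ×-dec ¬? (d ≟ᶠ e))
      where
      by-distinct : Dec (∃ λ d → ∃ λ e → d ∈ B × e ∈ B × d ≢ e) → Goal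
      by-distinct (yes (d , e , d∈ , e∈ , d≢e)) = with-two-elements d∈ e∈ d≢e
      by-distinct (no none) = Bounds.from-b≤1 {0#} N≤a (card-subsingleton {B} true (λ _ _ → refl)
        λ {x} {y} x∈ y∈ → decidable-stable (x ≟ᶠ y) λ x≢y → none (x , y , x∈ , y∈ , x≢y))

  -- Removing the normalisation

  sumset-intro : ∀ {A x y} → x ∈ A → y ∈ A → x +ᶠ y ∈ sumset A
  sumset-intro {A} {x} {y} x∈ y∈ = any-intro {S = λ a → A a ∧ any (λ b → A b ∧ does ((a +ᶠ b) ≟ᶠ (x +ᶠ y))) elems} (∈-elems x)
    (∧-intro x∈ (any-intro {S = λ b → A b ∧ does ((x +ᶠ b) ≟ᶠ (x +ᶠ y))} (∈-elems y)
      (∧-intro y∈ (dec-true ((x +ᶠ y) ≟ᶠ (x +ᶠ y)) refl))))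

  prodset-intro : ∀ {A x y} → x ∈ A → y ∈ A → x · y ∈ prodset A
  prodset-intro {A} {x} {y} x∈ y∈ = any-intro {S = λ a → A a ∧ any (λ b → A b ∧ does ((a · b) ≟ᶠ (x · y))) elems} (∈-elems x)
    (∧-intro x∈ (any-intro {S = λ b → A b ∧ does ((x · b) ≟ᶠ (x · y))} (∈-elems y)
      (∧-intro y∈ (dec-true ((x · y) ≟ᶠ (x · y)) refl))))

  affine-intro : ∀ {c G d x} → x ∈ G → c · x +ᶠ d ∈ affine c G d
  affine-intro {c} {G} {d} {x} x∈ = any-intro {S = λ g → G g ∧ does ((c · g +ᶠ d) ≟ᶠ (c · x +ᶠ d))} (∈-elems x)
    (∧-intro x∈ (dec-true ((c · x +ᶠ d) ≟ᶠ (c · x +ᶠ d)) refl))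

  card-dilate : ∀ {t} → t ≢ 0# → ∀ S → card (λ x → S (t · x)) ≡ card S
  card-dilate {t} t≢0 = card-reindex (t ·_) (inv t ·_) (inv·-cancel t≢0) (·inv-cancel t≢0)

  module _ {t : ℕ} (4≤t : 4 ≤ t) (256≤t⁴ : 256 ≤ t ^ 4) {A P : Subset} {M L : ℕ}
    (nonzero : ∀ {x} → x ∈ A → x ≢ 0#) (1≤A : 1 ≤ card A) (1≤L : 1 ≤ L) (A<2^ : card A < 2 ^ suc L)
    (A⊞A≤M : card (A ⊞ A) ≤ M) (AA⊆P : ∀ {x y} → x ∈ A → y ∈ A → x · y ∈ P) (P≤M : card P ≤ M)
    (sparse : ∀ G → IsSubfield G → ∀ c d → card (A ∩ affine c G d) ^ 175 ≤ card G ^ 98 ⊔ card A ^ 150) where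

    open ≤-Reasoning

    module Rescale {z : Carrier} (z∈A : z ∈ A) (levels : LevelSet A (λ b → card ((b ⊙ A) ∩ (z ⊙ A))) M L) where

      open LevelSet levels

      z≢0 : z ≢ 0#
      z≢0 = nonzero z∈A

      -- Preimages under multiplication by `z`; products of two elements of `A/z` lose the factor
      -- `z` twice.
      A/z B/z P/z² : Subset
      A/z x = A (z · x)
      B/z x = B (z · x)
      P/z² x = P (z · (z · x))

      card-A/z : card A/z ≡ card A
      card-A/z = card-dilate z≢0 A

      A/z-nonzero : ∀ {x} → x ∈ A/z → x ≢ 0#
      A/z-nonzero x∈ refl = nonzero x∈ (·-zeroʳ z)

      A/z⊞A/z≤M : card (A/z ⊞ A/z) ≤ M
      A/z⊞A/z≤M = ≤-trans (card-mono {A/z ⊞ A/z} {λ x → (A ⊞ A) (z · x)} inclusion)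
                          (≤-trans (≤-reflexive (card-dilate z≢0 (A ⊞ A))) A⊞A≤M)
        where
        inclusion : ∀ {x} → x ∈ A/z ⊞ A/z → z · x ∈ A ⊞ A
        inclusion x∈ with ⊞-elim x∈
        ... | u , v , u∈ , v∈ , refl = subst (_∈ A ⊞ A) (sym (·-distribˡ z u v)) (⊞-intro u∈ v∈)

      A/z-product : ∀ {x y} → x ∈ A/z → y ∈ A/z → x · y ∈ P/z²
      A/z-product {x} {y} x∈ y∈ =
        subst (_∈ P) (solve 3 (λ z x y → z :* x :* (z :* y) := z :* (z :* (x :* y))) refl z x y) (AA⊆P x∈ y∈)

      P/z²≤M : card P/z² ≤ M
      P/z²≤M = ≤-trans (≤-reflexive (trans (card-dilate z≢0 (λ x → P (z · x))) (card-dilate z≢0 P))) P≤M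

      -- Multiplication by z² carries A/z ∩ b (A/z) onto zA ∩ (z b)A, and z b lies in `B`.
      popular : ∀ {b} → b ∈ B/z → N ≤ card (A/z ∩ (b ⊙ A/z))
      popular {b} b∈ = begin
        N                                                   ≤⟨ N≤v b∈ ⟩
        card C                                              ≡⟨ sym (trans (card-dilate z≢0 (λ x → C (z · x))) (card-dilate z≢0 C)) ⟩
        card (λ x → C (z · (z · x)))                        ≤⟨ card-mono {λ x → C (z · (z · x))} {A/z ∩ (b ⊙ A/z)} inclusion ⟩
        card (A/z ∩ (b ⊙ A/z))                              ∎
        where
        C = ((z · b) ⊙ A) ∩ (z ⊙ A)
        inclusion : ∀ {x} → z · (z · x) ∈ C → x ∈ A/z ∩ (b ⊙ A/z)
        inclusion {x} h = ∧-intro (from-z (⊙-elim (proj₂ (∧-elim {((z · b) ⊙ A) _} h)))) (from-zb (⊙-elim (proj₁ (∧-elim h))))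
          where
          from-z : (∃ λ s → s ∈ A × z · (z · x) ≡ z · s) → x ∈ A/z
          from-z (s , s∈ , e) = subst (_∈ A) (sym (·-cancelˡ z≢0 e)) s∈
          from-zb : (∃ λ s → s ∈ A × z · (z · x) ≡ z · b · s) → x ∈ b ⊙ A/z
          from-zb (s , s∈ , e) = subst (_∈ b ⊙ A/z) (·-cancelˡ z≢0 eq) (⊙-intro (subst (_∈ A) (sym (·inv-cancel z≢0 s)) s∈))
            where
            eq : z · (b · (inv z · s)) ≡ z · x
            eq = trans (solve 4 (λ z b i s → z :* (b :* (i :* s)) := b :* (z :* (i :* s))) refl z b (inv z) s)
                   (trans (cong (b ·_) (·inv-cancel z≢0 s)) (sym (·-cancelˡ z≢0 (trans e (·-assoc z b s)))))

      -- Multiplication by `z` carries A/z ∩ G onto A ∩ zG, so allowing dilates of subfields in the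
      -- hypothesis is what makes it survive rescaling.
      sparse/z : ∀ G → IsSubfield G → card (A/z ∩ G) ^ 175 ≤ card G ^ 98 ⊔ card A/z ^ 150
      sparse/z G G-subfield = begin
        card (A/z ∩ G) ^ 175                  ≤⟨ ^-monoˡ-≤ 175 inclusion ⟩
        card (A ∩ affine z G 0#) ^ 175        ≤⟨ sparse G G-subfield z 0# ⟩
        card G ^ 98 ⊔ card A ^ 150            ≡⟨ cong (λ n → card G ^ 98 ⊔ n ^ 150) (sym card-A/z) ⟩
        card G ^ 98 ⊔ card A/z ^ 150          ∎
        where
        inclusion : card (A/z ∩ G) ≤ card (A ∩ affine z G 0#)
        inclusion = ≤-trans (card-mono {A/z ∩ G} {λ x → (A ∩ affine z G 0#) (z · x)} λ {x} h → ∧-intro (proj₁ (∧-elim h))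
            (subst (_∈ affine z G 0#) (+ᶠ-identityʳ (z · x)) (affine-intro {z} {G} {0#} (proj₂ (∧-elim {A/z x} h)))))
          (≤-reflexive (card-dilate z≢0 (A ∩ affine z G 0#)))

      rescaled : card A ^ 15 ≤ (t * (M * L)) ^ 14
      rescaled = subst (λ n → n ^ 15 ≤ (t * (M * L)) ^ 14) card-A/z
        (normalised-sum-product 4≤t 256≤t⁴ {A/z} {B/z} {P/z²} A/z-nonzero (subst (1 ≤_) (sym card-A/z) 1≤A) 1≤L A/z⊞A/z≤M A/z-product P/z²≤M
          (λ b∈ → B⊆A b∈) 1≤N popular
          (subst (λ n → n * n ≤ 2 * M * N) (sym card-A/z) large)
          (subst₂ (λ n m → n * n * n ≤ 2 * M * (suc L * (N * m))) (sym card-A/z) (sym (card-dilate z≢0 B)) mass)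
          sparse/z)

    sum-product : card A ^ 15 ≤ (t * (M * L)) ^ 14
    sum-product = from-popular (popular-dilate nonzero AA⊆P P≤M 1≤A)
      where
      1≤M : 1 ≤ M
      1≤M = ≤-trans (≤-trans 1≤A (card≤card-⊞ʳ (proj₂ (1≤card⇒∃ 1≤A)))) A⊞A≤M
      from-popular : (∃ λ z → z ∈ A × card A * card A * card A ≤ M * ∑ (λ b → ⟦ A b ⟧ * card ((b ⊙ A) ∩ (z ⊙ A)))) →
                     card A ^ 15 ≤ (t * (M * L)) ^ 14
      from-popular (z , z∈A , energy) = Rescale.rescaled z∈A (level-set 1≤M small energy)
        where
        small : ∀ b → card ((b ⊙ A) ∩ (z ⊙ A)) < 2 ^ suc L
        small b = ≤-<-trans (card-mono {(b ⊙ A) ∩ (z ⊙ A)} {z ⊙ A} (λ {x} h → proj₂ (∧-elim {(b ⊙ A) x} h)))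
                    (subst (_< 2 ^ suc L) (sym (card-⊙ (nonzero z∈A) A)) A<2^)

  opaque
    unfolding card

    sum-product-estimate : ∀ {t} → 4 ≤ t → 256 ≤ t ^ 4 → ∀ A → (∀ x → A x ≡ true → x ≢ 0#) → 2 ≤ ∣ A ∣ →
      (∀ G → IsSubfield G → ∀ c d → ∣ A ∩ affine c G d ∣ ^ 175 ≤ (∣ G ∣ ^ 98) ⊔ (∣ A ∣ ^ 150)) →
      ∣ A ∣ ^ 15 ≤ (t * ((∣ sumset A ∣ ⊔ ∣ prodset A ∣) * ⌊log₂ ∣ A ∣ ⌋)) ^ 14
    sum-product-estimate 4≤t 256≤t⁴ A nonzero 2≤A sparse =
      sum-product 4≤t 256≤t⁴ {A} {prodset A} (λ {x} x∈ → nonzero x x∈) (≤-trans (s≤s z≤n) 2≤A) (⌊log₂⌋-mono-≤ 2≤A) (n<2^[1+⌊log₂n⌋] ∣ A ∣)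
        (≤-trans (card-mono inclusion) (m≤m⊔n ∣ sumset A ∣ ∣ prodset A ∣)) prodset-intro (m≤n⊔m ∣ sumset A ∣ ∣ prodset A ∣) sparse
      where
      inclusion : A ⊞ A ⊆ sumset A
      inclusion x∈ with ⊞-elim x∈
      ... | u , v , u∈ , v∈ , refl = sumset-intro u∈ v∈

-- The hypothesis is raised to the power 175, the least common multiple of 25 and 7: 175 · 14/25 =
-- 98 and 175 · 6/7 = 150. The conclusion is raised to the power 14. Taking the floor of the binary
-- logarithm only strengthens the bound; |A| ≥ 2 makes it positive.
theorem4 : ∃ λ (C : ℕ) → 1 ≤ C ×
    ((p n : ℕ) → Prime p → (F : FiniteField (p ^ n)) →
    let open FiniteField F renaming (_*_ to _·_) in
    (A : Subset) →
    (∀ x → A x ≡ true → x ≢ 0#) →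
    2 ≤ ∣ A ∣ →
    (∀ (G : Subset) → IsSubfield G → ∀ c d →
    ∣ A ∩ affine c G d ∣ ^ 175 ≤ (∣ G ∣ ^ 98) ⊔ (∣ A ∣ ^ 150)) →
    ∣ A ∣ ^ 15 ≤ (C * ((∣ sumset A ∣ ⊔ ∣ prodset A ∣) * ⌊log₂ ∣ A ∣ ⌋)) ^ 14)
-- 4 satisfies both demands on the constant with equality, as 4⁴ = 256.
theorem4 = 4 , s≤s z≤n , λ p n _ F → SumProduct.sum-product-estimate F ≤-refl ≤-refl
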